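{- Let $k\ge2$ and for $n\ge0$ let $ud(n)$ be the number of up-down permutations of length $n$ that contain $1\mbox{ - }3\mbox{ - }2$ exactly once and contain $1\mbox{ - }2\mbox{ - }\cdots\mbox{ - }k$ exactly once. Writing $U_r$ for $U_r\!\left(\frac1{2x}\right)$, $$\sum_{n\ge0}ud(n)x^n=\frac{1}{U_{k-1}^2}\sum_{j=0}^{k-3}\frac{U_{j+1}\bigl(U_{j+1}+xU_j\bigr)+2x\sum_{i=0}^{j-1}U_iU_{i+1}}{U_{j+1}U_{j+2}}.$$
   Context: A permutation of length $n$ is a word $\pi_1\cdots\pi_n$ containing each of $1,\dots,n$ exactly once. A classical pattern $\tau$ of length $m$ (written with dashes) occurs in $\pi$ at indices $i_1<\dots<i_m$ if $\pi_{i_1}\cdots\pi_{i_m}$ is order-isomorphic to $\tau$; containing $\tau$ exactly once means there is exactly one such index tuple. $1\mbox{ - }3\mbox{ - }2$ is the pattern $132$ and $1\mbox{ - }2\mbox{ - }\cdots\mbox{ - }k$ is $12\cdots k$. An up-down permutation is one of odd length $n\ge3$ with $\pi_1<\pi_2>\pi_3<\cdots>\pi_n$; there are none of length $0$, $1$ or of even length. $U_r$ is the Chebyshev polynomial of the second kind, $U_r(\cos\theta)=\sin((r+1)\theta)/\sin\theta$; $U_0=1$, $U_1(t)=2t$, $U_r(t)=2tU_{r-1}(t)-U_{r-2}(t)$. An empty sum equals $0$. -}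

module Defs where

open import Data.Bool using (Bool; true; false; _∧_; if_then_else_)
open import Data.Nat as ℕ using (ℕ; zero; suc; _∸_; _⊔_; _<ᵇ_; _≡ᵇ_; _≤ᵇ_)
open import Data.Integer as ℤ using (ℤ; +_; -[1+_])
open import Data.Rational as ℚ using (ℚ; 0ℚ; 1ℚ; ½; _/_)
open import Data.Rational.Properties using () renaming (_≟_ to _≟ℚ_)
open import Data.List using (List; []; _∷_; [_]; map; concatMap; _++_; length; upTo; zipWith; foldr)
open import Data.Product using (_×_; _,_)
open import Relation.Nullary using (yes; no)

range : ℕ → List ℕ
range n = map suc (upTo n)

words : ℕ → ℕ → List (List ℕ)
words zero    n = [ [] ]
words (suc l) n = concatMap (λ a → map (a ∷_) (words l n)) (range n)

notIn : ℕ → List ℕ → Bool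
notIn a []       = true
notIn a (b ∷ bs) = (if a ≡ᵇ b then false else true) ∧ notIn a bs

distinct : List ℕ → Bool
distinct []       = true
distinct (a ∷ as) = notIn a as ∧ distinct as

-- permutations of length n: words of length n over {1..n} with distinct entries
-- (each permutation pi_1...pi_n appears exactly once in this list after filtering)

-- all choices of m indices i_1 < ... < i_m, returned as the subsequence
-- (one list element per index tuple, so multiplicities count index tuples)
subseqs : {A : Set} → ℕ → List A → List (List A)
subseqs zero    xs       = [ [] ]
subseqs (suc m) []       = []
subseqs (suc m) (x ∷ xs) = map (x ∷_) (subseqs m xs) ++ subseqs (suc m) xs

_==_ : Bool → Bool → Bool
true  == b = b
false == b = if b then false else true

compat : ℕ × ℕ → ℕ × ℕ → Bool
compat (a , b) (c , d) = ((a <ᵇ c) == (b <ᵇ d)) ∧ ((c <ᵇ a) == (d <ᵇ b))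

allPairs : List (ℕ × ℕ) → Bool
allPairs []       = true
allPairs (p ∷ ps) = foldr (λ q r → compat p q ∧ r) true ps ∧ allPairs ps

zipL : List ℕ → List ℕ → List (ℕ × ℕ)
zipL (a ∷ as) (b ∷ bs) = (a , b) ∷ zipL as bs
zipL _        _        = []

orderIso : List ℕ → List ℕ → Bool
orderIso u v = (length u ≡ᵇ length v) ∧ allPairs (zipL u v)

countᵇ : {A : Set} → (A → Bool) → List A → ℕ
countᵇ p []       = 0
countᵇ p (x ∷ xs) = (if p x then 1 else 0) ℕ.+ countᵇ p xs

occ : List ℕ → List ℕ → ℕ
occ τ π = countᵇ (orderIso τ) (subseqs (length τ) π)

p132 : List ℕ
p132 = 1 ∷ 3 ∷ 2 ∷ []

inc : ℕ → List ℕ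
inc k = range k

-- up-down: odd length n ≥ 3 with π1 < π2 > π3 < ... > πn
mutual
  altUp : List ℕ → Bool
  altUp []            = true
  altUp (a ∷ [])      = true
  altUp (a ∷ b ∷ r)   = (a <ᵇ b) ∧ altDown (b ∷ r)

  altDown : List ℕ → Bool
  altDown []          = false
  altDown (a ∷ [])    = false
  altDown (a ∷ b ∷ r) = (b <ᵇ a) ∧ altUp (b ∷ r)

upDown : List ℕ → Bool
upDown π = (3 ≤ᵇ length π) ∧ altUp π

ud : ℕ → ℕ → ℕ
ud k n = countᵇ (λ π → distinct π ∧ upDown π ∧ (occ p132 π ≡ᵇ 1) ∧ (occ (inc k) π ≡ᵇ 1))
                (words n n)

PS : Set
PS = ℕ → ℚ

sumTo : ℕ → (ℕ → ℚ) → ℚ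
sumTo zero    f = 0ℚ
sumTo (suc n) f = sumTo n f ℚ.+ f n

mulPS : PS → PS → PS
mulPS a b n = sumTo (suc n) (λ i → a i ℚ.* b (n ∸ i))

shiftPS : ℕ → PS → PS
shiftPS m s n = if n <ᵇ m then 0ℚ else s (n ∸ m)

inv0 : ℚ → ℚ
inv0 q with q ≟ℚ 0ℚ
... | yes _  = 0ℚ
... | no q≢0 = ℚ.1/_ q {{ℚ.≢-nonZero q≢0}}

-- [b_n, ..., b_0] for the reciprocal b of s (meaningful when s 0 ≠ 0)
invList : PS → ℕ → List ℚ
invList s zero    = [ inv0 (s 0) ]
invList s (suc n) = let bs = invList s n in
  (ℚ.- (inv0 (s 0) ℚ.* foldr ℚ._+_ 0ℚ (zipWith ℚ._*_ (map s (range (suc n))) bs))) ∷ bs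

headQ : List ℚ → ℚ
headQ []      = 0ℚ
headQ (q ∷ _) = q

invPS : PS → PS
invPS s n = headQ (invList s n)

-- Laurent series x^(-shift) * ser
record Laurent : Set where
  constructor laurent
  field
    shift : ℕ
    ser   : PS
open Laurent public

coeffL : Laurent → ℤ → ℚ
coeffL (laurent m s) e with e ℤ.+ + m
... | + n      = s n
... | -[1+ _ ] = 0ℚ

constL : ℚ → Laurent
constL q = laurent 0 (λ { zero → q ; (suc _) → 0ℚ })

zeroL oneL xL : Laurent
zeroL = constL 0ℚ
oneL  = constL 1ℚ
xL    = laurent 0 (λ { 1 → 1ℚ ; _ → 0ℚ })

tL : Laurent
tL = laurent 1 (λ { zero → ½ ; (suc _) → 0ℚ })

infixl 6 _+L_
infixl 7 _*L_

_+L_ : Laurent → Laurent → Laurent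
laurent m s +L laurent m' s' =
  laurent (m ⊔ m') (λ n → shiftPS (m ⊔ m' ∸ m) s n ℚ.+ shiftPS (m ⊔ m' ∸ m') s' n)

_*L_ : Laurent → Laurent → Laurent
laurent m s *L laurent m' s' = laurent (m ℕ.+ m') (mulPS s s')

-L_ : Laurent → Laurent
-L laurent m s = laurent m (λ n → ℚ.- s n)

-- reciprocal of x^(-m) s, valid whenever s 0 ≠ 0 (true for every use below)
recipL : Laurent → Laurent
recipL (laurent m s) = laurent 0 (shiftPS m (invPS s))

sumL : ℕ → (ℕ → Laurent) → Laurent
sumL zero    f = zeroL
sumL (suc n) f = sumL n f +L f n

chebU : Laurent → ℕ → Laurent
chebU t zero          = oneL
chebU t (suc zero)    = constL (+ 2 / 1) *L t
chebU t (suc (suc r)) = (constL (+ 2 / 1) *L t) *L chebU t (suc r) +L (-L chebU t r)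

U : ℕ → Laurent
U = chebU tL

gf : (ℕ → ℕ) → Laurent
gf f = laurent 0 (λ n → + f n / 1)

rhs : ℕ → Laurent
rhs k = recipL (U (k ∸ 1) *L U (k ∸ 1)) *L
  sumL (k ∸ 2) (λ j →
    ((U (suc j) *L (U (suc j) +L (xL *L U j)))
       +L (constL (+ 2 / 1) *L xL *L sumL j (λ i → U i *L U (suc i))))
    *L recipL (U (suc j) *L U (suc (suc j))))

{-# OPTIONS --safe #-}
-- A permutation that avoids 132 has the form L N R with N its maximum and every letter of L above every letter of R;
-- if it is alternating of odd length, then so are L and R, and it ends with its smallest letter.  Such permutations
-- are read off binary trees.  If 132 occurs exactly once, then either the occurrence lies inside L or inside R, or it
-- uses N; in the last case the word arises from one with L above R by exchanging the last (smallest) letter of L with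
-- the largest letter of R, two consecutive values.  So these permutations are the trees with one marked inner node.
-- In both cases 12⋯k occurs occₖ(L) + occₖ₋₁(L) + occₖ(R) times in L N R for k ≥ 3.  Let A and B (F and E) be the
-- generating functions of the unmarked (marked) trees with no and with exactly one occurrence of 12⋯k.  Then
--   Aₖ = x (1 + Aₖ₋₁ Aₖ),               Bₖ = x (Bₖ₋₁ Aₖ + Aₖ₋₁ Bₖ),
--   Fₖ = x (Fₖ₋₁ Aₖ + Aₖ₋₁ Fₖ + Aₖ₋₁ Aₖ),
--   Eₖ = x (Eₖ₋₁ Aₖ + Fₖ₋₁ Bₖ + Bₖ₋₁ Fₖ + Aₖ₋₁ Eₖ + Bₖ₋₁ Aₖ + Aₖ₋₁ Bₖ),
-- and each of these linear equations is solved by multiplying with Uₖ₋₂: Aₖ = Uₖ₋₂ / Uₖ₋₁, Bₖ = x / Uₖ₋₁²,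
-- Fₖ = (U₀U₁ + ⋯ + Uₖ₋₃Uₖ₋₂) / Uₖ₋₁², and Uₖ₋₁² Eₖ is the sum in the theorem.
module Submission where

open import Defs
open import Data.Nat using (ℕ; _≤_)
open import Data.Integer using (ℤ)
open import Relation.Binary.PropositionalEquality using (_≡_)
open import Algebra.Bundles using (CommutativeSemiring)
import Algebra.Solver.Ring.NaturalCoefficients.Default as SemiringSolver
open import Algebra.Structures.Biased using (isCommutativeMonoidˡ; isCommutativeSemiringˡ)
open import Data.Bool using (Bool; true; false; _∧_; if_then_else_; T)
open import Data.Bool.Properties using (T?)
open import Data.Empty using (⊥; ⊥-elim)
open import Data.Integer as ℤ using (+_; -[1+_])
import Data.Integer.Properties as ℤₚ
open import Data.List using (List; []; _∷_; [_]; map; concatMap; _++_; length; upTo; applyUpTo; zipWith; foldr; filterᵇ; cartesianProduct)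
import Data.List.Properties as Listₚ
open import Data.List.Membership.Propositional using (_∈_)
import Data.List.Membership.Propositional.Properties as ∈ₚ
open import Data.List.Membership.Propositional.Properties.WithK using (unique∧set⇒bag)
open import Data.List.Relation.Binary.BagAndSetEquality using (∼bag⇒↭)
open import Data.List.Relation.Unary.All as All using (All; []; _∷_)
import Data.List.Relation.Unary.All.Properties as Allₚ
open import Data.List.Relation.Unary.Any using (here; there)
open import Data.List.Relation.Unary.AllPairs using (AllPairs; []; _∷_)
import Data.List.Relation.Unary.AllPairs.Properties as AllPairsₚ
open import Data.List.Relation.Unary.Unique.Propositional using (Unique)
import Data.List.Relation.Unary.Unique.Propositional.Properties as Uniqueₚ
open import Data.List.Relation.Binary.Permutation.Propositional using (_↭_; ↭-sym; ↭-trans; ↭-refl)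
import Data.List.Relation.Binary.Permutation.Propositional as ↭
import Data.List.Relation.Binary.Permutation.Setoid.Properties as ↭ₛₚ
import Data.List.Relation.Binary.Permutation.Propositional.Properties as ↭ₚ
open import Data.Nat using (zero; suc; _+_; _*_; _∸_; _⊔_; _<_; _<ᵇ_; _≡ᵇ_; _≤ᵇ_; z≤n; s≤s)
import Data.Nat.Properties as ℕₚ
open import Relation.Binary.Definitions using (tri<; tri≈; tri>)
open import Data.Nat.Solver using (module +-*-Solver)
open import Data.Product using (∃; _×_; _,_; proj₁; proj₂; uncurry)
open import Data.Rational as ℚ using (ℚ; 0ℚ; 1ℚ; _/_)
import Data.Rational.Properties as ℚₚ
import Data.Rational.Unnormalised as ℚᵘ
import Data.Rational.Unnormalised.Properties as ℚᵘₚ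
import Data.Sum
open import Data.Sum using (_⊎_; inj₁; inj₂)
open import Function using (_∘_; mk⇔)
import Relation.Binary.Reasoning.Setoid as SetoidReasoning
open import Relation.Binary.Structures using (IsEquivalence)
open import Relation.Binary.PropositionalEquality using (refl; sym; trans; cong; cong₂; subst; _≢_; _≗_; module ≡-Reasoning) renaming (setoid to ≡-setoid)
open import Level using (0ℓ)
open import Relation.Nullary using (yes; no)

-- Formal power series

-- A 132 that lies inside neither L nor R has its 1 in L and its 2 in R, so it rests on a pair l < r
-- with l in L and r in R, and each such pair already gives l N r. A single occurrence therefore
-- allows a single pair. A letter y of L after l would lie above R, and l y r would be a second
-- occurrence; so l is the last letter of L and the rest of L lies above R. Exchanging l and r
-- restores L above R. The two parts then fill adjacent intervals in which r is the least value of
-- the upper and l the greatest of the lower one, which is why l and r are consecutive.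
--
-- The left part enters the equations with index k - 1 alone: an occurrence of 12⋯k in L contains k
-- of 12⋯(k-1), so occₖ(L) vanishes as soon as occₖ₋₁(L) ≤ 1. The pair l r is increasing too, but it
-- extends to nothing longer and is seen by 12 only. Together with l N it puts 12 at least twice
-- into every marked tree, so the equations for F and E start at k = 3 from F₂ = E₂ = 0.

sumTo-cong : ∀ n {f g : ℕ → ℚ} → (∀ i → i < n → f i ≡ g i) → sumTo n f ≡ sumTo n g
sumTo-cong zero    e = refl
sumTo-cong (suc n) e = cong₂ ℚ._+_ (sumTo-cong n (λ i i<n → e i (ℕₚ.m<n⇒m<1+n i<n))) (e n ℕₚ.≤-refl)

sumTo-front : ∀ n (f : ℕ → ℚ) → sumTo (suc n) f ≡ f 0 ℚ.+ sumTo n (f ∘ suc)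
sumTo-front zero    f = ℚₚ.+-comm 0ℚ (f 0)
sumTo-front (suc n) f = trans (cong (ℚ._+ f (suc n)) (sumTo-front n f)) (ℚₚ.+-assoc (f 0) (sumTo n (f ∘ suc)) (f (suc n)))

addPS : PS → PS → PS
addPS a b n = a n ℚ.+ b n

scale : ℚ → PS → PS
scale q a n = q ℚ.* a n

zeroPS : PS
zeroPS _ = 0ℚ

-- Splitting off one end of the sum leaves a product of a shifted series at a smaller index. The
-- ring laws below are inductions on the index that use this; commutativity plays it against
-- `mulPS-tailʳ`.
mulPS-tailˡ : ∀ a b n → mulPS a b (suc n) ≡ a 0 ℚ.* b (suc n) ℚ.+ mulPS (a ∘ suc) b n
mulPS-tailˡ a b n = sumTo-front (suc n) (λ i → a i ℚ.* b (suc n ∸ i))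

mulPS-tailʳ : ∀ a b n → mulPS a b (suc n) ≡ mulPS a (b ∘ suc) n ℚ.+ a (suc n) ℚ.* b 0
mulPS-tailʳ a b n = cong₂ ℚ._+_
  (sumTo-cong (suc n) (λ i i<1+n → cong (λ m → a i ℚ.* b m) (ℕₚ.+-∸-assoc 1 (ℕₚ.≤-pred i<1+n))))
  (cong (λ m → a (suc n) ℚ.* b m) (ℕₚ.n∸n≡0 n))

mulPS-head : ∀ a b → mulPS a b 0 ≡ a 0 ℚ.* b 0
mulPS-head a b = ℚₚ.+-identityˡ (a 0 ℚ.* b 0)

mulPS-cong : ∀ {a a′ b b′} → a ≗ a′ → b ≗ b′ → mulPS a b ≗ mulPS a′ b′
mulPS-cong ea eb n = sumTo-cong (suc n) (λ i _ → cong₂ ℚ._*_ (ea i) (eb (n ∸ i)))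

mulPS-comm : ∀ a b → mulPS a b ≗ mulPS b a
mulPS-comm a b zero    = trans (mulPS-head a b) (trans (ℚₚ.*-comm (a 0) (b 0)) (sym (mulPS-head b a)))
mulPS-comm a b (suc n) = begin
  mulPS a b (suc n)                              ≡⟨ mulPS-tailˡ a b n ⟩
  a 0 ℚ.* b (suc n) ℚ.+ mulPS (a ∘ suc) b n      ≡⟨ cong₂ ℚ._+_ (ℚₚ.*-comm (a 0) (b (suc n))) (mulPS-comm (a ∘ suc) b n) ⟩
  b (suc n) ℚ.* a 0 ℚ.+ mulPS b (a ∘ suc) n      ≡⟨ ℚₚ.+-comm (b (suc n) ℚ.* a 0) (mulPS b (a ∘ suc) n) ⟩
  mulPS b (a ∘ suc) n ℚ.+ b (suc n) ℚ.* a 0      ≡⟨ mulPS-tailʳ b a n ⟨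
  mulPS b a (suc n)                              ∎
  where open ≡-Reasoning

+-interchange : ∀ p q r s → (p ℚ.+ q) ℚ.+ (r ℚ.+ s) ≡ (p ℚ.+ r) ℚ.+ (q ℚ.+ s)
+-interchange p q r s = begin
  (p ℚ.+ q) ℚ.+ (r ℚ.+ s)  ≡⟨ ℚₚ.+-assoc p q (r ℚ.+ s) ⟩
  p ℚ.+ (q ℚ.+ (r ℚ.+ s))  ≡⟨ cong (p ℚ.+_) (ℚₚ.+-assoc q r s) ⟨
  p ℚ.+ ((q ℚ.+ r) ℚ.+ s)  ≡⟨ cong (λ t → p ℚ.+ (t ℚ.+ s)) (ℚₚ.+-comm q r) ⟩
  p ℚ.+ ((r ℚ.+ q) ℚ.+ s)  ≡⟨ cong (p ℚ.+_) (ℚₚ.+-assoc r q s) ⟩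
  p ℚ.+ (r ℚ.+ (q ℚ.+ s))  ≡⟨ ℚₚ.+-assoc p r (q ℚ.+ s) ⟨
  (p ℚ.+ r) ℚ.+ (q ℚ.+ s)  ∎
  where open ≡-Reasoning

mulPS-distribʳ : ∀ c a b → mulPS (addPS a b) c ≗ addPS (mulPS a c) (mulPS b c)
mulPS-distribʳ c a b zero = trans (mulPS-head (addPS a b) c)
  (trans (ℚₚ.*-distribʳ-+ (c 0) (a 0) (b 0)) (sym (cong₂ ℚ._+_ (mulPS-head a c) (mulPS-head b c))))
mulPS-distribʳ c a b (suc n) = begin
  mulPS (addPS a b) c (suc n)
    ≡⟨ mulPS-tailˡ (addPS a b) c n ⟩
  (a 0 ℚ.+ b 0) ℚ.* c (suc n) ℚ.+ mulPS (addPS (a ∘ suc) (b ∘ suc)) c n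
    ≡⟨ cong₂ ℚ._+_ (ℚₚ.*-distribʳ-+ (c (suc n)) (a 0) (b 0)) (mulPS-distribʳ c (a ∘ suc) (b ∘ suc) n) ⟩
  (a 0 ℚ.* c (suc n) ℚ.+ b 0 ℚ.* c (suc n)) ℚ.+ (mulPS (a ∘ suc) c n ℚ.+ mulPS (b ∘ suc) c n)
    ≡⟨ +-interchange (a 0 ℚ.* c (suc n)) (b 0 ℚ.* c (suc n)) (mulPS (a ∘ suc) c n) (mulPS (b ∘ suc) c n) ⟩
  (a 0 ℚ.* c (suc n) ℚ.+ mulPS (a ∘ suc) c n) ℚ.+ (b 0 ℚ.* c (suc n) ℚ.+ mulPS (b ∘ suc) c n)
    ≡⟨ cong₂ ℚ._+_ (mulPS-tailˡ a c n) (mulPS-tailˡ b c n) ⟨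
  mulPS a c (suc n) ℚ.+ mulPS b c (suc n) ∎
  where open ≡-Reasoning

mulPS-scaleˡ : ∀ q a b → mulPS (scale q a) b ≗ scale q (mulPS a b)
mulPS-scaleˡ q a b zero = trans (mulPS-head (scale q a) b)
  (trans (ℚₚ.*-assoc q (a 0) (b 0)) (cong (q ℚ.*_) (sym (mulPS-head a b))))
mulPS-scaleˡ q a b (suc n) = begin
  mulPS (scale q a) b (suc n)
    ≡⟨ mulPS-tailˡ (scale q a) b n ⟩
  (q ℚ.* a 0) ℚ.* b (suc n) ℚ.+ mulPS (scale q (a ∘ suc)) b n
    ≡⟨ cong₂ ℚ._+_ (ℚₚ.*-assoc q (a 0) (b (suc n))) (mulPS-scaleˡ q (a ∘ suc) b n) ⟩
  q ℚ.* (a 0 ℚ.* b (suc n)) ℚ.+ q ℚ.* mulPS (a ∘ suc) b n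
    ≡⟨ ℚₚ.*-distribˡ-+ q (a 0 ℚ.* b (suc n)) (mulPS (a ∘ suc) b n) ⟨
  q ℚ.* (a 0 ℚ.* b (suc n) ℚ.+ mulPS (a ∘ suc) b n)
    ≡⟨ cong (q ℚ.*_) (mulPS-tailˡ a b n) ⟨
  q ℚ.* mulPS a b (suc n) ∎
  where open ≡-Reasoning

mulPS-assoc : ∀ a b c → mulPS (mulPS a b) c ≗ mulPS a (mulPS b c)
mulPS-assoc a b c zero = begin
  mulPS (mulPS a b) c 0     ≡⟨ mulPS-head (mulPS a b) c ⟩
  mulPS a b 0 ℚ.* c 0       ≡⟨ cong (ℚ._* c 0) (mulPS-head a b) ⟩
  (a 0 ℚ.* b 0) ℚ.* c 0     ≡⟨ ℚₚ.*-assoc (a 0) (b 0) (c 0) ⟩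
  a 0 ℚ.* (b 0 ℚ.* c 0)     ≡⟨ cong (a 0 ℚ.*_) (mulPS-head b c) ⟨
  a 0 ℚ.* mulPS b c 0       ≡⟨ mulPS-head a (mulPS b c) ⟨
  mulPS a (mulPS b c) 0     ∎
  where open ≡-Reasoning
mulPS-assoc a b c (suc n) = begin
  mulPS (mulPS a b) c (suc n)
    ≡⟨ mulPS-tailˡ (mulPS a b) c n ⟩
  mulPS a b 0 ℚ.* c (suc n) ℚ.+ mulPS (mulPS a b ∘ suc) c n
    ≡⟨ cong₂ ℚ._+_ (cong (ℚ._* c (suc n)) (mulPS-head a b)) (mulPS-cong {b = c} (mulPS-tailˡ a b) (λ _ → refl) n) ⟩
  -- The tail of `mulPS a b` is a scaled series plus a product with the shorter factor `a ∘ suc`, so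
  -- distributivity and scaling make room for the induction hypothesis.
  (a 0 ℚ.* b 0) ℚ.* c (suc n) ℚ.+ mulPS (addPS (scale (a 0) (b ∘ suc)) (mulPS (a ∘ suc) b)) c n
    ≡⟨ cong₂ ℚ._+_ (ℚₚ.*-assoc (a 0) (b 0) (c (suc n))) (mulPS-distribʳ c (scale (a 0) (b ∘ suc)) (mulPS (a ∘ suc) b) n) ⟩
  a 0 ℚ.* (b 0 ℚ.* c (suc n)) ℚ.+ (mulPS (scale (a 0) (b ∘ suc)) c n ℚ.+ mulPS (mulPS (a ∘ suc) b) c n)
    ≡⟨ cong (a 0 ℚ.* (b 0 ℚ.* c (suc n)) ℚ.+_) (cong₂ ℚ._+_ (mulPS-scaleˡ (a 0) (b ∘ suc) c n) (mulPS-assoc (a ∘ suc) b c n)) ⟩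
  a 0 ℚ.* (b 0 ℚ.* c (suc n)) ℚ.+ (a 0 ℚ.* mulPS (b ∘ suc) c n ℚ.+ mulPS (a ∘ suc) (mulPS b c) n)
    ≡⟨ ℚₚ.+-assoc (a 0 ℚ.* (b 0 ℚ.* c (suc n))) (a 0 ℚ.* mulPS (b ∘ suc) c n) (mulPS (a ∘ suc) (mulPS b c) n) ⟨
  (a 0 ℚ.* (b 0 ℚ.* c (suc n)) ℚ.+ a 0 ℚ.* mulPS (b ∘ suc) c n) ℚ.+ mulPS (a ∘ suc) (mulPS b c) n
    ≡⟨ cong (ℚ._+ mulPS (a ∘ suc) (mulPS b c) n) (ℚₚ.*-distribˡ-+ (a 0) (b 0 ℚ.* c (suc n)) (mulPS (b ∘ suc) c n)) ⟨
  a 0 ℚ.* (b 0 ℚ.* c (suc n) ℚ.+ mulPS (b ∘ suc) c n) ℚ.+ mulPS (a ∘ suc) (mulPS b c) n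
    ≡⟨ cong (λ q → a 0 ℚ.* q ℚ.+ mulPS (a ∘ suc) (mulPS b c) n) (mulPS-tailˡ b c n) ⟨
  a 0 ℚ.* mulPS b c (suc n) ℚ.+ mulPS (a ∘ suc) (mulPS b c) n
    ≡⟨ mulPS-tailˡ a (mulPS b c) n ⟨
  mulPS a (mulPS b c) (suc n) ∎
  where open ≡-Reasoning

mulPS-zeroˡ : ∀ b → mulPS zeroPS b ≗ zeroPS
mulPS-zeroˡ b zero    = trans (mulPS-head zeroPS b) (ℚₚ.*-zeroˡ (b 0))
mulPS-zeroˡ b (suc n) = trans (mulPS-tailˡ zeroPS b n)
  (trans (cong₂ ℚ._+_ (ℚₚ.*-zeroˡ (b (suc n))) (mulPS-zeroˡ b n)) (ℚₚ.+-identityʳ 0ℚ))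

mulPS-constˡ : ∀ q b → mulPS (ser (constL q)) b ≗ scale q b
mulPS-constˡ q b zero    = mulPS-head (ser (constL q)) b
mulPS-constˡ q b (suc n) = trans (mulPS-tailˡ (ser (constL q)) b n)
  (trans (cong (q ℚ.* b (suc n) ℚ.+_) (mulPS-zeroˡ b n)) (ℚₚ.+-identityʳ (q ℚ.* b (suc n))))

-- Multiplication by powers of x

shiftPS-+ : ∀ i j s → shiftPS i (shiftPS j s) ≗ shiftPS (i + j) s
shiftPS-+ zero    j s n       = refl
shiftPS-+ (suc i) j s zero    = refl
shiftPS-+ (suc i) j s (suc n) = shiftPS-+ i j s n

shiftPS-cong : ∀ i {s t} → s ≗ t → shiftPS i s ≗ shiftPS i t
shiftPS-cong zero    e n       = e n
shiftPS-cong (suc i) e zero    = refl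
shiftPS-cong (suc i) e (suc n) = shiftPS-cong i e n

shiftPS-swap : ∀ i j s → shiftPS i (shiftPS j s) ≗ shiftPS j (shiftPS i s)
shiftPS-swap i j s n = trans (shiftPS-+ i j s n)
  (trans (cong (λ m → shiftPS m s n) (ℕₚ.+-comm i j)) (sym (shiftPS-+ j i s n)))

shiftPS-at : ∀ i s n → shiftPS i s (i + n) ≡ s n
shiftPS-at zero    s n = refl
shiftPS-at (suc i) s n = shiftPS-at i s n

shiftPS-injective : ∀ i {s t} → shiftPS i s ≗ shiftPS i t → s ≗ t
shiftPS-injective i {s} {t} e n = trans (sym (shiftPS-at i s n)) (trans (e (i + n)) (shiftPS-at i t n))

shiftPS-add : ∀ i s t → shiftPS i (addPS s t) ≗ addPS (shiftPS i s) (shiftPS i t)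
shiftPS-add zero    s t n       = refl
shiftPS-add (suc i) s t zero    = sym (ℚₚ.+-identityʳ 0ℚ)
shiftPS-add (suc i) s t (suc n) = shiftPS-add i s t n

shiftPS-zero : ∀ i → shiftPS i zeroPS ≗ zeroPS
shiftPS-zero zero    n       = refl
shiftPS-zero (suc i) zero    = refl
shiftPS-zero (suc i) (suc n) = shiftPS-zero i n

mulPS-shiftˡ : ∀ i s t → mulPS (shiftPS i s) t ≗ shiftPS i (mulPS s t)
mulPS-shiftˡ zero    s t n       = refl
mulPS-shiftˡ (suc i) s t zero    = trans (mulPS-head (shiftPS (suc i) s) t) (ℚₚ.*-zeroˡ (t 0))
mulPS-shiftˡ (suc i) s t (suc n) = trans (mulPS-tailˡ (shiftPS (suc i) s) t n)
  (trans (cong (ℚ._+ mulPS (shiftPS i s) t n) (ℚₚ.*-zeroˡ (t (suc n))))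
    (trans (ℚₚ.+-identityˡ (mulPS (shiftPS i s) t n)) (mulPS-shiftˡ i s t n)))

mulPS-shiftʳ : ∀ i s t → mulPS s (shiftPS i t) ≗ shiftPS i (mulPS s t)
mulPS-shiftʳ i s t n = trans (mulPS-comm s (shiftPS i t) n)
  (trans (mulPS-shiftˡ i t s n) (shiftPS-cong i (mulPS-comm t s) n))

-- Reciprocals of power series

inv0-inverse : ∀ q → q ≢ 0ℚ → q ℚ.* inv0 q ≡ 1ℚ
inv0-inverse q q≢0 with q ℚₚ.≟ 0ℚ
... | yes q≡0 = ⊥-elim (q≢0 q≡0)
... | no  q≢0 = ℚₚ.*-inverseʳ q {{ℚ.≢-nonZero q≢0}}

-- The list holds the reciprocal's coefficients from index n down to 0, so zipping it with ascending
-- coefficients of `t` yields a Cauchy product. The reindexing `f` is general because the induction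
-- passes to `f ∘ suc`.
foldr-zip-invList : ∀ s (t : PS) (f : ℕ → ℕ) n →
  foldr ℚ._+_ 0ℚ (zipWith ℚ._*_ (map t (applyUpTo f (suc n))) (invList s n)) ≡ mulPS (t ∘ f) (invPS s) n
foldr-zip-invList s t f zero    = ℚₚ.+-comm (t (f 0) ℚ.* invPS s 0) 0ℚ
foldr-zip-invList s t f (suc n) = trans
  (cong (t (f 0) ℚ.* invPS s (suc n) ℚ.+_) (foldr-zip-invList s t (f ∘ suc) n))
  (sym (mulPS-tailˡ (t ∘ f) (invPS s) n))

mulPS-invPS : ∀ s → s 0 ≢ 0ℚ → mulPS s (invPS s) ≗ ser oneL
mulPS-invPS s s0≢0 zero    = trans (mulPS-head s (invPS s)) (inv0-inverse (s 0) s0≢0)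
mulPS-invPS s s0≢0 (suc n) = begin
  mulPS s (invPS s) (suc n)
    ≡⟨ mulPS-tailˡ s (invPS s) n ⟩
  s 0 ℚ.* (ℚ.- (inv0 (s 0) ℚ.* foldr ℚ._+_ 0ℚ (zipWith ℚ._*_ (map s (range (suc n))) (invList s n)))) ℚ.+ m
    ≡⟨ cong (λ xs → s 0 ℚ.* (ℚ.- (inv0 (s 0) ℚ.* foldr ℚ._+_ 0ℚ (zipWith ℚ._*_ (map s xs) (invList s n)))) ℚ.+ m)
         (Listₚ.map-upTo suc (suc n)) ⟩
  s 0 ℚ.* (ℚ.- (inv0 (s 0) ℚ.* foldr ℚ._+_ 0ℚ (zipWith ℚ._*_ (map s (applyUpTo suc (suc n))) (invList s n)))) ℚ.+ m
    ≡⟨ cong (λ q → s 0 ℚ.* (ℚ.- (inv0 (s 0) ℚ.* q)) ℚ.+ m) (foldr-zip-invList s s suc n) ⟩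
  s 0 ℚ.* (ℚ.- (inv0 (s 0) ℚ.* m)) ℚ.+ m
    ≡⟨ cong (ℚ._+ m) (ℚₚ.neg-distribʳ-* (s 0) (inv0 (s 0) ℚ.* m)) ⟨
  (ℚ.- (s 0 ℚ.* (inv0 (s 0) ℚ.* m))) ℚ.+ m
    ≡⟨ cong (λ q → (ℚ.- q) ℚ.+ m) (ℚₚ.*-assoc (s 0) (inv0 (s 0)) m) ⟨
  (ℚ.- ((s 0 ℚ.* inv0 (s 0)) ℚ.* m)) ℚ.+ m
    ≡⟨ cong (λ q → (ℚ.- (q ℚ.* m)) ℚ.+ m) (inv0-inverse (s 0) s0≢0) ⟩
  (ℚ.- (1ℚ ℚ.* m)) ℚ.+ m
    ≡⟨ cong (λ q → (ℚ.- q) ℚ.+ m) (ℚₚ.*-identityˡ m) ⟩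
  (ℚ.- m) ℚ.+ m
    ≡⟨ ℚₚ.+-inverseˡ m ⟩
  0ℚ ∎
  where open ≡-Reasoning
        m = mulPS (s ∘ suc) (invPS s) n

-- The commutative semiring of Laurent series

infix 4 _≈L_

-- x⁻ᵐ s and x⁻ⁿ t are the same series when xⁿ s = xᵐ t.
record _≈L_ (u v : Laurent) : Set where
  constructor cleared
  field
    clear : shiftPS (shift v) (ser u) ≗ shiftPS (shift u) (ser v)

shiftPS-mul : ∀ i j s t → shiftPS (i + j) (mulPS s t) ≗ mulPS (shiftPS i s) (shiftPS j t)
shiftPS-mul i j s t n = trans (sym (shiftPS-+ i j (mulPS s t) n))
  (trans (shiftPS-cong i (λ l → sym (mulPS-shiftʳ j s t l)) n) (sym (mulPS-shiftˡ i s (shiftPS j t) n)))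

≈L-strict : ∀ {u v} → shift u ≡ shift v → ser u ≗ ser v → u ≈L v
≈L-strict {laurent m s} {laurent .m t} refl e = cleared (shiftPS-cong m e)

≈L-refl : ∀ {u} → u ≈L u
≈L-refl = ≈L-strict refl (λ _ → refl)

≈L-sym : ∀ {u v} → u ≈L v → v ≈L u
≈L-sym (cleared e) = cleared (λ n → sym (e n))

≈L-trans : ∀ {u v w} → u ≈L v → v ≈L w → u ≈L w
≈L-trans {laurent m s} {laurent m′ s′} {laurent m″ s″} (cleared e) (cleared f) =
  -- The two hypotheses chain only after multiplication by the power of x that belongs to the middle
  -- series; that power is cancelled again.
  cleared (shiftPS-injective m′ λ n → begin
    shiftPS m′ (shiftPS m″ s) n   ≡⟨ shiftPS-swap m′ m″ s n ⟩
    shiftPS m″ (shiftPS m′ s) n   ≡⟨ shiftPS-cong m″ e n ⟩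
    shiftPS m″ (shiftPS m s′) n   ≡⟨ shiftPS-swap m″ m s′ n ⟩
    shiftPS m (shiftPS m″ s′) n   ≡⟨ shiftPS-cong m f n ⟩
    shiftPS m (shiftPS m′ s″) n   ≡⟨ shiftPS-swap m m′ s″ n ⟩
    shiftPS m′ (shiftPS m s″) n   ∎)
  where open ≡-Reasoning

shiftPS-∸ : ∀ {i j} → i ≤ j → ∀ s → shiftPS (j ∸ i) (shiftPS i s) ≗ shiftPS j s
shiftPS-∸ {i} {j} i≤j s n = trans (shiftPS-+ (j ∸ i) i s n) (cong (λ l → shiftPS l s n) (ℕₚ.m∸n+n≡m i≤j))

-- `_+L_` first raises both summands to the larger shift. Equal series stay equal when each is
-- raised to a target of its own, which is what each summand needs in `+L-cong`.
≈L-raise : ∀ {u v} → u ≈L v → ∀ {i j} → shift u ≤ i → shift v ≤ j →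
  shiftPS j (shiftPS (i ∸ shift u) (ser u)) ≗ shiftPS i (shiftPS (j ∸ shift v) (ser v))
≈L-raise {laurent m s} {laurent m′ s′} (cleared e) {i} {j} m≤i m′≤j n = begin
  shiftPS j (shiftPS (i ∸ m) s) n                        ≡⟨ shiftPS-swap j (i ∸ m) s n ⟩
  shiftPS (i ∸ m) (shiftPS j s) n                        ≡⟨ shiftPS-cong (i ∸ m) (shiftPS-∸ m′≤j s) n ⟨
  shiftPS (i ∸ m) (shiftPS (j ∸ m′) (shiftPS m′ s)) n    ≡⟨ shiftPS-cong (i ∸ m) (shiftPS-cong (j ∸ m′) e) n ⟩
  shiftPS (i ∸ m) (shiftPS (j ∸ m′) (shiftPS m s′)) n    ≡⟨ shiftPS-swap (i ∸ m) (j ∸ m′) (shiftPS m s′) n ⟩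
  shiftPS (j ∸ m′) (shiftPS (i ∸ m) (shiftPS m s′)) n    ≡⟨ shiftPS-cong (j ∸ m′) (shiftPS-∸ m≤i s′) n ⟩
  shiftPS (j ∸ m′) (shiftPS i s′) n                      ≡⟨ shiftPS-swap (j ∸ m′) i s′ n ⟩
  shiftPS i (shiftPS (j ∸ m′) s′) n                      ∎
  where open ≡-Reasoning

+L-cong : ∀ {u u′ v v′} → u ≈L u′ → v ≈L v′ → u +L v ≈L u′ +L v′
+L-cong {laurent m s} {laurent m′ s′} {laurent l t} {laurent l′ t′} e f = cleared λ n → begin
  shiftPS j (addPS (shiftPS (i ∸ m) s) (shiftPS (i ∸ l) t)) n
    ≡⟨ shiftPS-add j (shiftPS (i ∸ m) s) (shiftPS (i ∸ l) t) n ⟩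
  shiftPS j (shiftPS (i ∸ m) s) n ℚ.+ shiftPS j (shiftPS (i ∸ l) t) n
    ≡⟨ cong₂ ℚ._+_ (≈L-raise e (ℕₚ.m≤m⊔n m l) (ℕₚ.m≤m⊔n m′ l′) n) (≈L-raise f (ℕₚ.m≤n⊔m m l) (ℕₚ.m≤n⊔m m′ l′) n) ⟩
  shiftPS i (shiftPS (j ∸ m′) s′) n ℚ.+ shiftPS i (shiftPS (j ∸ l′) t′) n
    ≡⟨ shiftPS-add i (shiftPS (j ∸ m′) s′) (shiftPS (j ∸ l′) t′) n ⟨
  shiftPS i (addPS (shiftPS (j ∸ m′) s′) (shiftPS (j ∸ l′) t′)) n ∎
  where open ≡-Reasoning
        i = m ⊔ l
        j = m′ ⊔ l′

*L-cong : ∀ {u u′ v v′} → u ≈L u′ → v ≈L v′ → u *L v ≈L u′ *L v′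
*L-cong {laurent m s} {laurent m′ s′} {laurent l t} {laurent l′ t′} (cleared e) (cleared f) = cleared λ n →
  trans (shiftPS-mul m′ l′ s t n) (trans (mulPS-cong e f n) (sym (shiftPS-mul m l s′ t′ n)))

+L-comm : ∀ u v → u +L v ≈L v +L u
+L-comm (laurent m s) (laurent l t) = ≈L-strict (ℕₚ.⊔-comm m l) λ n → trans
  (ℚₚ.+-comm (shiftPS (m ⊔ l ∸ m) s n) (shiftPS (m ⊔ l ∸ l) t n))
  (cong (λ i → shiftPS (i ∸ l) t n ℚ.+ shiftPS (i ∸ m) s n) (ℕₚ.⊔-comm m l))

∸-split : ∀ {m i j} → m ≤ i → i ≤ j → (j ∸ i) + (i ∸ m) ≡ j ∸ m
∸-split {m} {i} {j} m≤i i≤j = begin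
  (j ∸ i) + (i ∸ m)   ≡⟨ ℕₚ.+-∸-assoc (j ∸ i) m≤i ⟨
  ((j ∸ i) + i) ∸ m   ≡⟨ cong (_∸ m) (ℕₚ.m∸n+n≡m i≤j) ⟩
  j ∸ m               ∎
  where open ≡-Reasoning

shiftPS-∸∸ : ∀ {m i j} → m ≤ i → i ≤ j → ∀ s → shiftPS (j ∸ i) (shiftPS (i ∸ m) s) ≗ shiftPS (j ∸ m) s
shiftPS-∸∸ {m} {i} {j} m≤i i≤j s n = trans (shiftPS-+ (j ∸ i) (i ∸ m) s n)
  (cong (λ d → shiftPS d s n) (∸-split m≤i i≤j))

+L-assoc : ∀ u v w → (u +L v) +L w ≈L u +L (v +L w)
+L-assoc (laurent m s) (laurent l t) (laurent p r) = ≈L-strict (ℕₚ.⊔-assoc m l p) λ n → begin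
  shiftPS (i ∸ (m ⊔ l)) (addPS (shiftPS (m ⊔ l ∸ m) s) (shiftPS (m ⊔ l ∸ l) t)) n ℚ.+ shiftPS (i ∸ p) r n
    ≡⟨ cong (ℚ._+ shiftPS (i ∸ p) r n) (shiftPS-add (i ∸ (m ⊔ l)) (shiftPS (m ⊔ l ∸ m) s) (shiftPS (m ⊔ l ∸ l) t) n) ⟩
  (shiftPS (i ∸ (m ⊔ l)) (shiftPS (m ⊔ l ∸ m) s) n ℚ.+ shiftPS (i ∸ (m ⊔ l)) (shiftPS (m ⊔ l ∸ l) t) n) ℚ.+ shiftPS (i ∸ p) r n
    ≡⟨ cong (ℚ._+ shiftPS (i ∸ p) r n) (cong₂ ℚ._+_ (shiftPS-∸∸ (ℕₚ.m≤m⊔n m l) (ℕₚ.m≤m⊔n (m ⊔ l) p) s n)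
                                                  (shiftPS-∸∸ (ℕₚ.m≤n⊔m m l) (ℕₚ.m≤m⊔n (m ⊔ l) p) t n)) ⟩
  (shiftPS (i ∸ m) s n ℚ.+ shiftPS (i ∸ l) t n) ℚ.+ shiftPS (i ∸ p) r n
    ≡⟨ ℚₚ.+-assoc (shiftPS (i ∸ m) s n) (shiftPS (i ∸ l) t n) (shiftPS (i ∸ p) r n) ⟩
  shiftPS (i ∸ m) s n ℚ.+ (shiftPS (i ∸ l) t n ℚ.+ shiftPS (i ∸ p) r n)
    ≡⟨ cong (λ h → shiftPS (h ∸ m) s n ℚ.+ (shiftPS (h ∸ l) t n ℚ.+ shiftPS (h ∸ p) r n)) (ℕₚ.⊔-assoc m l p) ⟩
  shiftPS (j ∸ m) s n ℚ.+ (shiftPS (j ∸ l) t n ℚ.+ shiftPS (j ∸ p) r n)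
    ≡⟨ cong (shiftPS (j ∸ m) s n ℚ.+_) (cong₂ ℚ._+_ (shiftPS-∸∸ (ℕₚ.m≤m⊔n l p) (ℕₚ.m≤n⊔m m (l ⊔ p)) t n)
                                                  (shiftPS-∸∸ (ℕₚ.m≤n⊔m l p) (ℕₚ.m≤n⊔m m (l ⊔ p)) r n)) ⟨
  shiftPS (j ∸ m) s n ℚ.+ (shiftPS (j ∸ (l ⊔ p)) (shiftPS (l ⊔ p ∸ l) t) n ℚ.+ shiftPS (j ∸ (l ⊔ p)) (shiftPS (l ⊔ p ∸ p) r) n)
    ≡⟨ cong (shiftPS (j ∸ m) s n ℚ.+_) (shiftPS-add (j ∸ (l ⊔ p)) (shiftPS (l ⊔ p ∸ l) t) (shiftPS (l ⊔ p ∸ p) r) n) ⟨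
  shiftPS (j ∸ m) s n ℚ.+ shiftPS (j ∸ (l ⊔ p)) (addPS (shiftPS (l ⊔ p ∸ l) t) (shiftPS (l ⊔ p ∸ p) r)) n ∎
  where open ≡-Reasoning
        i = (m ⊔ l) ⊔ p
        j = m ⊔ (l ⊔ p)

ser-zeroL : ser zeroL ≗ zeroPS
ser-zeroL zero    = refl
ser-zeroL (suc n) = refl

+L-identityˡ : ∀ u → zeroL +L u ≈L u
+L-identityˡ (laurent m s) = ≈L-strict refl λ n → begin
  shiftPS m (ser zeroL) n ℚ.+ shiftPS (m ∸ m) s n
    ≡⟨ cong₂ ℚ._+_ (trans (shiftPS-cong m ser-zeroL n) (shiftPS-zero m n)) (cong (λ d → shiftPS d s n) (ℕₚ.n∸n≡0 m)) ⟩
  0ℚ ℚ.+ s n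
    ≡⟨ ℚₚ.+-identityˡ (s n) ⟩
  s n ∎
  where open ≡-Reasoning

+L-inverseʳ : ∀ u → u +L (-L u) ≈L zeroL
+L-inverseʳ (laurent m s) = cleared λ n → begin
  shiftPS (m ⊔ m ∸ m) s n ℚ.+ shiftPS (m ⊔ m ∸ m) (λ i → ℚ.- s i) n
    ≡⟨ cong (λ d → shiftPS d s n ℚ.+ shiftPS d (λ i → ℚ.- s i) n) (trans (cong (_∸ m) (ℕₚ.⊔-idem m)) (ℕₚ.n∸n≡0 m)) ⟩
  s n ℚ.+ (ℚ.- s n)
    ≡⟨ ℚₚ.+-inverseʳ (s n) ⟩
  0ℚ
    ≡⟨ trans (shiftPS-cong (m ⊔ m) ser-zeroL n) (shiftPS-zero (m ⊔ m) n) ⟨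
  shiftPS (m ⊔ m) (ser zeroL) n ∎
  where open ≡-Reasoning

*L-comm : ∀ u v → u *L v ≈L v *L u
*L-comm (laurent m s) (laurent l t) = ≈L-strict (ℕₚ.+-comm m l) (mulPS-comm s t)

*L-assoc : ∀ u v w → (u *L v) *L w ≈L u *L (v *L w)
*L-assoc (laurent m s) (laurent l t) (laurent p r) = ≈L-strict (ℕₚ.+-assoc m l p) (mulPS-assoc s t r)

*L-identityˡ : ∀ u → oneL *L u ≈L u
*L-identityˡ (laurent m s) = ≈L-strict refl λ n → trans (mulPS-constˡ 1ℚ s n) (ℚₚ.*-identityˡ (s n))

*L-zeroˡ : ∀ u → zeroL *L u ≈L zeroL
*L-zeroˡ (laurent m s) = cleared λ n →
  trans (mulPS-constˡ 0ℚ s n) (trans (ℚₚ.*-zeroˡ (s n))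
    (sym (trans (shiftPS-cong m ser-zeroL n) (shiftPS-zero m n))))

*L-distribʳ-+L : ∀ w u v → (u +L v) *L w ≈L u *L w +L v *L w
*L-distribʳ-+L (laurent p r) (laurent m s) (laurent l t) = ≈L-strict (ℕₚ.+-distribʳ-⊔ p m l) λ n → begin
  mulPS (addPS (shiftPS (m ⊔ l ∸ m) s) (shiftPS (m ⊔ l ∸ l) t)) r n
    ≡⟨ mulPS-distribʳ r (shiftPS (m ⊔ l ∸ m) s) (shiftPS (m ⊔ l ∸ l) t) n ⟩
  mulPS (shiftPS (m ⊔ l ∸ m) s) r n ℚ.+ mulPS (shiftPS (m ⊔ l ∸ l) t) r n
    ≡⟨ cong₂ ℚ._+_ (mulPS-shiftˡ (m ⊔ l ∸ m) s r n) (mulPS-shiftˡ (m ⊔ l ∸ l) t r n) ⟩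
  shiftPS (m ⊔ l ∸ m) (mulPS s r) n ℚ.+ shiftPS (m ⊔ l ∸ l) (mulPS t r) n
    ≡⟨ cong₂ (λ d e → shiftPS d (mulPS s r) n ℚ.+ shiftPS e (mulPS t r) n) (raised m) (raised l) ⟩
  shiftPS ((m + p) ⊔ (l + p) ∸ (m + p)) (mulPS s r) n ℚ.+ shiftPS ((m + p) ⊔ (l + p) ∸ (l + p)) (mulPS t r) n ∎
  where
  open ≡-Reasoning
  raised : ∀ i → m ⊔ l ∸ i ≡ (m + p) ⊔ (l + p) ∸ (i + p)
  raised i = begin
    m ⊔ l ∸ i                      ≡⟨ ℕₚ.[m+n]∸[m+o]≡n∸o p (m ⊔ l) i ⟨
    (p + (m ⊔ l)) ∸ (p + i)        ≡⟨ cong₂ _∸_ (ℕₚ.+-comm p (m ⊔ l)) (ℕₚ.+-comm p i) ⟩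
    ((m ⊔ l) + p) ∸ (i + p)        ≡⟨ cong (_∸ (i + p)) (ℕₚ.+-distribʳ-⊔ p m l) ⟩
    (m + p) ⊔ (l + p) ∸ (i + p)    ∎

-- Subtraction enters only through `+L-inverseʳ`, to write the Chebyshev recurrence as a sum and to
-- cancel a summand; all other algebra lives in the semiring.
laurentSemiring : CommutativeSemiring _ _
laurentSemiring = record
  { Carrier = Laurent
  ; _≈_ = _≈L_
  ; _+_ = _+L_
  ; _*_ = _*L_
  ; 0# = zeroL
  ; 1# = oneL
  ; isCommutativeSemiring = isCommutativeSemiringˡ record
    { +-isCommutativeMonoid = isCommutativeMonoidˡ record
      { isSemigroup = record
        { isMagma = record { isEquivalence = ≈L-isEquivalence ; ∙-cong = +L-cong }
        ; assoc = +L-assoc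
        }
      ; identityˡ = +L-identityˡ
      ; comm = +L-comm
      }
    ; *-isCommutativeMonoid = isCommutativeMonoidˡ record
      { isSemigroup = record
        { isMagma = record { isEquivalence = ≈L-isEquivalence ; ∙-cong = *L-cong }
        ; assoc = *L-assoc
        }
      ; identityˡ = *L-identityˡ
      ; comm = *L-comm
      }
    ; distribʳ = *L-distribʳ-+L
    ; zeroˡ = *L-zeroˡ
    }
  }
  where
  ≈L-isEquivalence : IsEquivalence _≈L_
  ≈L-isEquivalence = record { refl = ≈L-refl ; sym = ≈L-sym ; trans = ≈L-trans }

recipL-inverseʳ : ∀ u → ser u 0 ≢ 0ℚ → u *L recipL u ≈L oneL
recipL-inverseʳ (laurent m s) s0≢0 = cleared λ n → begin
  mulPS s (shiftPS m (invPS s)) n    ≡⟨ mulPS-shiftʳ m s (invPS s) n ⟩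
  shiftPS m (mulPS s (invPS s)) n    ≡⟨ shiftPS-cong m (mulPS-invPS s s0≢0) n ⟩
  shiftPS m (ser oneL) n             ≡⟨ cong (λ d → shiftPS d (ser oneL) n) (ℕₚ.+-identityʳ m) ⟨
  shiftPS (m + 0) (ser oneL) n       ∎
  where open ≡-Reasoning

-- `coeffL` branches on the sum of the exponent and the shift. As a function of that sum, the
-- coefficient can be transported along equations between exponents.
extendPS : PS → ℤ → ℚ
extendPS s (+ n)    = s n
extendPS s -[1+ _ ] = 0ℚ

coeffL-extendPS : ∀ m s e → coeffL (laurent m s) e ≡ extendPS s (e ℤ.+ + m)
coeffL-extendPS m s e with e ℤ.+ + m
... | + n      = refl
... | -[1+ _ ] = refl

shiftPS-below : ∀ d s n → n < d → shiftPS d s n ≡ 0ℚ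
shiftPS-below (suc d) s zero    _         = refl
shiftPS-below (suc d) s (suc n) (s≤s n<d) = shiftPS-below d s n n<d

-- A negative exponent either stays negative after the shift by d or lands among the d leading
-- zeros.
extendPS-⊖ : ∀ d n s → extendPS (shiftPS d s) (d ℤ.⊖ suc n) ≡ 0ℚ
extendPS-⊖ d n s with ℕₚ.≤-<-connex (suc n) d
... | inj₁ n<d rewrite ℤₚ.⊖-≥ n<d = shiftPS-below d s (d ∸ suc n) (ℕₚ.∸-monoʳ-< (s≤s z≤n) n<d)
... | inj₂ d≤n rewrite ℤₚ.⊖-< d≤n | ℕₚ.+-∸-assoc 1 (ℕₚ.≤-pred d≤n) = refl

extendPS-shift : ∀ d s i → extendPS (shiftPS d s) (i ℤ.+ + d) ≡ extendPS s i
extendPS-shift d s (+ n)    = trans (cong (shiftPS d s) (ℕₚ.+-comm n d)) (shiftPS-at d s n)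
extendPS-shift d s -[1+ n ] = extendPS-⊖ d n s

coeffL-shift : ∀ d m s e → coeffL (laurent m s) e ≡ coeffL (laurent (m + d) (shiftPS d s)) e
coeffL-shift d m s e = begin
  coeffL (laurent m s) e                       ≡⟨ coeffL-extendPS m s e ⟩
  extendPS s (e ℤ.+ + m)                       ≡⟨ extendPS-shift d s (e ℤ.+ + m) ⟨
  extendPS (shiftPS d s) (e ℤ.+ + m ℤ.+ + d)   ≡⟨ cong (extendPS (shiftPS d s)) (ℤₚ.+-assoc e (+ m) (+ d)) ⟩
  extendPS (shiftPS d s) (e ℤ.+ + (m + d))     ≡⟨ coeffL-extendPS (m + d) (shiftPS d s) e ⟨
  coeffL (laurent (m + d) (shiftPS d s)) e     ∎
  where open ≡-Reasoning

extendPS-cong : ∀ {s t} → s ≗ t → extendPS s ≗ extendPS t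
extendPS-cong e (+ n)    = e n
extendPS-cong e -[1+ _ ] = refl

-- Both series are brought to the shift m + l, where the cleared equation compares their
-- coefficients. This carries `_≈L_` over to the form of the theorem.
coeffL-cong : ∀ {u v} → u ≈L v → ∀ e → coeffL u e ≡ coeffL v e
coeffL-cong {laurent m s} {laurent l t} (cleared f) e = begin
  coeffL (laurent m s) e                          ≡⟨ coeffL-shift l m s e ⟩
  coeffL (laurent (m + l) (shiftPS l s)) e        ≡⟨ coeffL-extendPS (m + l) (shiftPS l s) e ⟩
  extendPS (shiftPS l s) (e ℤ.+ + (m + l))        ≡⟨ extendPS-cong f (e ℤ.+ + (m + l)) ⟩
  extendPS (shiftPS m t) (e ℤ.+ + (m + l))        ≡⟨ cong (λ d → extendPS (shiftPS m t) (e ℤ.+ + d)) (ℕₚ.+-comm m l) ⟩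
  extendPS (shiftPS m t) (e ℤ.+ + (l + m))        ≡⟨ coeffL-extendPS (l + m) (shiftPS m t) e ⟨
  coeffL (laurent (l + m) (shiftPS m t)) e        ≡⟨ coeffL-shift m l t e ⟨
  coeffL (laurent l t) e                          ∎
  where open ≡-Reasoning

-- Solution of the functional equations

-- Over an abstract semiring only the laws are visible and the arithmetic of Laurent series stays
-- closed.
module FunctionalEquations (R : CommutativeSemiring 0ℓ 0ℓ) where

  open CommutativeSemiring R renaming (_+_ to infixl 6 _⊕_; _*_ to infixl 7 _⊗_; refl to ≈-refl; sym to ≈-sym; trans to ≈-trans)
  open SemiringSolver R using (solve; _:+_; _:*_; _:=_)
  open SetoidReasoning setoid

  *-cancelˡ : ∀ {u v w} w⁻¹ → w ⊗ w⁻¹ ≈ 1# → w ⊗ u ≈ w ⊗ v → u ≈ v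
  *-cancelˡ {u} {v} {w} w⁻¹ inv e = begin
    u                  ≈⟨ *-identityˡ u ⟨
    1# ⊗ u          ≈⟨ *-congʳ inv ⟨
    (w ⊗ w⁻¹) ⊗ u    ≈⟨ solve 3 (λ a b c → (a :* b) :* c := b :* (a :* c)) ≈-refl w w⁻¹ u ⟩
    w⁻¹ ⊗ (w ⊗ u)    ≈⟨ *-congˡ e ⟩
    w⁻¹ ⊗ (w ⊗ v)    ≈⟨ solve 3 (λ a b c → b :* (a :* c) := (a :* b) :* c) ≈-refl w w⁻¹ v ⟩
    (w ⊗ w⁻¹) ⊗ v    ≈⟨ *-congʳ inv ⟩
    1# ⊗ v          ≈⟨ *-identityˡ v ⟩
    v                  ∎

  -- `S k` stands for U₀U₁ + ⋯ + Uₖ₋₁Uₖ and `G k` for the first k summands of the theorem's outer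
  -- sum; both enter through their recurrences.
  module Solution
    (⊖_ : Carrier → Carrier) (⊖-inverseʳ : ∀ u → u ⊕ (⊖ u) ≈ 0#)
    (x 2# : Carrier) (recip : Carrier → Carrier) (U S G A B F E : ℕ → Carrier)
    (2#-def : 2# ≈ 1# ⊕ 1#)
    (U0 : U 0 ≈ 1#) (x-U1 : x ⊗ U 1 ≈ 1#)
    (U-suc : ∀ r → U (2 + r) ≈ U 1 ⊗ U (1 + r) ⊕ (⊖ U r))
    (U*U-invertible : ∀ q r → (U q ⊗ U r) ⊗ recip (U q ⊗ U r) ≈ 1#)
    (S-zero : S 0 ≈ 0#) (S-suc : ∀ k → S (suc k) ≈ S k ⊕ U k ⊗ U (suc k))
    (G-zero : G 0 ≈ 0#)
    (G-suc : ∀ k → G (suc k) ≈ G k ⊕ ((U (suc k) ⊗ (U (suc k) ⊕ (x ⊗ U k))) ⊕ (2# ⊗ x ⊗ S k)) ⊗ recip (U (suc k) ⊗ U (suc (suc k))))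
    (A1 : A 1 ≈ 0#) (B1 : B 1 ≈ x) (F2 : F 2 ≈ 0#) (E2 : E 2 ≈ 0#)
    (A-eq : ∀ k → A (2 + k) ≈ x ⊗ (1# ⊕ A (1 + k) ⊗ A (2 + k)))
    (B-eq : ∀ k → B (2 + k) ≈ x ⊗ (B (1 + k) ⊗ A (2 + k) ⊕ A (1 + k) ⊗ B (2 + k)))
    (F-eq : ∀ k → F (3 + k) ≈ x ⊗ (F (2 + k) ⊗ A (3 + k) ⊕ (A (2 + k) ⊗ F (3 + k) ⊕ A (2 + k) ⊗ A (3 + k))))
    (E-eq : ∀ k → E (3 + k) ≈ x ⊗ ((E (2 + k) ⊗ A (3 + k) ⊕ F (2 + k) ⊗ B (3 + k)) ⊕
                                ((B (2 + k) ⊗ F (3 + k) ⊕ A (2 + k) ⊗ E (3 + k)) ⊕ (B (2 + k) ⊗ A (3 + k) ⊕ A (2 + k) ⊗ B (3 + k)))))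
    where

    ⊕-cancelʳ : ∀ {u v} w → u ⊕ w ≈ v ⊕ w → u ≈ v
    ⊕-cancelʳ {u} {v} w e = begin
      u                  ≈⟨ +-identityʳ u ⟨
      u ⊕ 0#             ≈⟨ +-congˡ (⊖-inverseʳ w) ⟨
      u ⊕ (w ⊕ (⊖ w))    ≈⟨ +-assoc u w (⊖ w) ⟨
      (u ⊕ w) ⊕ (⊖ w)    ≈⟨ +-congʳ e ⟩
      (v ⊕ w) ⊕ (⊖ w)    ≈⟨ +-assoc v w (⊖ w) ⟩
      v ⊕ (w ⊕ (⊖ w))    ≈⟨ +-congˡ (⊖-inverseʳ w) ⟩
      v ⊕ 0#             ≈⟨ +-identityʳ v ⟩
      v                  ∎

    U-recurrence : ∀ r → U (2 + r) ⊕ U r ≈ U 1 ⊗ U (1 + r)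
    U-recurrence r = begin
      U (2 + r) ⊕ U r                         ≈⟨ +-congʳ (U-suc r) ⟩
      (U 1 ⊗ U (1 + r) ⊕ (⊖ U r)) ⊕ U r       ≈⟨ +-assoc (U 1 ⊗ U (1 + r)) (⊖ U r) (U r) ⟩
      U 1 ⊗ U (1 + r) ⊕ ((⊖ U r) ⊕ U r)       ≈⟨ +-congˡ (≈-trans (+-comm (⊖ U r) (U r)) (⊖-inverseʳ (U r))) ⟩
      U 1 ⊗ U (1 + r) ⊕ 0#                    ≈⟨ +-identityʳ (U 1 ⊗ U (1 + r)) ⟩
      U 1 ⊗ U (1 + r)                         ∎

    -- U₍ᵣ₋₁₎, with U₍₋₁₎ = 0.
    V : ℕ → Carrier
    V zero    = 0#
    V (suc r) = U r

    -- This is x times the Chebyshev recurrence, because x U₁ = 1; the convention U₋₁ = 0 lets it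
    -- start at r = 0.
    V-recurrence : ∀ r → x ⊗ U (1 + r) ⊕ x ⊗ V r ≈ U r
    V-recurrence zero = begin
      x ⊗ U 1 ⊕ x ⊗ 0#    ≈⟨ +-cong x-U1 (zeroʳ x) ⟩
      1# ⊕ 0#             ≈⟨ +-identityʳ 1# ⟩
      1#                  ≈⟨ U0 ⟨
      U 0                 ∎
    V-recurrence (suc r) = begin
      x ⊗ U (2 + r) ⊕ x ⊗ U r    ≈⟨ distribˡ x (U (2 + r)) (U r) ⟨
      x ⊗ (U (2 + r) ⊕ U r)      ≈⟨ *-congˡ (U-recurrence r) ⟩
      x ⊗ (U 1 ⊗ U (1 + r))      ≈⟨ *-assoc x (U 1) (U (1 + r)) ⟨
      (x ⊗ U 1) ⊗ U (1 + r)      ≈⟨ *-congʳ x-U1 ⟩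
      1# ⊗ U (1 + r)             ≈⟨ *-identityˡ (U (1 + r)) ⟩
      U (1 + r)                  ∎

    numerator : ℕ → Carrier
    numerator j = (U (suc j) ⊗ (U (suc j) ⊕ (x ⊗ U j))) ⊕ (2# ⊗ x ⊗ S j)

    -- Multiply Y = x (W + A₍ₖ₊₁₎ Y) by Uₖ, use A₍ₖ₊₁₎ Uₖ = U₍ₖ₋₁₎ and x U₍ₖ₊₁₎ = Uₖ − x U₍ₖ₋₁₎, and cancel x.
    kernel : ∀ k {Y W} → A (1 + k) ⊗ U k ≈ V k → Y ≈ x ⊗ (W ⊕ A (1 + k) ⊗ Y) → U (1 + k) ⊗ Y ≈ U k ⊗ W
    kernel k {Y} {W} AU eq = *-cancelˡ (U 1) x-U1 (⊕-cancelʳ (x ⊗ (V k ⊗ Y)) (begin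
      x ⊗ (U (1 + k) ⊗ Y) ⊕ x ⊗ (V k ⊗ Y)
        ≈⟨ solve 4 (λ x u v y → x :* (u :* y) :+ x :* (v :* y) := (x :* u :+ x :* v) :* y) ≈-refl x (U (1 + k)) (V k) Y ⟩
      (x ⊗ U (1 + k) ⊕ x ⊗ V k) ⊗ Y
        ≈⟨ *-congʳ (V-recurrence k) ⟩
      U k ⊗ Y
        ≈⟨ *-congˡ eq ⟩
      U k ⊗ (x ⊗ (W ⊕ A (1 + k) ⊗ Y))
        ≈⟨ solve 5 (λ u x w a y → u :* (x :* (w :+ a :* y)) := x :* (u :* w) :+ x :* ((a :* u) :* y)) ≈-refl (U k) x W (A (1 + k)) Y ⟩
      x ⊗ (U k ⊗ W) ⊕ x ⊗ ((A (1 + k) ⊗ U k) ⊗ Y)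
        ≈⟨ +-congˡ (*-congˡ (*-congʳ AU)) ⟩
      x ⊗ (U k ⊗ W) ⊕ x ⊗ (V k ⊗ Y) ∎))

    -- `kernel` with W = 1. Its hypothesis at k is this lemma one step earlier, and from here on it
    -- is available at every index.
    A-solution : ∀ k → A (1 + k) ⊗ U k ≈ V k
    A-solution zero    = ≈-trans (*-congʳ A1) (zeroˡ (U 0))
    A-solution (suc k) = begin
      A (2 + k) ⊗ U (1 + k)   ≈⟨ *-comm (A (2 + k)) (U (1 + k)) ⟩
      U (1 + k) ⊗ A (2 + k)   ≈⟨ kernel k (A-solution k) (A-eq k) ⟩
      U k ⊗ 1#              ≈⟨ *-identityʳ (U k) ⟩
      U k                      ∎

    -- The product is independent of k: `kernel` trades one factor `U (1 + k)` for `U k`, and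
    -- `A-solution` trades the other. So it keeps its value at k = 0.
    B-solution : ∀ k → B (1 + k) ⊗ (U k ⊗ U k) ≈ x
    B-solution zero    = ≈-trans (*-congˡ (≈-trans (*-cong U0 U0) (*-identityʳ 1#))) (≈-trans (*-identityʳ (B 1)) B1)
    B-solution (suc k) = begin
      B (2 + k) ⊗ (U (1 + k) ⊗ U (1 + k))
        ≈⟨ solve 2 (λ b u → b :* (u :* u) := (u :* b) :* u) ≈-refl (B (2 + k)) (U (1 + k)) ⟩
      (U (1 + k) ⊗ B (2 + k)) ⊗ U (1 + k)
        ≈⟨ *-congʳ (kernel k (A-solution k) (B-eq k)) ⟩
      (U k ⊗ (B (1 + k) ⊗ A (2 + k))) ⊗ U (1 + k)
        ≈⟨ solve 4 (λ u b a v → (u :* (b :* a)) :* v := (u :* b) :* (a :* v)) ≈-refl (U k) (B (1 + k)) (A (2 + k)) (U (1 + k)) ⟩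
      (U k ⊗ B (1 + k)) ⊗ (A (2 + k) ⊗ U (1 + k))
        ≈⟨ *-congˡ (A-solution (suc k)) ⟩
      (U k ⊗ B (1 + k)) ⊗ U k
        ≈⟨ solve 2 (λ b u → (u :* b) :* u := b :* (u :* u)) ≈-refl (B (1 + k)) (U k) ⟩
      B (1 + k) ⊗ (U k ⊗ U k)
        ≈⟨ B-solution k ⟩
      x ∎

    -- The same trade as for B, but now W has the extra summand a a′ of the nodes marked at the
    -- root; it contributes the new term UₖUₖ₊₁ of `S`.
    F-solution : ∀ k → F (2 + k) ⊗ (U (1 + k) ⊗ U (1 + k)) ≈ S k
    F-solution zero    = ≈-trans (*-congʳ F2) (≈-trans (zeroˡ _) (≈-sym S-zero))
    F-solution (suc k) = begin
      f′ ⊗ (u₂ ⊗ u₂)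
        ≈⟨ solve 2 (λ f u → f :* (u :* u) := (u :* f) :* u) ≈-refl f′ u₂ ⟩
      (u₂ ⊗ f′) ⊗ u₂
        ≈⟨ *-congʳ (kernel (suc k) (A-solution (suc k)) (≈-trans (F-eq k) (*-congˡ
             (solve 3 (λ p q r → p :+ (q :+ r) := (p :+ r) :+ q) ≈-refl (f ⊗ a′) (a ⊗ f′) (a ⊗ a′))))) ⟩
      (u₁ ⊗ (f ⊗ a′ ⊕ a ⊗ a′)) ⊗ u₂
        ≈⟨ solve 5 (λ u₁ u₂ f a a′ → (u₁ :* (f :* a′ :+ a :* a′)) :* u₂ := (u₁ :* (f :+ a)) :* (a′ :* u₂)) ≈-refl u₁ u₂ f a a′ ⟩
      (u₁ ⊗ (f ⊕ a)) ⊗ (a′ ⊗ u₂)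
        ≈⟨ *-congˡ (A-solution (suc (suc k))) ⟩
      (u₁ ⊗ (f ⊕ a)) ⊗ u₁
        ≈⟨ solve 3 (λ u f a → (u :* (f :+ a)) :* u := f :* (u :* u) :+ (a :* u) :* u) ≈-refl u₁ f a ⟩
      f ⊗ (u₁ ⊗ u₁) ⊕ (a ⊗ u₁) ⊗ u₁
        ≈⟨ +-cong (F-solution k) (*-congʳ (A-solution (suc k))) ⟩
      S k ⊕ U k ⊗ u₁
        ≈⟨ S-suc k ⟨
      S (suc k) ∎
      where
      u₁ u₂ f f′ a a′ : Carrier
      u₁ = U (1 + k)
      u₂ = U (2 + k)
      f  = F (2 + k)
      f′ = F (3 + k)
      a  = A (2 + k)
      a′ = A (3 + k)

    E-solution : ∀ k → E (2 + k) ⊗ (U (1 + k) ⊗ U (1 + k)) ≈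
      G k
    E-solution zero    = ≈-trans (*-congʳ E2) (≈-trans (zeroˡ _) (≈-sym G-zero))
    E-solution (suc k) = begin
      e′ ⊗ (u₂ ⊗ u₂)
        ≈⟨ solve 2 (λ e u → e :* (u :* u) := (u :* e) :* u) ≈-refl e′ u₂ ⟩
      (u₂ ⊗ e′) ⊗ u₂
        ≈⟨ *-congʳ (kernel (suc k) (A-solution (suc k)) (≈-trans (E-eq k) (*-congˡ
             (solve 5 (λ p q r s t → (p :+ q) :+ ((r :+ s) :+ t) := ((p :+ q) :+ r :+ t) :+ s) ≈-refl
               (e ⊗ a′) (f ⊗ b′) (b ⊗ f′) (a ⊗ e′) (b ⊗ a′ ⊕ a ⊗ b′))))) ⟩
      -- The terms with factor a′ absorb u₂ and become multiples of u₁²; the other three keep u₁ u₂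
      -- and are evaluated in `increment`.
      (u₁ ⊗ (e ⊗ a′ ⊕ f ⊗ b′ ⊕ b ⊗ f′ ⊕ (b ⊗ a′ ⊕ a ⊗ b′))) ⊗ u₂
        ≈⟨ solve 9 (λ u₁ u₂ e f f′ a a′ b b′ →
              (u₁ :* (e :* a′ :+ f :* b′ :+ b :* f′ :+ (b :* a′ :+ a :* b′))) :* u₂
           := ((e :+ b) :* u₁) :* (a′ :* u₂) :+ (u₁ :* u₂) :* (f :* b′ :+ b :* f′ :+ a :* b′))
           ≈-refl u₁ u₂ e f f′ a a′ b b′ ⟩
      ((e ⊕ b) ⊗ u₁) ⊗ (a′ ⊗ u₂) ⊕ (u₁ ⊗ u₂) ⊗ (f ⊗ b′ ⊕ b ⊗ f′ ⊕ a ⊗ b′)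
        ≈⟨ +-congʳ (*-congˡ (A-solution (suc (suc k)))) ⟩
      ((e ⊕ b) ⊗ u₁) ⊗ u₁ ⊕ (u₁ ⊗ u₂) ⊗ (f ⊗ b′ ⊕ b ⊗ f′ ⊕ a ⊗ b′)
        ≈⟨ solve 4 (λ e b u r → ((e :+ b) :* u) :* u :+ r := e :* (u :* u) :+ (b :* (u :* u) :+ r)) ≈-refl e b u₁ _ ⟩
      e ⊗ (u₁ ⊗ u₁) ⊕ (b ⊗ (u₁ ⊗ u₁) ⊕ (u₁ ⊗ u₂) ⊗ (f ⊗ b′ ⊕ b ⊗ f′ ⊕ a ⊗ b′))
        ≈⟨ +-cong (E-solution k) (≈-trans (+-congʳ (B-solution (suc k))) increment) ⟩
      G k ⊕ numerator k ⊗ recip (u₁ ⊗ u₂)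
        ≈⟨ G-suc k ⟨
      G (suc k) ∎
      where
      u₀ u₁ u₂ e e′ f f′ a a′ b b′ s : Carrier
      u₀ = U k
      u₁ = U (1 + k)
      u₂ = U (2 + k)
      e  = E (2 + k)
      e′ = E (3 + k)
      f  = F (2 + k)
      f′ = F (3 + k)
      a  = A (2 + k)
      a′ = A (3 + k)
      b  = B (2 + k)
      b′ = B (3 + k)
      s  = S k

      -- After multiplication by u₁ u₂ every factor f, f′, b, b′ and a meets exactly the power of U
      -- that its closed form requires.
      increment : x ⊕ (u₁ ⊗ u₂) ⊗ (f ⊗ b′ ⊕ b ⊗ f′ ⊕ a ⊗ b′) ≈ numerator k ⊗ recip (u₁ ⊗ u₂)
      increment = *-cancelˡ (recip (u₁ ⊗ u₂)) (U*U-invertible (1 + k) (2 + k)) (begin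
        (u₁ ⊗ u₂) ⊗ (x ⊕ (u₁ ⊗ u₂) ⊗ (f ⊗ b′ ⊕ b ⊗ f′ ⊕ a ⊗ b′))
          ≈⟨ solve 8 (λ u₁ u₂ f f′ a b b′ x →
                (u₁ :* u₂) :* (x :+ (u₁ :* u₂) :* (f :* b′ :+ b :* f′ :+ a :* b′))
             := u₁ :* (x :* u₂) :+ ((f :* (u₁ :* u₁)) :* (b′ :* (u₂ :* u₂)) :+ (b :* (u₁ :* u₁)) :* (f′ :* (u₂ :* u₂))
                  :+ ((a :* u₁) :* u₁) :* (b′ :* (u₂ :* u₂))))
             ≈-refl u₁ u₂ f f′ a b b′ x ⟩
        u₁ ⊗ (x ⊗ u₂) ⊕ ((f ⊗ (u₁ ⊗ u₁)) ⊗ (b′ ⊗ (u₂ ⊗ u₂)) ⊕ (b ⊗ (u₁ ⊗ u₁)) ⊗ (f′ ⊗ (u₂ ⊗ u₂))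
           ⊕ ((a ⊗ u₁) ⊗ u₁) ⊗ (b′ ⊗ (u₂ ⊗ u₂)))
          ≈⟨ +-congˡ (+-cong (+-cong (*-cong (F-solution k) (B-solution (2 + k))) (*-cong (B-solution (1 + k)) (≈-trans (F-solution (suc k)) (S-suc k))))
               (*-cong (*-congʳ (A-solution (suc k))) (B-solution (2 + k)))) ⟩
        u₁ ⊗ (x ⊗ u₂) ⊕ (s ⊗ x ⊕ x ⊗ (s ⊕ u₀ ⊗ u₁) ⊕ (u₀ ⊗ u₁) ⊗ x)
          -- One of the two copies of x u₀ joins x u₂ to give u₁ by `V-recurrence`; the other
          -- remains as the summand x Uⱼ of the theorem's bracket.
          ≈⟨ solve 5 (λ u₀ u₁ u₂ s x → u₁ :* (x :* u₂) :+ (s :* x :+ x :* (s :+ u₀ :* u₁) :+ (u₀ :* u₁) :* x)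
             := u₁ :* ((x :* u₂ :+ x :* u₀) :+ x :* u₀) :+ (x :* s :+ x :* s)) ≈-refl u₀ u₁ u₂ s x ⟩
        u₁ ⊗ ((x ⊗ u₂ ⊕ x ⊗ u₀) ⊕ x ⊗ u₀) ⊕ (x ⊗ s ⊕ x ⊗ s)
          ≈⟨ +-cong (*-congˡ (+-congʳ (V-recurrence (suc k)))) doubled ⟩
        numerator k
          ≈⟨ *-identityʳ (numerator k) ⟨
        numerator k ⊗ 1#
          ≈⟨ *-congˡ (U*U-invertible (1 + k) (2 + k)) ⟨
        numerator k ⊗ ((u₁ ⊗ u₂) ⊗ recip (u₁ ⊗ u₂))
          ≈⟨ solve 3 (λ n u r → n :* (u :* r) := u :* (n :* r)) ≈-refl (numerator k) (u₁ ⊗ u₂) (recip (u₁ ⊗ u₂)) ⟩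
        (u₁ ⊗ u₂) ⊗ (numerator k ⊗ recip (u₁ ⊗ u₂)) ∎)
        where
        doubled : x ⊗ s ⊕ x ⊗ s ≈ 2# ⊗ x ⊗ s
        doubled = begin
          x ⊗ s ⊕ x ⊗ s               ≈⟨ +-cong (*-identityˡ (x ⊗ s)) (*-identityˡ (x ⊗ s)) ⟨
          1# ⊗ (x ⊗ s) ⊕ 1# ⊗ (x ⊗ s)  ≈⟨ distribʳ (x ⊗ s) 1# 1# ⟨
          (1# ⊕ 1#) ⊗ (x ⊗ s)      ≈⟨ *-congʳ 2#-def ⟨
          2# ⊗ (x ⊗ s)    ≈⟨ *-assoc (2#) x s ⟨
          2# ⊗ x ⊗ s      ∎

    E-closed : ∀ k → E (2 + k) ≈ recip (U (1 + k) ⊗ U (1 + k)) ⊗ G k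
    E-closed k = begin
      E (2 + k)                             ≈⟨ *-identityˡ (E (2 + k)) ⟨
      1# ⊗ E (2 + k)                     ≈⟨ *-congʳ (U*U-invertible (1 + k) (1 + k)) ⟨
      (u² ⊗ recip u²) ⊗ E (2 + k)        ≈⟨ solve 3 (λ u r e → (u :* r) :* e := r :* (e :* u)) ≈-refl u² (recip u²) (E (2 + k)) ⟩
      recip u² ⊗ (E (2 + k) ⊗ u²)        ≈⟨ *-congˡ (E-solution k) ⟩
      recip (U (1 + k) ⊗ U (1 + k)) ⊗ G k                           ∎
      where
      u² : Carrier
      u² = U (1 + k) ⊗ U (1 + k)

-- Chebyshev polynomials at 1/(2x)

ser-U1 : ser (U 1) ≗ ser oneL
ser-U1 zero    = refl
ser-U1 (suc n) = trans (mulPS-constˡ (+ 2 / 1) (ser tL) (suc n)) refl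

ser-xL : ser xL ≗ shiftPS 1 (ser oneL)
ser-xL zero          = refl
ser-xL (suc zero)    = refl
ser-xL (suc (suc n)) = refl

xL-U1 : xL *L U 1 ≈L oneL
xL-U1 = cleared λ n → begin
  mulPS (ser xL) (ser (U 1)) n                    ≡⟨ mulPS-cong ser-xL ser-U1 n ⟩
  mulPS (shiftPS 1 (ser oneL)) (ser oneL) n       ≡⟨ mulPS-shiftˡ 1 (ser oneL) (ser oneL) n ⟩
  shiftPS 1 (mulPS (ser oneL) (ser oneL)) n       ≡⟨ shiftPS-cong 1 (λ i → trans (mulPS-constˡ 1ℚ (ser oneL) i) (ℚₚ.*-identityˡ (ser oneL i))) n ⟩
  shiftPS 1 (ser oneL) n                          ∎
  where open ≡-Reasoning

-- The stored shift is the exact order of the pole. `recipL` relies on this, since it inverts the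
-- coefficient at index 0.
U-shift : ∀ r → shift (U r) ≡ r
U-shift zero          = refl
U-shift (suc zero)    = refl
U-shift (suc (suc r)) rewrite U-shift (suc r) | U-shift r =
  ℕₚ.m≥n⇒m⊔n≡m (ℕₚ.m≤n+m r 2)

-- The shift of U r is smaller by two, so its series is pushed up by two places and misses index 0.
-- What remains is the leading coefficient of U₁, 2 · ½ = 1, times that of `U (1 + r)`.
U-leading-step : ∀ r → ser (U (1 + r)) 0 ≡ 1ℚ → ser (U (2 + r)) 0 ≡ 1ℚ
U-leading-step r ih
  rewrite U-shift (suc r) | U-shift r | ℕₚ.m≥n⇒m⊔n≡m (ℕₚ.m≤n+m r 2) | ℕₚ.n∸n≡0 r | ℕₚ.m+n∸n≡m 2 r =
  trans (ℚₚ.+-identityʳ (mulPS (ser (U 1)) (ser (U (1 + r))) 0))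
    (trans (mulPS-head (ser (U 1)) (ser (U (1 + r)))) (cong (ser (U 1) 0 ℚ.*_) ih))

U-leading : ∀ r → ser (U r) 0 ≡ 1ℚ
U-leading zero          = refl
U-leading (suc zero)    = refl
U-leading (suc (suc r)) = U-leading-step r (U-leading (suc r))

U*U-invertible : ∀ q r → (U q *L U r) *L recipL (U q *L U r) ≈L oneL
U*U-invertible q r = recipL-inverseʳ (U q *L U r) λ e → 1≢0 (trans (sym leading) e)
  where
  leading : ser (U q *L U r) 0 ≡ 1ℚ
  leading = trans (mulPS-head (ser (U q)) (ser (U r))) (cong₂ ℚ._*_ (U-leading q) (U-leading r))
  1≢0 : 1ℚ ≢ 0ℚ
  1≢0 ()

twoL : constL (+ 2 / 1) ≈L oneL +L oneL
twoL = ≈L-strict refl λ { zero → refl ; (suc n) → refl }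

-- Counting occurrences of 12⋯k and 132

above below : ℕ → List ℕ → List ℕ
above a = filterᵇ (a <ᵇ_)
below a = filterᵇ (_<ᵇ a)

-- Occurrences of 12⋯k sorted by their first letter. Like `c21` and `c132`, it recurses on the word
-- and avoids lists of subsequences; `occ-inc`, `occ-21` and `occ-132` give the agreement with
-- `occ`.
ci : ℕ → List ℕ → ℕ
ci zero    xs       = 1
ci (suc k) []       = 0
ci (suc k) (x ∷ xs) = ci k (above x xs) + ci (suc k) xs

c21 : List ℕ → ℕ
c21 []       = 0
c21 (x ∷ xs) = length (below x xs) + c21 xs

c132 : List ℕ → ℕ
c132 []       = 0
c132 (x ∷ xs) = c21 (above x xs) + c132 xs

allᵇ : (ℕ → Bool) → List ℕ → Bool
allᵇ q []       = true
allᵇ q (x ∷ xs) = q x ∧ allᵇ q xs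

countᵇ-++ : ∀ {A : Set} (p : A → Bool) xs ys → countᵇ p (xs ++ ys) ≡ countᵇ p xs + countᵇ p ys
countᵇ-++ p []       ys = refl
countᵇ-++ p (x ∷ xs) ys = trans (cong (λ n → (if p x then 1 else 0) + n) (countᵇ-++ p xs ys)) (sym (ℕₚ.+-assoc (if p x then 1 else 0) _ _))

countᵇ-map : ∀ {A B : Set} (p : B → Bool) (f : A → B) xs → countᵇ p (map f xs) ≡ countᵇ (p ∘ f) xs
countᵇ-map p f []       = refl
countᵇ-map p f (x ∷ xs) = cong (λ n → (if p (f x) then 1 else 0) + n) (countᵇ-map p f xs)

countᵇ-cong : ∀ {A : Set} {p q : A → Bool} → p ≗ q → ∀ xs → countᵇ p xs ≡ countᵇ q xs
countᵇ-cong e []       = refl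
countᵇ-cong e (x ∷ xs) = cong₂ (λ b n → (if b then 1 else 0) + n) (e x) (countᵇ-cong e xs)

countᵇ-false : ∀ {A : Set} (xs : List A) → countᵇ (λ _ → false) xs ≡ 0
countᵇ-false []       = refl
countᵇ-false (x ∷ xs) = countᵇ-false xs

countᵇ-subseqs-∷ : ∀ (p : List ℕ → Bool) m x xs →
  countᵇ p (subseqs (suc m) (x ∷ xs)) ≡ countᵇ (p ∘ (x ∷_)) (subseqs m xs) + countᵇ p (subseqs (suc m) xs)
countᵇ-subseqs-∷ p m x xs = trans (countᵇ-++ p (map (x ∷_) (subseqs m xs)) (subseqs (suc m) xs))
  (cong (_+ countᵇ p (subseqs (suc m) xs)) (countᵇ-map p (x ∷_) (subseqs m xs)))

-- Once the first letter of an occurrence is fixed, its comparison with the later letters becomes a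
-- filter of the remaining word.
countᵇ-subseqs-filterᵇ : ∀ q p m xs →
  countᵇ (λ s → allᵇ q s ∧ p s) (subseqs m xs) ≡ countᵇ p (subseqs m (filterᵇ q xs))
countᵇ-subseqs-filterᵇ q p zero    xs       = refl
countᵇ-subseqs-filterᵇ q p (suc m) []       = refl
countᵇ-subseqs-filterᵇ q p (suc m) (x ∷ xs)
  rewrite countᵇ-subseqs-∷ (λ s → allᵇ q s ∧ p s) m x xs with q x
... | true  rewrite countᵇ-subseqs-∷ p m x (filterᵇ q xs) =
  cong₂ _+_ (countᵇ-subseqs-filterᵇ q (p ∘ (x ∷_)) m xs) (countᵇ-subseqs-filterᵇ q p (suc m) xs)
... | false rewrite countᵇ-false (subseqs m xs) = countᵇ-subseqs-filterᵇ q p (suc m) xs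

<ᵇ-true : ∀ {m n} → m < n → (m <ᵇ n) ≡ true
<ᵇ-true {zero}  {suc n} _         = refl
<ᵇ-true {suc m} {suc n} (s≤s m<n) = <ᵇ-true m<n

<ᵇ-false : ∀ {m n} → n ≤ m → (m <ᵇ n) ≡ false
<ᵇ-false {m}     {zero}  _         = refl
<ᵇ-false {suc m} {suc n} (s≤s n≤m) = <ᵇ-false n≤m

<ᵇ-true⁻¹ : ∀ m n → (m <ᵇ n) ≡ true → m < n
<ᵇ-true⁻¹ zero    (suc n) _ = s≤s z≤n
<ᵇ-true⁻¹ (suc m) (suc n) e = s≤s (<ᵇ-true⁻¹ m n e)

<ᵇ-false⁻¹ : ∀ m n → (m <ᵇ n) ≡ false → n ≤ m
<ᵇ-false⁻¹ m       zero    _ = z≤n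
<ᵇ-false⁻¹ (suc m) (suc n) e = s≤s (<ᵇ-false⁻¹ m n e)

compat-< : ∀ {t c} x d → t < c → compat (t , x) (c , d) ≡ (x <ᵇ d)
compat-< {t} {c} x d t<c rewrite <ᵇ-true t<c | <ᵇ-false (ℕₚ.<⇒≤ t<c) with x <ᵇ d in e
... | false = refl
... | true  rewrite <ᵇ-false (ℕₚ.<⇒≤ (<ᵇ-true⁻¹ x d e)) = refl

compat-> : ∀ {t c} x d → c < t → compat (t , x) (c , d) ≡ (d <ᵇ x)
compat-> {t} {c} x d c<t rewrite <ᵇ-true c<t | <ᵇ-false (ℕₚ.<⇒≤ c<t) with d <ᵇ x in e
... | true  rewrite <ᵇ-false (ℕₚ.<⇒≤ (<ᵇ-true⁻¹ d x e)) = refl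
... | false with x <ᵇ d
...   | true  = refl
...   | false = refl

-- A single predicate q serves all positions because the first pattern letter is extreme: smallest
-- in 12⋯k and 132, largest in 21.
orderIso-∷ : ∀ t x (q : ℕ → Bool) {τ} s → All (λ c → ∀ d → compat (t , x) (c , d) ≡ q d) τ →
  orderIso (t ∷ τ) (x ∷ s) ≡ allᵇ q s ∧ orderIso τ s
orderIso-∷ t x q {τ} s h = rearrange (length τ ≡ᵇ length s) refl
  where
  compare : ∀ {τ} s → All (λ c → ∀ d → compat (t , x) (c , d) ≡ q d) τ → (length τ ≡ᵇ length s) ≡ true →
    foldr (λ p r → compat (t , x) p ∧ r) true (zipL τ s) ≡ allᵇ q s
  compare []      []      e = refl
  compare (d ∷ s) (h ∷ hs) e = cong₂ _∧_ (h d) (compare s hs e)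
  ∧-falseʳ : ∀ b → b ∧ false ≡ false
  ∧-falseʳ true  = refl
  ∧-falseʳ false = refl
  rearrange : ∀ b → (length τ ≡ᵇ length s) ≡ b → orderIso (t ∷ τ) (x ∷ s) ≡ allᵇ q s ∧ orderIso τ s
  rearrange true  e rewrite e = cong (_∧ allPairs (zipL τ s)) (compare s h e)
  rearrange false e rewrite e = sym (∧-falseʳ (allᵇ q s))

countᵇ-orderIso-∷ : ∀ t x (q : ℕ → Bool) {τ} m xs → All (λ c → ∀ d → compat (t , x) (c , d) ≡ q d) τ →
  countᵇ (orderIso (t ∷ τ) ∘ (x ∷_)) (subseqs m xs) ≡ countᵇ (orderIso τ) (subseqs m (filterᵇ q xs))
countᵇ-orderIso-∷ t x q {τ} m xs h = trans (countᵇ-cong (λ s → orderIso-∷ t x q s h) (subseqs m xs))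
  (countᵇ-subseqs-filterᵇ q (orderIso τ) m xs)

occ-increasing : ∀ {τ} → AllPairs _<_ τ → ∀ xs → occ τ xs ≡ ci (length τ) xs
occ-increasing {[]}    []       xs       = refl
occ-increasing {t ∷ τ} (h ∷ hs) []       = refl
occ-increasing {t ∷ τ} (h ∷ hs) (x ∷ xs) = begin
  occ (t ∷ τ) (x ∷ xs)
    ≡⟨ countᵇ-subseqs-∷ (orderIso (t ∷ τ)) (length τ) x xs ⟩
  countᵇ (orderIso (t ∷ τ) ∘ (x ∷_)) (subseqs (length τ) xs) + occ (t ∷ τ) xs
    ≡⟨ cong₂ _+_ (countᵇ-orderIso-∷ t x (x <ᵇ_) (length τ) xs (All.map (λ t<c d → compat-< x d t<c) h))
                 (occ-increasing (h ∷ hs) xs) ⟩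
  occ τ (above x xs) + ci (suc (length τ)) xs
    ≡⟨ cong (_+ ci (suc (length τ)) xs) (occ-increasing hs (above x xs)) ⟩
  ci (length τ) (above x xs) + ci (suc (length τ)) xs ∎
  where open ≡-Reasoning

inc-increasing : ∀ k → AllPairs _<_ (inc k)
inc-increasing k = subst (AllPairs _<_) (sym (Listₚ.map-upTo suc k))
  (AllPairsₚ.applyUpTo⁺₁ suc k (λ i<j _ → s≤s i<j))

occ-inc : ∀ k xs → occ (inc k) xs ≡ ci k xs
occ-inc k xs = trans (occ-increasing (inc-increasing k) xs)
  (cong (λ m → ci m xs) (trans (Listₚ.length-map suc (upTo k)) (Listₚ.length-upTo k)))

occ-1 : ∀ t xs → occ [ t ] xs ≡ length xs
occ-1 t []       = refl
occ-1 t (x ∷ xs) = cong suc (occ-1 t xs)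

-- Written 3, 2 because this is what 132 leaves behind after its first letter.
occ-21 : ∀ xs → occ (3 ∷ 2 ∷ []) xs ≡ c21 xs
occ-21 []       = refl
occ-21 (x ∷ xs) = trans (countᵇ-subseqs-∷ (orderIso (3 ∷ 2 ∷ [])) 1 x xs)
  (cong₂ _+_ (trans (countᵇ-orderIso-∷ 3 x (_<ᵇ x) 1 xs ((λ d → compat-> {3} {2} x d (s≤s (s≤s (s≤s z≤n)))) ∷ [])) (occ-1 2 (below x xs)))
             (occ-21 xs))

occ-132 : ∀ xs → occ p132 xs ≡ c132 xs
occ-132 []       = refl
occ-132 (x ∷ xs) = trans (countᵇ-subseqs-∷ (orderIso p132) 2 x xs)
  (cong₂ _+_ (trans (countᵇ-orderIso-∷ 1 x (x <ᵇ_) 2 xs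
                      ((λ d → compat-< {1} {3} x d (s≤s (s≤s z≤n))) ∷ (λ d → compat-< {1} {2} x d (s≤s (s≤s z≤n))) ∷ [])) (occ-21 (above x xs)))
             (occ-132 xs))

-- Words split at their maximum

above-++ : ∀ x ys zs → above x (ys ++ zs) ≡ above x ys ++ above x zs
above-++ x = Listₚ.filter-++ (λ y → T? (x <ᵇ y))

above-none : ∀ {x ys} → All (_< x) ys → above x ys ≡ []
above-none []                            = refl
above-none {x} {y ∷ ys} (y<x ∷ h) rewrite <ᵇ-false (ℕₚ.<⇒≤ y<x) = above-none h

above-∷ : ∀ {x y} ys → x < y → above x (y ∷ ys) ≡ y ∷ above x ys
above-∷ ys x<y rewrite <ᵇ-true x<y = refl

above-All : ∀ {P : ℕ → Set} x {ys} → All P ys → All P (above x ys)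
above-All x = Allₚ.filter⁺ (λ y → T? (x <ᵇ y))

∈-above⁻ : ∀ x ys {y} → y ∈ above x ys → y ∈ ys × x < y
∈-above⁻ x ys {y} y∈ with ∈ₚ.∈-filter⁻ (λ y → T? (x <ᵇ y)) {xs = ys} y∈
... | y∈ys , x<y = y∈ys , ℕₚ.<ᵇ⇒< x y x<y

∈-above⁺ : ∀ x {ys y} → y ∈ ys → x < y → y ∈ above x ys
∈-above⁺ x y∈ys x<y = ∈ₚ.∈-filter⁺ (λ y → T? (x <ᵇ y)) y∈ys (ℕₚ.<⇒<ᵇ x<y)

length-pos : ∀ {v} {xs : List ℕ} → v ∈ xs → 1 ≤ length xs
length-pos (here _)  = s≤s z≤n
length-pos (there _) = s≤s z≤n

infix 4 _≫_

_≫_ : List ℕ → List ℕ → Set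
L ≫ R = All (λ l → All (_< l) R) L

above-split : ∀ {x N R} L → x < N → All (_< x) R → above x (L ++ N ∷ R) ≡ above x L ++ [ N ]
above-split {x} {N} {R} L x<N R<x = trans (above-++ x L (N ∷ R))
  (cong (above x L ++_) (trans (above-∷ R x<N) (cong (N ∷_) (above-none R<x))))

above-last : ∀ {x l} L → l < x → above x (L ++ [ l ]) ≡ above x L
above-last {x} {l} L l<x = trans (above-++ x L [ l ])
  (trans (cong (above x L ++_) (above-none (l<x ∷ []))) (Listₚ.++-identityʳ (above x L)))

above-split-last : ∀ {x l N R} L → l < x → x < N → All (_< x) R → above x (L ++ l ∷ N ∷ R) ≡ above x L ++ [ N ]
above-split-last {x} {l} {N} {R} L l<x x<N R<x = begin
  above x (L ++ l ∷ N ∷ R)          ≡⟨ cong (above x) (Listₚ.++-assoc L [ l ] (N ∷ R)) ⟨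
  above x ((L ++ [ l ]) ++ N ∷ R)   ≡⟨ above-split (L ++ [ l ]) x<N R<x ⟩
  above x (L ++ [ l ]) ++ [ N ]     ≡⟨ cong (_++ [ N ]) (above-last L l<x) ⟩
  above x L ++ [ N ]                ∎
  where open ≡-Reasoning

-- The value 0 at length 0 reflects that the empty pattern has no last letter which N could be.
ciPred : ℕ → List ℕ → ℕ
ciPred zero    xs = 0
ciPred (suc k) xs = ci k xs

ci-∷ : ∀ k x xs → ci k (x ∷ xs) ≡ ciPred k (above x xs) + ci k xs
ci-∷ zero    x xs = refl
ci-∷ (suc k) x xs = refl

-- An occurrence either avoids the final maximum or ends with it.
ci-snoc : ∀ k {N} L → All (_< N) L → ci k (L ++ [ N ]) ≡ ci k L + ciPred k L
ci-snoc zero    L       _         = refl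
ci-snoc (suc k) []      _         = ℕₚ.+-comm (ci k []) 0
ci-snoc (suc k) {N} (x ∷ L) (x<N ∷ L<N) = begin
  ci k (above x (L ++ [ N ])) + ci (suc k) (L ++ [ N ])
    ≡⟨ cong₂ _+_ (cong (ci k) (above-split L x<N [])) (ci-snoc (suc k) L L<N) ⟩
  ci k (above x L ++ [ N ]) + (ci (suc k) L + ci k L)
    ≡⟨ cong (_+ (ci (suc k) L + ci k L)) (ci-snoc k (above x L) (above-All x L<N)) ⟩
  (ci k (above x L) + ciPred k (above x L)) + (ci (suc k) L + ci k L)
    ≡⟨ solve 4 (λ a b c d → (a :+ b) :+ (c :+ d) := (a :+ c) :+ (b :+ d)) refl (ci k (above x L)) _ _ _ ⟩
  (ci k (above x L) + ci (suc k) L) + (ciPred k (above x L) + ci k L)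
    ≡⟨ cong (λ n → (ci k (above x L) + ci (suc k) L) + n) (ci-∷ k x L) ⟨
  ci (suc k) (x ∷ L) + ci k (x ∷ L) ∎
  where open ≡-Reasoning
        open +-*-Solver

ci-node-step : ∀ k x L r → (ci k (above x L) + ciPred k (above x L)) + (ci (suc k) L + ci k L + r) ≡
  ci (suc k) (x ∷ L) + ci k (x ∷ L) + r
ci-node-step k x L r rewrite ci-∷ k x L =
  solve 5 (λ a b c d e → (a :+ b) :+ (c :+ d :+ e) := (a :+ c) :+ (b :+ d) :+ e) refl
    (ci k (above x L)) (ciPred k (above x L)) (ci (suc k) L) (ci k L) r
  where open +-*-Solver

-- No increasing sequence passes from L or N into R. An occurrence lies in L, or consists of k
-- letters of L and N, or lies in R.
ci-node : ∀ k {N R} L → All (_< N) L → All (_< N) R → L ≫ R →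
  ci (suc k) (L ++ N ∷ R) ≡ ci (suc k) L + ci k L + ci (suc k) R
ci-node k {N} {R} []      _           R<N _            rewrite above-none R<N = refl
ci-node k {N} {R} (x ∷ L) (x<N ∷ L<N) R<N (R<x ∷ L≫R) = trans
  (cong₂ _+_ (trans (cong (ci k) (above-split L x<N R<x)) (ci-snoc k (above x L) (above-All x L<N))) (ci-node k L L<N R<N L≫R))
  (ci-node-step k x L (ci (suc k) R))

-- The pair l < r is the only increasing one that joins the left part to R.
crossing : ℕ → ℕ
crossing 1 = 1
crossing _ = 0

-- Beyond the three kinds in `ci-node` there is the pair l r. It does not extend: the letters before
-- l exceed r, N is too large to stand between, and r is the only letter of R above l.
ci-cross : ∀ k {N R l r} L → All (_< N) (l ∷ L) → All (_< N) R → L ≫ (l ∷ R) → above l R ≡ [ r ] → r < N →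
  ci (suc k) (L ++ l ∷ N ∷ R) ≡ ci (suc k) (L ++ [ l ]) + ci k (L ++ [ l ]) + (ci (suc k) R + crossing k)
ci-cross k {N} {R} {l} {r} [] (l<N ∷ []) R<N [] e r<N
  rewrite above-∷ R l<N | e | above-none R<N = base k
  where
  base : ∀ k → ci k (N ∷ r ∷ []) + (ci k [] + ci (suc k) R) ≡ ci k [] + 0 + ci k [ l ] + (ci (suc k) R + crossing k)
  base zero          = cong (suc ∘ suc) (sym (ℕₚ.+-identityʳ (ci 1 R)))
  base (suc zero)    = cong suc (ℕₚ.+-comm 1 (ci 2 R))
  base (suc (suc k)) rewrite <ᵇ-false (ℕₚ.<⇒≤ r<N) = sym (ℕₚ.+-identityʳ (ci (3 + k) R))
ci-cross k {N} {R} {l} {r} (x ∷ L) (l<N ∷ x<N ∷ L<N) R<N ((l<x ∷ R<x) ∷ L≫) e r<N = begin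
  ci k (above x (L ++ l ∷ N ∷ R)) + ci (suc k) (L ++ l ∷ N ∷ R)
    ≡⟨ cong₂ _+_ (trans (cong (ci k) (above-split-last L l<x x<N R<x)) (ci-snoc k (above x L) (above-All x L<N)))
                 (ci-cross k L (l<N ∷ L<N) R<N L≫ e r<N) ⟩
  (ci k (above x L) + ciPred k (above x L)) + (ci (suc k) (L ++ [ l ]) + ci k (L ++ [ l ]) + (ci (suc k) R + crossing k))
    ≡⟨ cong (λ ys → (ci k ys + ciPred k ys) + (ci (suc k) (L ++ [ l ]) + ci k (L ++ [ l ]) + (ci (suc k) R + crossing k))) (above-last L l<x) ⟨
  (ci k (above x (L ++ [ l ])) + ciPred k (above x (L ++ [ l ]))) + (ci (suc k) (L ++ [ l ]) + ci k (L ++ [ l ]) + (ci (suc k) R + crossing k))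
    ≡⟨ ci-node-step k x (L ++ [ l ]) (ci (suc k) R + crossing k) ⟩
  ci (suc k) (x ∷ L ++ [ l ]) + ci k (x ∷ L ++ [ l ]) + (ci (suc k) R + crossing k) ∎
  where open ≡-Reasoning

below-snoc : ∀ {y N} L → y < N → below y (L ++ [ N ]) ≡ below y L
below-snoc {y} {N} L y<N = trans (Listₚ.filter-++ (λ z → T? (z <ᵇ y)) L [ N ]) (trans (cong (below y L ++_) last) (Listₚ.++-identityʳ (below y L)))
  where
  last : below y [ N ] ≡ []
  last rewrite <ᵇ-false (ℕₚ.<⇒≤ y<N) = refl

c21-snoc : ∀ {N} L → All (_< N) L → c21 (L ++ [ N ]) ≡ c21 L
c21-snoc []      _           = refl
c21-snoc (y ∷ L) (y<N ∷ L<N) = cong₂ _+_ (cong length (below-snoc L y<N)) (c21-snoc L L<N)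

-- An occurrence inside neither part has its 1 in L and its 2 in R, which `L ≫ R` forbids.
c132-node : ∀ {N R} L → All (_< N) L → All (_< N) R → L ≫ R → c132 (L ++ N ∷ R) ≡ c132 L + c132 R
c132-node []      _           R<N _ rewrite above-none R<N = refl
c132-node {N} {R} (x ∷ L) (x<N ∷ L<N) R<N (R<x ∷ L≫R) = trans
  (cong₂ _+_ (trans (cong c21 (above-split L x<N R<x)) (c21-snoc (above x L) (above-All x L<N))) (c132-node L L<N R<N L≫R))
  (sym (ℕₚ.+-assoc (c21 (above x L)) (c132 L) (c132 R)))

-- The ascent from l to r carries only l N r: nothing stands between l and N, and no other letter of
-- R exceeds l.
c132-cross : ∀ {N R l r} L → All (_< N) (l ∷ L) → All (_< N) R → L ≫ (l ∷ R) → above l R ≡ [ r ] → r < N →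
  c132 (L ++ l ∷ N ∷ R) ≡ c132 (L ++ [ l ]) + suc (c132 R)
c132-cross {N} {R} {l} {r} [] (l<N ∷ []) R<N [] e r<N
  rewrite above-∷ R l<N | e | above-none R<N | <ᵇ-true r<N = refl
c132-cross {N} {R} {l} {r} (x ∷ L) (l<N ∷ x<N ∷ L<N) R<N ((l<x ∷ R<x) ∷ L≫) e r<N = begin
  c21 (above x (L ++ l ∷ N ∷ R)) + c132 (L ++ l ∷ N ∷ R)
    ≡⟨ cong₂ _+_ (trans (cong c21 (above-split-last L l<x x<N R<x)) (c21-snoc (above x L) (above-All x L<N)))
                 (c132-cross L (l<N ∷ L<N) R<N L≫ e r<N) ⟩
  c21 (above x L) + (c132 (L ++ [ l ]) + suc (c132 R))
    ≡⟨ cong (λ ys → c21 ys + (c132 (L ++ [ l ]) + suc (c132 R))) (above-last L l<x) ⟨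
  c21 (above x (L ++ [ l ])) + (c132 (L ++ [ l ]) + suc (c132 R))
    ≡⟨ ℕₚ.+-assoc (c21 (above x (L ++ [ l ]))) (c132 (L ++ [ l ])) (suc (c132 R)) ⟨
  c132 (x ∷ L ++ [ l ]) + suc (c132 R) ∎
  where open ≡-Reasoning

c21-++ʳ : ∀ xs ys → c21 ys ≤ c21 (xs ++ ys)
c21-++ʳ []       ys = ℕₚ.≤-refl
c21-++ʳ (x ∷ xs) ys = ℕₚ.≤-trans (c21-++ʳ xs ys) (ℕₚ.m≤n+m (c21 (xs ++ ys)) _)

-- N forms an inversion with each later letter.
c21-max : ∀ {N} xs ys → All (_< N) ys → length ys ≤ c21 (xs ++ N ∷ ys)
c21-max {N} xs ys ys<N = ℕₚ.≤-trans (ℕₚ.≤-trans (ℕₚ.≤-reflexive (cong length (sym (all-below ys ys<N)))) (ℕₚ.m≤m+n _ (c21 ys))) (c21-++ʳ xs (N ∷ ys))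
  where
  all-below : ∀ ys → All (_< N) ys → below N ys ≡ ys
  all-below []       []           = refl
  all-below (y ∷ ys) (y<N ∷ ys<N) rewrite <ᵇ-true y<N = cong (y ∷_) (all-below ys ys<N)

above-empty : ∀ x R → All (x ≢_) R → above x R ≡ [] → All (_< x) R
above-empty x []      _         _ = []
above-empty x (y ∷ R) (x≢y ∷ h) e with x <ᵇ y in eq
... | false = ℕₚ.≤∧≢⇒< (<ᵇ-false⁻¹ x y eq) (x≢y ∘ sym) ∷ above-empty x R h e

-- Each letter r of R above x completes an occurrence x N r.
c132-tail : ∀ {N R} x L → All (_< N) (x ∷ L) → All (_< N) R →
  length (above x R) + c132 (L ++ N ∷ R) ≤ c132 (x ∷ L ++ N ∷ R)
c132-tail {N} {R} x L (x<N ∷ L<N) R<N = ℕₚ.+-monoˡ-≤ (c132 (L ++ N ∷ R))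
  (ℕₚ.≤-trans (c21-max (above x L) (above x R) (above-All x R<N))
    (ℕₚ.≤-reflexive (cong c21 (sym (trans (above-++ x L (N ∷ R)) (cong (above x L ++_) (above-∷ R x<N)))))))

c132-zero⇒≫ : ∀ {N R} L → All (_< N) L → All (_< N) R → All (λ l → All (l ≢_) R) L → c132 (L ++ N ∷ R) ≡ 0 → L ≫ R
c132-zero⇒≫ []      _    _   _       _ = []
c132-zero⇒≫ {N} {R} (x ∷ L) xL<N R<N (x≢ ∷ L≢) e =
  above-empty x R x≢ (empty (above x R) (ℕₚ.m+n≡0⇒m≡0 _ tail≡0))
  ∷ c132-zero⇒≫ L (All.tail xL<N) R<N L≢ (ℕₚ.m+n≡0⇒n≡0 (length (above x R)) tail≡0)
  where
  empty : ∀ (ys : List ℕ) → length ys ≡ 0 → ys ≡ []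
  empty [] _ = refl
  tail≡0 : length (above x R) + c132 (L ++ N ∷ R) ≡ 0
  tail≡0 = ℕₚ.n≤0⇒n≡0 (ℕₚ.≤-trans (c132-tail x L xL<N R<N) (ℕₚ.≤-reflexive e))

-- The one way in which `L ≫ R` can fail when 132 occurs at most once.
record Crossing (L R : List ℕ) : Set where
  constructor crossed
  field
    {init}  : List ℕ
    {l r}   : ℕ
    L-snoc  : L ≡ init ++ [ l ]
    init≫R  : init ≫ R
    above-l : above l R ≡ [ r ]

≫-or-crossing : ∀ {N R} L → All (_< N) L → All (_< N) R → All (λ l → All (l ≢_) R) L → c132 (L ++ N ∷ R) ≤ 1 →
  L ≫ R ⊎ Crossing L R
≫-or-crossing []      _    _   _       _ = inj₁ []
≫-or-crossing {N} {R} (x ∷ L) xL<N R<N (x≢ ∷ L≢) c≤1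
  with above x R in eq | c132-tail {R = R} x L xL<N R<N
... | [] | tail≤ with ≫-or-crossing L (All.tail xL<N) R<N L≢ (ℕₚ.≤-trans tail≤ c≤1)
...   | inj₁ L≫R                = inj₁ (above-empty x R x≢ eq ∷ L≫R)
...   | inj₂ (crossed e i≫R al) = inj₂ (crossed (cong (x ∷_) e) (above-empty x R x≢ eq ∷ i≫R) al)
≫-or-crossing {N} {R} (x ∷ L) xL<N R<N (x≢ ∷ L≢) c≤1 | r ∷ rs | tail≤ = inj₂ (only L rs refl refl)
  where
  rest≤0 : length rs + c132 (L ++ N ∷ R) ≤ 0
  rest≤0 = ℕₚ.≤-pred (ℕₚ.≤-trans tail≤ c≤1)
  L≫R : L ≫ R
  L≫R = c132-zero⇒≫ L (All.tail xL<N) R<N L≢ (ℕₚ.n≤0⇒n≡0 (ℕₚ.≤-trans (ℕₚ.m≤n+m _ (length rs)) rest≤0))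
  x<r×r∈R : r ∈ R × x < r
  x<r×r∈R = ∈-above⁻ x R (subst (r ∈_) (sym eq) (here refl))
  only : ∀ L′ rs′ → L′ ≡ L → rs′ ≡ rs → Crossing (x ∷ L′) R
  only []       []       refl refl = crossed refl [] eq
  -- A letter y of L after x lies above R, so x y r is an occurrence besides x N r.
  only (y ∷ L′) []       refl refl = ⊥-elim (ℕₚ.<⇒≱ (ℕₚ.≤-trans two≤ (ℕₚ.m≤m+n _ (c132 (L ++ N ∷ R)))) c≤1)
    where
    r<y : r < y
    r<y = All.lookup (All.head L≫R) (proj₁ x<r×r∈R)
    shape : above x (y ∷ L′ ++ N ∷ R) ≡ y ∷ above x L′ ++ N ∷ r ∷ []
    shape = trans (above-++ x (y ∷ L′) (N ∷ R)) (cong₂ _++_ (above-∷ L′ (ℕₚ.<-trans (proj₂ x<r×r∈R) r<y))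
      (trans (above-∷ R (All.head xL<N)) (cong (N ∷_) eq)))
    r∈below : r ∈ below y (above x L′ ++ N ∷ r ∷ [])
    r∈below = ∈ₚ.∈-filter⁺ (λ z → T? (z <ᵇ y)) (∈ₚ.∈-++⁺ʳ (above x L′) (there (here refl))) (ℕₚ.<⇒<ᵇ r<y)
    two≤ : 2 ≤ c21 (above x (y ∷ L′ ++ N ∷ R))
    two≤ = subst (λ ys → 2 ≤ c21 ys) (sym shape)
      (ℕₚ.+-mono-≤ (length-pos r∈below) (c21-max (above x L′) [ r ] (All.lookup R<N (proj₁ x<r×r∈R) ∷ [])))
  -- Two letters of R above x give two occurrences through N.
  only L′       (s ∷ rs′) refl refl with () ← rest≤0

Nonempty : List ℕ → Set
Nonempty xs = xs ≢ []

nonempty-map : ∀ (f : ℕ → ℕ) xs → Nonempty xs → Nonempty (map f xs)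
nonempty-map f []      ne e = ne refl
nonempty-map f (_ ∷ _) ne ()

-- Nonempty words accepted by `altUp` have odd length, so N falls on a peak. The empty word is
-- accepted as well and has to be excluded separately.
altUp-node : ∀ {N} L R → altUp L ≡ true → altUp R ≡ true → Nonempty L → Nonempty R →
  All (_< N) L → All (_< N) R → altUp (L ++ N ∷ R) ≡ true
altUp-node []              R       _  _  L≢[] _    _           _         = ⊥-elim (L≢[] refl)
altUp-node (a ∷ [])        []      _  _  _    R≢[] _           _         = ⊥-elim (R≢[] refl)
altUp-node (a ∷ [])        (b ∷ R) _  hR _    _    (a<N ∷ _)   (b<N ∷ _)
  rewrite <ᵇ-true a<N | <ᵇ-true b<N = hR
altUp-node (a ∷ b ∷ [])    R       hL _  _    _    _           _         with a <ᵇ b | hL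
... | true  | ()
... | false | ()
altUp-node (a ∷ b ∷ c ∷ L) R       hL hR _    R≢[] (_ ∷ _ ∷ h) R<N       with a <ᵇ b | c <ᵇ b
... | true  | true  = altUp-node (c ∷ L) R hL hR (λ ()) R≢[] h R<N
altUp-node (a ∷ b ∷ c ∷ L) R       () hR _    R≢[] _           R<N       | true  | false
altUp-node (a ∷ b ∷ c ∷ L) R       () hR _    R≢[] _           R<N       | false | _

-- The maximum cannot stand in a valley next to another letter: it is a peak with letters on both
-- sides, or the whole word.
altUp-split : ∀ {N} L R → altUp (L ++ N ∷ R) ≡ true → All (_< N) L → All (_< N) R →
  (L ≡ [] × R ≡ []) ⊎ ((altUp L ≡ true × Nonempty L) × (altUp R ≡ true × Nonempty R))
altUp-split []              []      _ _             _         = inj₁ (refl , refl)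
altUp-split {N} []          (b ∷ R) h _             (b<N ∷ _) rewrite <ᵇ-false (ℕₚ.<⇒≤ b<N) with () ← h
altUp-split {N} (a ∷ [])    []      h (a<N ∷ _)     _         rewrite <ᵇ-true a<N with () ← h
altUp-split {N} (a ∷ [])    (b ∷ R) h (a<N ∷ _)     (b<N ∷ _) rewrite <ᵇ-true a<N | <ᵇ-true b<N =
  inj₂ ((refl , λ ()) , (h , λ ()))
altUp-split {N} (a ∷ b ∷ []) R      h (_ ∷ b<N ∷ _) _         rewrite <ᵇ-false (ℕₚ.<⇒≤ b<N) with a <ᵇ b | h
... | true  | ()
... | false | ()
altUp-split {N} (a ∷ b ∷ c ∷ L) R   h (_ ∷ _ ∷ h′)  R<N       with a <ᵇ b | c <ᵇ b | h
... | true  | false | ()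
... | false | _     | ()
... | true  | true  | h″ with altUp-split (c ∷ L) R h″ h′ R<N
...   | inj₂ ((hL , _) , hR) = inj₂ ((hL , λ ()) , hR)

-- Invariance under relabellings that preserve the relative order

-- Monotonicity on the letters of one word only: `swap` reverses l and r, yet it is monotone on each
-- side of N taken alone.
MonoOn : (ℕ → ℕ) → List ℕ → Set
MonoOn f xs = ∀ {a b} → a ∈ xs → b ∈ xs → a < b → f a < f b

MonoOn-<ᵇ : ∀ {f xs} → MonoOn f xs → ∀ {a b} → a ∈ xs → b ∈ xs → (f a <ᵇ f b) ≡ (a <ᵇ b)
MonoOn-<ᵇ {f} mono {a} {b} a∈ b∈ with ℕₚ.<-cmp a b
... | tri< a<b _ _ = trans (<ᵇ-true (mono a∈ b∈ a<b)) (sym (<ᵇ-true a<b))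
... | tri≈ _ refl _ = trans (<ᵇ-false (ℕₚ.≤-refl {f a})) (sym (<ᵇ-false (ℕₚ.≤-refl {a})))
... | tri> _ _ b<a = trans (<ᵇ-false (ℕₚ.<⇒≤ (mono b∈ a∈ b<a))) (sym (<ᵇ-false (ℕₚ.<⇒≤ b<a)))

filterᵇ-map : ∀ {f : ℕ → ℕ} {p q : ℕ → Bool} xs → (∀ {y} → y ∈ xs → p (f y) ≡ q y) →
  filterᵇ p (map f xs) ≡ map f (filterᵇ q xs)
filterᵇ-map []       e = refl
filterᵇ-map {q = q} (x ∷ xs) e rewrite e (here refl) with q x
... | true  = cong (_ ∷_) (filterᵇ-map xs (e ∘ there))
... | false = filterᵇ-map xs (e ∘ there)

above-map : ∀ {f x xs} → MonoOn f (x ∷ xs) → above (f x) (map f xs) ≡ map f (above x xs)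
above-map {f} {x} {xs} mono = filterᵇ-map xs (λ y∈ → MonoOn-<ᵇ mono (here refl) (there y∈))

below-map : ∀ {f x xs} → MonoOn f (x ∷ xs) → below (f x) (map f xs) ≡ map f (below x xs)
below-map {f} {x} {xs} mono = filterᵇ-map xs (λ y∈ → MonoOn-<ᵇ mono (there y∈) (here refl))

MonoOn-tail : ∀ {f x xs} → MonoOn f (x ∷ xs) → MonoOn f xs
MonoOn-tail mono a∈ b∈ = mono (there a∈) (there b∈)

MonoOn-above : ∀ {f x xs} → MonoOn f (x ∷ xs) → MonoOn f (above x xs)
MonoOn-above {x = x} {xs} mono a∈ b∈ = mono (there (proj₁ (∈-above⁻ x xs a∈))) (there (proj₁ (∈-above⁻ x xs b∈)))

ci-map : ∀ k {f} xs → MonoOn f xs → ci k (map f xs) ≡ ci k xs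
ci-map zero    xs       mono = refl
ci-map (suc k) []       mono = refl
ci-map (suc k) (x ∷ xs) mono = cong₂ _+_
  (trans (cong (ci k) (above-map mono)) (ci-map k (above x xs) (MonoOn-above mono)))
  (ci-map (suc k) xs (MonoOn-tail mono))

c21-map : ∀ {f} xs → MonoOn f xs → c21 (map f xs) ≡ c21 xs
c21-map []       mono = refl
c21-map {f} (x ∷ xs) mono = cong₂ _+_
  (trans (cong length (below-map mono)) (Listₚ.length-map f (below x xs)))
  (c21-map xs (MonoOn-tail mono))

c132-map : ∀ {f} xs → MonoOn f xs → c132 (map f xs) ≡ c132 xs
c132-map []       mono = refl
c132-map (x ∷ xs) mono = cong₂ _+_
  (trans (cong c21 (above-map mono)) (c21-map (above x xs) (MonoOn-above mono)))
  (c132-map xs (MonoOn-tail mono))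

mutual
  altUp-map : ∀ {f} xs → MonoOn f xs → altUp (map f xs) ≡ altUp xs
  altUp-map []           mono = refl
  altUp-map (x ∷ [])     mono = refl
  altUp-map (x ∷ y ∷ xs) mono = cong₂ _∧_ (MonoOn-<ᵇ mono (here refl) (there (here refl))) (altDown-map (y ∷ xs) (MonoOn-tail mono))

  altDown-map : ∀ {f} xs → MonoOn f xs → altDown (map f xs) ≡ altDown xs
  altDown-map []           mono = refl
  altDown-map (x ∷ [])     mono = refl
  altDown-map (x ∷ y ∷ xs) mono = cong₂ _∧_ (MonoOn-<ᵇ mono (there (here refl)) (here refl)) (altUp-map (y ∷ xs) (MonoOn-tail mono))

-- The exchange of two values

swap : ℕ → ℕ → ℕ → ℕ
swap l r v with v ℕₚ.≟ l | v ℕₚ.≟ r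
... | yes _ | _     = r
... | no _  | yes _ = l
... | no _  | no _  = v

swap-l : ∀ l r → swap l r l ≡ r
swap-l l r with l ℕₚ.≟ l | l ℕₚ.≟ r
... | yes _  | _ = refl
... | no l≢l | _ = ⊥-elim (l≢l refl)

swap-r : ∀ l r → swap l r r ≡ l
swap-r l r with r ℕₚ.≟ l | r ℕₚ.≟ r
... | yes r≡l | _       = r≡l
... | no _    | yes _   = refl
... | no _    | no r≢r  = ⊥-elim (r≢r refl)

swap-other : ∀ {l r v} → v ≢ l → v ≢ r → swap l r v ≡ v
swap-other {l} {r} {v} v≢l v≢r with v ℕₚ.≟ l | v ℕₚ.≟ r
... | yes v≡l | _       = ⊥-elim (v≢l v≡l)
... | no _    | yes v≡r = ⊥-elim (v≢r v≡r)
... | no _    | no _    = refl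

data SwapCase (l r v : ℕ) : Set where
  isL   : v ≡ l → SwapCase l r v
  isR   : v ≡ r → SwapCase l r v
  other : v ≢ l → v ≢ r → SwapCase l r v

swapCase : ∀ l r v → SwapCase l r v
swapCase l r v with v ℕₚ.≟ l | v ℕₚ.≟ r
... | yes e | _     = isL e
... | no _  | yes e = isR e
... | no e  | no f  = other e f

swap-involutive : ∀ l r v → swap l r (swap l r v) ≡ v
swap-involutive l r v with swapCase l r v
... | isL refl  = trans (cong (swap l r) (swap-l l r)) (swap-r l r)
... | isR refl  = trans (cong (swap l r) (swap-r l r)) (swap-l l r)
... | other e f = trans (cong (swap l r) (swap-other e f)) (swap-other e f)

swap-injective : ∀ l r {v v′} → swap l r v ≡ swap l r v′ → v ≡ v′
swap-injective l r {v} {v′} e = trans (sym (swap-involutive l r v)) (trans (cong (swap l r) e) (swap-involutive l r v′))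

map-swap-involutive : ∀ l r xs → map (swap l r) (map (swap l r) xs) ≡ xs
map-swap-involutive l r xs = trans (sym (Listₚ.map-∘ xs)) (trans (Listₚ.map-cong (swap-involutive l r) xs) (Listₚ.map-id xs))

map-swap-other : ∀ {l r} xs → All (λ v → v ≢ l × v ≢ r) xs → map (swap l r) xs ≡ xs
map-swap-other []       []              = refl
map-swap-other (x ∷ xs) ((e , f) ∷ es) = cong₂ _∷_ (swap-other e f) (map-swap-other xs es)

swap-between : ∀ {l r c} → l < r → c ≡ l ⊎ c ≡ r → l ≤ swap l r c × swap l r c ≤ r
swap-between {l} {r} l<r (inj₁ refl) rewrite swap-l l r = ℕₚ.<⇒≤ l<r , ℕₚ.≤-refl
swap-between {l} {r} l<r (inj₂ refl) rewrite swap-r l r = ℕₚ.≤-refl , ℕₚ.<⇒≤ l<r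

between : ∀ {l r c} → l < r → c ≡ l ⊎ c ≡ r → l ≤ c × c ≤ r
between l<r (inj₁ refl) = ℕₚ.≤-refl , ℕₚ.<⇒≤ l<r
between l<r (inj₂ refl) = ℕₚ.<⇒≤ l<r , ℕₚ.≤-refl

-- The word holds one of the two values, and its other letters exceed both, so no comparison
-- changes. The value c is r when a word is built from trees and l when the exchange is undone.
swap-mono-upper : ∀ {l r c} xs → l < r → c ≡ l ⊎ c ≡ r → All (λ v → v ≡ c ⊎ r < v) xs → MonoOn (swap l r) xs
swap-mono-upper {l} {r} {c} xs l<r c∈ h {a} {b} a∈ b∈ a<b with All.lookup h a∈ | All.lookup h b∈
... | inj₁ refl | inj₁ refl = ⊥-elim (ℕₚ.<-irrefl refl a<b)
... | inj₂ r<a  | inj₁ refl = ⊥-elim (ℕₚ.<⇒≱ (ℕₚ.<-trans r<a a<b) (proj₂ (between l<r c∈)))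
... | inj₁ refl | inj₂ r<b  = ℕₚ.≤-<-trans (proj₂ (swap-between l<r c∈))
  (subst (r <_) (sym (swap-other (ℕₚ.<⇒≢ (ℕₚ.<-trans l<r r<b) ∘ sym) (ℕₚ.<⇒≢ r<b ∘ sym))) r<b)
... | inj₂ r<a  | inj₂ r<b
  rewrite swap-other (ℕₚ.<⇒≢ (ℕₚ.<-trans l<r r<a) ∘ sym) (ℕₚ.<⇒≢ r<a ∘ sym)
        | swap-other (ℕₚ.<⇒≢ (ℕₚ.<-trans l<r r<b) ∘ sym) (ℕₚ.<⇒≢ r<b ∘ sym) = a<b

swap-mono-lower : ∀ {l r c} xs → l < r → c ≡ l ⊎ c ≡ r → All (λ v → v ≡ c ⊎ v < l) xs → MonoOn (swap l r) xs
swap-mono-lower {l} {r} {c} xs l<r c∈ h {a} {b} a∈ b∈ a<b with All.lookup h a∈ | All.lookup h b∈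
... | inj₁ refl | inj₁ refl = ⊥-elim (ℕₚ.<-irrefl refl a<b)
... | inj₁ refl | inj₂ b<l  = ⊥-elim (ℕₚ.<⇒≱ (ℕₚ.<-trans a<b b<l) (proj₁ (between l<r c∈)))
... | inj₂ a<l  | inj₁ refl = ℕₚ.<-≤-trans
  (subst (_< l) (sym (swap-other (ℕₚ.<⇒≢ a<l) (ℕₚ.<⇒≢ (ℕₚ.<-trans a<l l<r)))) a<l)
  (proj₁ (swap-between l<r c∈))
... | inj₂ a<l  | inj₂ b<l
  rewrite swap-other (ℕₚ.<⇒≢ a<l) (ℕₚ.<⇒≢ (ℕₚ.<-trans a<l l<r))
        | swap-other (ℕₚ.<⇒≢ b<l) (ℕₚ.<⇒≢ (ℕₚ.<-trans b<l l<r)) = a<b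

-- Arrangements of an interval of values

-- Listed from the top, so that the maximum at which a word is cut comes first and an upper interval
-- followed by a lower one is again an interval.
interval : ℕ → ℕ → List ℕ
interval o zero    = []
interval o (suc n) = o + suc n ∷ interval o n

InInterval : ℕ → ℕ → ℕ → Set
InInterval o n v = o < v × v ≤ o + n

interval-bounds : ∀ o n → All (InInterval o n) (interval o n)
interval-bounds o zero    = []
interval-bounds o (suc n) = (ℕₚ.m<m+n o (s≤s z≤n) , ℕₚ.≤-refl) ∷
  All.map (λ (o<v , v≤) → o<v , ℕₚ.≤-trans v≤ (ℕₚ.+-monoʳ-≤ o (ℕₚ.n≤1+n n))) (interval-bounds o n)

interval-length : ∀ o n → length (interval o n) ≡ n
interval-length o zero    = refl
interval-length o (suc n) = cong suc (interval-length o n)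

interval-unique : ∀ o n → Unique (interval o n)
interval-unique o zero    = []
interval-unique o (suc n) = All.map (λ (_ , v≤) e → ℕₚ.<⇒≱ (ℕₚ.+-monoʳ-< o (ℕₚ.n<1+n n)) (subst (_≤ o + n) (sym e) v≤)) (interval-bounds o n)
  ∷ interval-unique o n

∈-interval : ∀ o n {v} → InInterval o n v → v ∈ interval o n
∈-interval o zero    (o<v , v≤) = ⊥-elim (ℕₚ.<⇒≱ o<v (ℕₚ.≤-trans v≤ (ℕₚ.≤-reflexive (ℕₚ.+-identityʳ o))))
∈-interval o (suc n) {v} (o<v , v≤) with v ℕₚ.≟ (o + suc n)
... | yes e = here e
... | no ¬e = there (∈-interval o n (o<v , ℕₚ.≤-pred (ℕₚ.≤-trans (ℕₚ.≤∧≢⇒< v≤ ¬e) (ℕₚ.≤-reflexive (ℕₚ.+-suc o n)))))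

interval-++ : ∀ o a b → interval (o + b) a ++ interval o b ≡ interval o (a + b)
interval-++ o zero    b = refl
interval-++ o (suc a) b = cong₂ _∷_
  (trans (ℕₚ.+-assoc o b (suc a)) (cong (λ n → o + n) (ℕₚ.+-comm b (suc a)))) (interval-++ o a b)

∈-remove : ∀ {x v : ℕ} xs {ys} → v ∈ xs ++ x ∷ ys → v ≢ x → v ∈ xs ++ ys
∈-remove []       (here e)   v≢x = ⊥-elim (v≢x e)
∈-remove []       (there v∈) v≢x = v∈
∈-remove (z ∷ xs) (here e)   v≢x = here e
∈-remove (z ∷ xs) (there v∈) v≢x = there (∈-remove xs v∈ v≢x)

-- Pigeonhole: each letter of `xs` uses up one of `ys`, and equal lengths leave none over.
unique-full : ∀ {xs ys : List ℕ} → Unique xs → All (_∈ ys) xs → length xs ≡ length ys → xs ↭ ys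
unique-full {[]}     {[]}     _          _           _ = ↭-refl
unique-full {x ∷ xs} {ys}     (x≢ ∷ uxs) (x∈ ∷ xs⊆) e with ∈ₚ.∈-∃++ x∈
... | as , bs , refl = ↭-trans (↭.prep x (unique-full uxs (remove x≢ xs⊆) lengths)) (↭-sym (↭ₚ.shift x as bs))
  where
  remove : ∀ {vs} → All (x ≢_) vs → All (_∈ as ++ x ∷ bs) vs → All (_∈ as ++ bs) vs
  remove []         []        = []
  remove (x≢v ∷ h) (v∈ ∷ vs∈) = ∈-remove as v∈ (x≢v ∘ sym) ∷ remove h vs∈
  lengths : length xs ≡ length (as ++ bs)
  lengths = ℕₚ.suc-injective (trans e (↭ₚ.↭-length (↭ₚ.shift x as bs)))

arrangement : ∀ {o n π} → Unique π → All (InInterval o n) π → length π ≡ n → π ↭ interval o n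
arrangement {o} {n} u b e = unique-full u (All.map (∈-interval o n) b) (trans e (sym (interval-length o n)))

module _ {o n π} (p : π ↭ interval o n) where

  arrangement-length : length π ≡ n
  arrangement-length = trans (↭ₚ.↭-length p) (interval-length o n)

  arrangement-bounds : All (InInterval o n) π
  arrangement-bounds = ↭ₚ.All-resp-↭ (↭-sym p) (interval-bounds o n)

  arrangement-unique : Unique π
  arrangement-unique = ↭ₛₚ.Unique-resp-↭ (≡-setoid ℕ) (↭.↭⇒↭ₛ (↭-sym p)) (interval-unique o n)

  arrangement-∈ : ∀ {v} → InInterval o n v → v ∈ π
  arrangement-∈ h = ↭ₚ.∈-resp-↭ (↭-sym p) (∈-interval o n h)

arrangement-node : ∀ {o a b L R} → L ↭ interval (o + b) a → R ↭ interval o b →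
  L ++ (o + suc (a + b)) ∷ R ↭ interval o (suc (a + b))
arrangement-node {o} {a} {b} {L} {R} p q = ↭-trans (↭ₚ.shift (o + suc (a + b)) L R)
  (↭.prep _ (↭-trans (↭ₚ.++⁺ p q) (↭.↭-reflexive (interval-++ o a b))))

arrangement-≫ : ∀ {o a b L R} → L ↭ interval (o + b) a → R ↭ interval o b → L ≫ R
arrangement-≫ {o} {a} {b} p q = All.map (λ (o+b<l , _) → All.map (λ (_ , r≤) → ℕₚ.≤-<-trans r≤ o+b<l) (arrangement-bounds {o} {b} q))
  (arrangement-bounds {o + b} {a} p)

-- Unless L is empty, the largest value lies in L, for in R it would be exceeded by a letter of L.
-- Removing it leaves the same situation with n smaller.
arrangement-split : ∀ o n {L R} → L ≫ R → L ++ R ↭ interval o n →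
  L ↭ interval (o + length R) (length L) × R ↭ interval o (length R)
arrangement-split o n {[]} {R} _ p = ↭-refl , subst (λ m → R ↭ interval o m) (sym (arrangement-length p)) p
arrangement-split o zero {x ∷ L} {R} _ p with () ← arrangement-length {o} {zero} p
arrangement-split o (suc n) {x ∷ L} {R} xL≫R p with ∈ₚ.∈-++⁻ (x ∷ L) (arrangement-∈ p {o + suc n} (ℕₚ.m<m+n o (s≤s z≤n) , ℕₚ.≤-refl))
... | inj₂ N∈R = ⊥-elim (ℕₚ.<⇒≱ (All.lookup (All.head xL≫R) N∈R) (proj₂ (All.head (arrangement-bounds p))))
... | inj₁ N∈L with ∈ₚ.∈-∃++ N∈L
...   | as , bs , e with arrangement-split o n {as ++ bs} {R} (remove (subst (_≫ R) e xL≫R))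
                        (↭-trans (↭.↭-reflexive (Listₚ.++-assoc as bs R)) (↭ₚ.drop-mid as [] (↭-trans (↭.↭-reflexive shape) p)))
  where
  remove : as ++ (o + suc n) ∷ bs ≫ R → as ++ bs ≫ R
  remove h = Allₚ.++⁺ (Allₚ.++⁻ˡ as h) (All.tail (Allₚ.++⁻ʳ as h))
  shape : as ++ (o + suc n) ∷ bs ++ R ≡ (x ∷ L) ++ R
  shape = trans (sym (Listₚ.++-assoc as ((o + suc n) ∷ bs) R)) (cong (_++ R) (sym e))
...     | p₁ , p₂ = ↭-trans (↭.↭-reflexive e) (↭-trans (↭ₚ.shift (o + suc n) as bs)
                      (subst (λ m → o + suc n ∷ as ++ bs ↭ interval (o + length R) m) (sym lengths)
                        (subst (λ N → N ∷ as ++ bs ↭ interval (o + length R) (suc (length (as ++ bs)))) top (↭.prep _ p₁)))) , p₂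
  where
  lengths : length (x ∷ L) ≡ suc (length (as ++ bs))
  lengths = trans (cong length e) (↭ₚ.↭-length (↭ₚ.shift (o + suc n) as bs))
  total : length (as ++ bs) + length R ≡ n
  total = ℕₚ.suc-injective (trans (cong (_+ length R) (sym lengths)) (trans (sym (Listₚ.length-++ (x ∷ L))) (arrangement-length p)))
  top : o + length R + suc (length (as ++ bs)) ≡ o + suc n
  top = trans (ℕₚ.+-assoc o (length R) _) (cong (λ m → o + m)
    (trans (ℕₚ.+-suc (length R) _) (cong suc (trans (ℕₚ.+-comm (length R) _) total))))

-- Trees for the permutations with no 132 and with exactly one 132

data Tree : Set where
  leaf : Tree
  node : Tree → Tree → Tree

-- A tree with one marked node: the unique 132 uses the maximum of the word read at the marked node.
data Marked : Set where
  inˡ : Marked → Tree → Marked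
  inʳ : Tree → Marked → Marked
  top : Tree → Tree → Marked

size : Tree → ℕ
size leaf       = 1
size (node s t) = suc (size s + size t)

sizeᴹ : Marked → ℕ
sizeᴹ (inˡ x t) = suc (sizeᴹ x + size t)
sizeᴹ (inʳ t x) = suc (size t + sizeᴹ x)
sizeᴹ (top s t) = suc (size s + size t)

-- The words use the values o + 1, …, o + size.
word : Tree → ℕ → List ℕ
word leaf       o = [ o + 1 ]
word (node s t) o = word s (o + size t) ++ o + suc (size s + size t) ∷ word t o

-- At the marked node the largest value of the right part and the smallest one of the left part trade places.
wordᴹ : Marked → ℕ → List ℕ
wordᴹ (inˡ x t) o = wordᴹ x (o + size t) ++ o + suc (sizeᴹ x + size t) ∷ word t o
wordᴹ (inʳ t x) o = word t (o + sizeᴹ x) ++ o + suc (size t + sizeᴹ x) ∷ wordᴹ x o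
wordᴹ (top s t) o = map (swap m (m + 1)) (word s m) ++ o + suc (size s + size t) ∷ map (swap m (m + 1)) (word t o)
  where m = o + size t

-- The recursion of `ci-node`. A leaf is one letter, so `ci k []` is 1 for the pattern 1 and 0 for
-- longer ones.
incs : ℕ → Tree → ℕ
incs zero    t          = 1
incs (suc k) leaf       = ci k []
incs (suc k) (node s t) = incs (suc k) s + incs k s + incs (suc k) t

incsᴹ : ℕ → Marked → ℕ
incsᴹ zero    x         = 1
incsᴹ (suc k) (inˡ x t) = incsᴹ (suc k) x + incsᴹ k x + incs (suc k) t
incsᴹ (suc k) (inʳ t x) = incs (suc k) t + incs k t + incsᴹ (suc k) x
incsᴹ (suc k) (top s t) = incs (suc k) s + incs k s + (incs (suc k) t + crossing k)

module Split {o a b L R} (p : L ↭ interval (o + b) a) (q : R ↭ interval o b) where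

  N : ℕ
  N = o + suc (a + b)

  o+b<N : o + b < N
  o+b<N = ℕₚ.+-monoʳ-< o (s≤s (ℕₚ.m≤n+m b a))

  L<N : All (_< N) L
  L<N = All.map (λ (_ , l≤) → ℕₚ.≤-<-trans (ℕₚ.≤-trans l≤ (ℕₚ.≤-reflexive (trans (ℕₚ.+-assoc o b a) (cong (λ m → o + m) (ℕₚ.+-comm b a)))))
                      (ℕₚ.+-monoʳ-< o (ℕₚ.n<1+n (a + b)))) (arrangement-bounds {o + b} {a} p)

  R<N : All (_< N) R
  R<N = All.map (λ (_ , r≤) → ℕₚ.≤-<-trans r≤ o+b<N) (arrangement-bounds {o} {b} q)

  L≫R : L ≫ R
  L≫R = arrangement-≫ {o} {a} {b} p q

word-arrangement : ∀ t o → word t o ↭ interval o (size t)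
word-arrangement leaf       o = ↭-refl
word-arrangement (node s t) o = arrangement-node (word-arrangement s (o + size t)) (word-arrangement t o)

module WordSplit (s t : Tree) (o : ℕ) =
  Split {o} {size s} {size t} (word-arrangement s (o + size t)) (word-arrangement t o)

-- A word that avoids 132 ends with its smallest letter, because its parts satisfy L ≫ R.
word-init : Tree → ℕ → List ℕ
word-init leaf       o = []
word-init (node s t) o = word s (o + size t) ++ o + suc (size s + size t) ∷ word-init t o

word-snoc : ∀ t o → word t o ≡ word-init t o ++ [ o + 1 ]
word-snoc leaf       o = refl
word-snoc (node s t) o = trans (cong (λ ys → word s (o + size t) ++ o + suc (size s + size t) ∷ ys) (word-snoc t o))
  (sym (Listₚ.++-assoc (word s (o + size t)) (o + suc (size s + size t) ∷ word-init t o) [ o + 1 ]))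

snoc-nonempty : ∀ xs x → Nonempty (xs ++ [ x ])
snoc-nonempty []       x ()
snoc-nonempty (y ∷ xs) x ()

word-nonempty : ∀ t o → Nonempty (word t o)
word-nonempty t o rewrite word-snoc t o = snoc-nonempty (word-init t o) (o + 1)

unique-snoc : ∀ xs {x : ℕ} → Unique (xs ++ [ x ]) → All (_≢ x) xs
unique-snoc []       _       = []
unique-snoc (y ∷ xs) (h ∷ u) = All.head (Allₚ.++⁻ʳ xs h) ∷ unique-snoc xs u

zip-All : ∀ {P Q R : ℕ → Set} → (∀ {v} → P v → Q v → R v) → ∀ {xs} → All P xs → All Q xs → All R xs
zip-All f []       []       = []
zip-All f (p ∷ ps) (q ∷ qs) = f p q ∷ zip-All f ps qs

word-init-bounds : ∀ t o → All (o + 1 <_) (word-init t o)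
word-init-bounds t o = zip-All
  (λ (o<v , _) v≢ → ℕₚ.≤∧≢⇒< (ℕₚ.≤-trans (ℕₚ.≤-reflexive (ℕₚ.+-comm o 1)) o<v) (v≢ ∘ sym))
  (Allₚ.++⁻ˡ (word-init t o) (subst (All (InInterval o (size t))) (word-snoc t o) (arrangement-bounds (word-arrangement t o))))
  (unique-snoc (word-init t o) (subst Unique (word-snoc t o) (arrangement-unique (word-arrangement t o))))

word-altUp : ∀ t o → altUp (word t o) ≡ true
word-altUp leaf       o = refl
word-altUp (node s t) o = altUp-node (word s (o + size t)) (word t o) (word-altUp s (o + size t)) (word-altUp t o)
  (word-nonempty s (o + size t)) (word-nonempty t o) L<N R<N
  where open WordSplit s t o

word-c132 : ∀ t o → c132 (word t o) ≡ 0
word-c132 leaf       o = refl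
word-c132 (node s t) o = trans (c132-node (word s (o + size t)) L<N R<N L≫R)
  (cong₂ _+_ (word-c132 s (o + size t)) (word-c132 t o))
  where open WordSplit s t o

word-ci : ∀ k t o → ci k (word t o) ≡ incs k t
word-ci zero    t          o = refl
word-ci (suc k) leaf       o = ℕₚ.+-identityʳ (ci k [])
word-ci (suc k) (node s t) o = trans (ci-node k (word s (o + size t)) L<N R<N L≫R)
  (cong₂ _+_ (cong₂ _+_ (word-ci (suc k) s (o + size t)) (word-ci k s (o + size t))) (word-ci (suc k) t o))
  where open WordSplit s t o

size-pos : ∀ u → 1 ≤ size u
size-pos leaf       = s≤s z≤n
size-pos (node _ _) = s≤s z≤n

-- The names `l` and `r` follow the exchanged word, where l ends the left part. Before the exchange
-- l is the maximum of `R` and r the minimum of `L`.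
module Cross (s t : Tree) (o : ℕ) where

  open WordSplit s t o public

  m l r : ℕ
  m = o + size t
  l = m
  r = m + 1

  l<r : l < r
  l<r = ℕₚ.m<m+n m (s≤s z≤n)

  σ : ℕ → ℕ
  σ = swap l r

  init L R L′ R′ : List ℕ
  init = word-init s m
  L    = word s m
  R    = word t o
  L′   = map σ L
  R′   = map σ R

  r<N : r < N
  r<N = ℕₚ.≤-<-trans (ℕₚ.≤-reflexive (ℕₚ.+-assoc o (size t) 1)) (ℕₚ.+-monoʳ-< o (s≤s (ℕₚ.≤-trans
    (ℕₚ.≤-reflexive (ℕₚ.+-comm (size t) 1)) (ℕₚ.+-monoˡ-≤ (size t) (size-pos s)))))

  l∈R : l ∈ R
  l∈R = arrangement-∈ {o} {size t} (word-arrangement t o) (ℕₚ.m<m+n o (size-pos t) , ℕₚ.≤-refl)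

  L-mono : MonoOn σ L
  L-mono = swap-mono-upper L l<r (inj₂ refl)
    (subst (All (λ v → v ≡ r ⊎ r < v)) (sym (word-snoc s m)) (Allₚ.++⁺ (All.map inj₂ (word-init-bounds s m)) (inj₁ refl ∷ [])))

  R-mono : MonoOn σ R
  R-mono = swap-mono-lower R l<r (inj₁ refl) (All.map low (arrangement-bounds {o} {size t} (word-arrangement t o)))
    where
    low : ∀ {v} → InInterval o (size t) v → v ≡ l ⊎ v < l
    low (_ , v≤) = Data.Sum.swap (ℕₚ.m≤n⇒m<n∨m≡n v≤)

  L′-snoc : L′ ≡ init ++ [ l ]
  L′-snoc = trans (cong (map σ) (word-snoc s m)) (trans (Listₚ.map-++ σ init [ r ])
    (cong₂ (λ xs v → xs ++ [ v ]) (map-swap-other init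
      (All.map (λ r<v → (λ e → ℕₚ.<⇒≢ (ℕₚ.<-trans l<r r<v) (sym e)) , (λ e → ℕₚ.<⇒≢ r<v (sym e))) (word-init-bounds s m))) (swap-r l r)))

  R′-values : All (λ v → v ≡ r ⊎ v < l) R′
  R′-values = Allₚ.map⁺ (All.map image (arrangement-bounds {o} {size t} (word-arrangement t o)))
    where
    image : ∀ {v} → InInterval o (size t) v → σ v ≡ r ⊎ σ v < l
    image (_ , v≤) with ℕₚ.m≤n⇒m<n∨m≡n v≤
    ... | inj₂ refl = inj₁ (swap-l l r)
    ... | inj₁ v<l  = inj₂ (subst (_< l) (sym (swap-other (ℕₚ.<⇒≢ v<l) (ℕₚ.<⇒≢ (ℕₚ.<-trans v<l l<r)))) v<l)

  init≫ : init ≫ (l ∷ R′)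
  init≫ = All.map (λ r<v → ℕₚ.<-trans l<r r<v ∷ All.map (λ { (inj₁ refl) → r<v ; (inj₂ w<l) → ℕₚ.<-trans w<l (ℕₚ.<-trans l<r r<v) }) R′-values)
    (word-init-bounds s m)

  R′<N : All (_< N) R′
  R′<N = All.map (λ { (inj₁ refl) → r<N ; (inj₂ w<l) → ℕₚ.<-trans w<l (ℕₚ.<-trans l<r r<N) }) R′-values

  init<N : All (_< N) init
  init<N = Allₚ.++⁻ˡ init (subst (All (_< N)) (word-snoc s m) L<N)

  l-init<N : All (_< N) (l ∷ init)
  l-init<N = ℕₚ.<-trans l<r r<N ∷ init<N

  L′<N : All (_< N) L′
  L′<N = subst (All (_< N)) (sym L′-snoc) (Allₚ.++⁺ init<N (ℕₚ.<-trans l<r r<N ∷ []))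

  above-l : above l R′ ≡ [ r ]
  above-l = single R (arrangement-unique {o} {size t} (word-arrangement t o)) l∈R (arrangement-bounds {o} {size t} (word-arrangement t o))
    where
    rest : ∀ ys → All (InInterval o (size t)) ys → All (l ≢_) ys → above l (map σ ys) ≡ []
    rest ys b h = above-none (Allₚ.map⁺ (zip-All below-l b h))
      where
      below-l : ∀ {v} → InInterval o (size t) v → l ≢ v → σ v < l
      below-l (_ , v≤) l≢v = subst (_< l) (sym (swap-other (l≢v ∘ sym) (ℕₚ.<⇒≢ (ℕₚ.<-trans v<l l<r)))) v<l
        where v<l = ℕₚ.≤∧≢⇒< v≤ (l≢v ∘ sym)
    single : ∀ ys → Unique ys → l ∈ ys → All (InInterval o (size t)) ys → above l (map σ ys) ≡ [ r ]
    single (y ∷ ys) (h ∷ u) (here refl) (_ ∷ b) rewrite swap-l l r = trans (above-∷ (map σ ys) l<r) (cong (r ∷_) (rest ys b h))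
    single (y ∷ ys) (h ∷ u) (there l∈)  ((o<y , y≤) ∷ b)
      rewrite swap-other {l} {r} {y} (All.lookup h l∈) (ℕₚ.<⇒≢ (ℕₚ.≤-<-trans y≤ l<r))
            | <ᵇ-false {l} {y} y≤ = single ys u l∈ b

  shape : wordᴹ (top s t) o ≡ init ++ l ∷ N ∷ R′
  shape = trans (cong (_++ N ∷ R′) L′-snoc) (Listₚ.++-assoc init [ l ] (N ∷ R′))

  -- N exceeds both exchanged values and is fixed, so the exchange acts on the whole word; by
  -- injectivity the result is again an arrangement.
  map-shape : wordᴹ (top s t) o ≡ map σ (word (node s t) o)
  map-shape = sym (trans (Listₚ.map-++ σ L (N ∷ R)) (cong (λ v → L′ ++ v ∷ R′)
    (swap-other (ℕₚ.<⇒≢ (ℕₚ.<-trans l<r r<N) ∘ sym) (ℕₚ.<⇒≢ r<N ∘ sym))))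

  in-interval : ∀ {v} → InInterval o (size (node s t)) v → InInterval o (size (node s t)) (σ v)
  in-interval {v} (o<v , v≤) with swapCase l r v
  ... | isL refl  rewrite swap-l l r = ℕₚ.<-trans o<v l<r , ℕₚ.<⇒≤ r<N
  ... | isR refl  rewrite swap-r l r = ℕₚ.m<m+n o (size-pos t) , ℕₚ.<⇒≤ (ℕₚ.<-trans l<r r<N)
  ... | other e f rewrite swap-other e f = o<v , v≤

  cross-arrangement : wordᴹ (top s t) o ↭ interval o (size (node s t))
  cross-arrangement = subst (_↭ interval o (size (node s t))) (sym map-shape)
    (arrangement (Uniqueₚ.map⁺ (swap-injective l r) (arrangement-unique {o} {size (node s t)} p))
      (Allₚ.map⁺ (All.map in-interval (arrangement-bounds {o} {size (node s t)} p)))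
      (trans (Listₚ.length-map σ (word (node s t) o)) (arrangement-length {o} {size (node s t)} p)))
    where p = word-arrangement (node s t) o

  cross-altUp : altUp (wordᴹ (top s t) o) ≡ true
  cross-altUp = altUp-node L′ R′ (trans (altUp-map L L-mono) (word-altUp s m)) (trans (altUp-map R R-mono) (word-altUp t o))
    (subst Nonempty (sym L′-snoc) (snoc-nonempty init l)) (nonempty-map σ R (word-nonempty t o)) L′<N R′<N

  L′-c132 : c132 L′ ≡ 0
  L′-c132 = trans (c132-map L L-mono) (word-c132 s m)

  R′-c132 : c132 R′ ≡ 0
  R′-c132 = trans (c132-map R R-mono) (word-c132 t o)

  cross-c132 : c132 (wordᴹ (top s t) o) ≡ 1
  cross-c132 = trans (cong c132 shape) (trans (c132-cross init l-init<N R′<N init≫ above-l r<N)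
    (cong₂ (λ i j → i + suc j) (trans (cong c132 (sym L′-snoc)) L′-c132) R′-c132))

  cross-ci : ∀ k → ci (suc k) (wordᴹ (top s t) o) ≡ incsᴹ (suc k) (top s t)
  cross-ci k = trans (cong (ci (suc k)) shape) (trans (ci-cross k init l-init<N R′<N init≫ above-l r<N)
    (cong₂ _+_ (cong₂ _+_ (left (suc k)) (left k)) (cong (_+ crossing k) (trans (ci-map (suc k) R R-mono) (word-ci (suc k) t o)))))
    where
    left : ∀ k → ci k (init ++ [ l ]) ≡ incs k s
    left k = trans (cong (ci k) (sym L′-snoc)) (trans (ci-map k L L-mono) (word-ci k s m))

wordᴹ-arrangement : ∀ x o → wordᴹ x o ↭ interval o (sizeᴹ x)
wordᴹ-arrangement (inˡ x t) o = arrangement-node (wordᴹ-arrangement x (o + size t)) (word-arrangement t o)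
wordᴹ-arrangement (inʳ t x) o = arrangement-node (word-arrangement t (o + sizeᴹ x)) (wordᴹ-arrangement x o)
wordᴹ-arrangement (top s t) o = Cross.cross-arrangement s t o

module WordSplitˡ (x : Marked) (t : Tree) (o : ℕ) =
  Split {o} {sizeᴹ x} {size t} (wordᴹ-arrangement x (o + size t)) (word-arrangement t o)

module WordSplitʳ (t : Tree) (x : Marked) (o : ℕ) =
  Split {o} {size t} {sizeᴹ x} (word-arrangement t (o + sizeᴹ x)) (wordᴹ-arrangement x o)

wordᴹ-nonempty : ∀ x o → Nonempty (wordᴹ x o)
wordᴹ-nonempty x o e with x | arrangement-length (wordᴹ-arrangement x o)
... | inˡ _ _ | len with () ← trans (sym (cong length e)) len
... | inʳ _ _ | len with () ← trans (sym (cong length e)) len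
... | top _ _ | len with () ← trans (sym (cong length e)) len

wordᴹ-altUp : ∀ x o → altUp (wordᴹ x o) ≡ true
wordᴹ-altUp (inˡ x t) o = altUp-node (wordᴹ x (o + size t)) (word t o) (wordᴹ-altUp x (o + size t)) (word-altUp t o)
  (wordᴹ-nonempty x (o + size t)) (word-nonempty t o) L<N R<N
  where open WordSplitˡ x t o
wordᴹ-altUp (inʳ t x) o = altUp-node (word t (o + sizeᴹ x)) (wordᴹ x o) (word-altUp t (o + sizeᴹ x)) (wordᴹ-altUp x o)
  (word-nonempty t (o + sizeᴹ x)) (wordᴹ-nonempty x o) L<N R<N
  where open WordSplitʳ t x o
wordᴹ-altUp (top s t) o = Cross.cross-altUp s t o

wordᴹ-c132 : ∀ x o → c132 (wordᴹ x o) ≡ 1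
wordᴹ-c132 (inˡ x t) o = trans (c132-node (wordᴹ x (o + size t)) L<N R<N L≫R)
  (cong₂ _+_ (wordᴹ-c132 x (o + size t)) (word-c132 t o))
  where open WordSplitˡ x t o
wordᴹ-c132 (inʳ t x) o = trans (c132-node (word t (o + sizeᴹ x)) L<N R<N L≫R)
  (cong₂ _+_ (word-c132 t (o + sizeᴹ x)) (wordᴹ-c132 x o))
  where open WordSplitʳ t x o
wordᴹ-c132 (top s t) o = Cross.cross-c132 s t o

wordᴹ-ci : ∀ k x o → ci k (wordᴹ x o) ≡ incsᴹ k x
wordᴹ-ci zero    x         o = refl
wordᴹ-ci (suc k) (inˡ x t) o = trans (ci-node k (wordᴹ x (o + size t)) L<N R<N L≫R)
  (cong₂ _+_ (cong₂ _+_ (wordᴹ-ci (suc k) x (o + size t)) (wordᴹ-ci k x (o + size t))) (word-ci (suc k) t o))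
  where open WordSplitˡ x t o
wordᴹ-ci (suc k) (inʳ t x) o = trans (ci-node k (word t (o + sizeᴹ x)) L<N R<N L≫R)
  (cong₂ _+_ (cong₂ _+_ (word-ci (suc k) t (o + sizeᴹ x)) (word-ci k t (o + sizeᴹ x))) (wordᴹ-ci (suc k) x o))
  where open WordSplitʳ t x o
wordᴹ-ci (suc k) (top s t) o = Cross.cross-ci s t o k

-- The words determine the trees

-- The letters before N are smaller than N, so its first appearance fixes the cut.
split-injective : ∀ {N R R′} L L′ → All (_< N) L → All (_< N) L′ → L ++ N ∷ R ≡ L′ ++ N ∷ R′ → L ≡ L′ × R ≡ R′
split-injective []      []       _         _          e = refl , Listₚ.∷-injectiveʳ e
split-injective []      (y ∷ L′) _         (y<N ∷ _)  e = ⊥-elim (ℕₚ.<⇒≢ y<N (sym (Listₚ.∷-injectiveˡ e)))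
split-injective (x ∷ L) []       (x<N ∷ _) _          e = ⊥-elim (ℕₚ.<⇒≢ x<N (Listₚ.∷-injectiveˡ e))
split-injective (x ∷ L) (y ∷ L′) (_ ∷ h)   (_ ∷ h′)   e with split-injective L L′ h h′ (Listₚ.∷-injectiveʳ e)
... | refl , e′ = cong (_∷ L) (Listₚ.∷-injectiveˡ e) , e′

split-injective′ : ∀ {N N′ R R′} L L′ → N ≡ N′ → All (_< N) L → All (_< N′) L′ → L ++ N ∷ R ≡ L′ ++ N′ ∷ R′ → L ≡ L′ × R ≡ R′
split-injective′ L L′ refl = split-injective L L′

word-length : ∀ t o → length (word t o) ≡ size t
word-length t o = arrangement-length (word-arrangement t o)

wordᴹ-length : ∀ x o → length (wordᴹ x o) ≡ sizeᴹ x
wordᴹ-length x o = arrangement-length (wordᴹ-arrangement x o)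

same-size : ∀ s t {o o′} → word s o ≡ word t o′ → size s ≡ size t
same-size s t {o} {o′} e = trans (sym (word-length s o)) (trans (cong length e) (word-length t o′))

same-sizeᴹ : ∀ x y {o o′} → wordᴹ x o ≡ wordᴹ y o′ → sizeᴹ x ≡ sizeᴹ y
same-sizeᴹ x y {o} {o′} e = trans (sym (wordᴹ-length x o)) (trans (cong length e) (wordᴹ-length y o′))

leaf≢node : ∀ s t → 1 ≢ size (node s t)
leaf≢node s t e with size s | size-pos s
leaf≢node s t () | suc _ | _

word-injective : ∀ t t′ o → word t o ≡ word t′ o → t ≡ t′
word-injective leaf       leaf         o e = refl
word-injective leaf       (node s t)   o e = ⊥-elim (leaf≢node s t (same-size leaf (node s t) {o} {o} e))
word-injective (node s t) leaf         o e = ⊥-elim (leaf≢node s t (same-size leaf (node s t) {o} {o} (sym e)))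
word-injective (node s t) (node s′ t′) o e
  with split-injective′ (word s (o + size t)) (word s′ (o + size t′)) (cong (λ n → o + n) (same-size (node s t) (node s′ t′) {o} {o} e))
         (WordSplit.L<N s t o) (WordSplit.L<N s′ t′ o) e
-- The right subtree comes first, because its size is part of the offset of the left word.
... | eL , eR with word-injective t t′ o eR
...   | refl = cong (λ u → node u t) (word-injective s s′ (o + size t) eL)

left right : Marked → ℕ → List ℕ
left (inˡ x t) o = wordᴹ x (o + size t)
left (inʳ t x) o = word t (o + sizeᴹ x)
left (top s t) o = Cross.L′ s t o
right (inˡ x t) o = word t o
right (inʳ t x) o = wordᴹ x o
right (top s t) o = Cross.R′ s t o

wordᴹ-split : ∀ x o → wordᴹ x o ≡ left x o ++ o + sizeᴹ x ∷ right x o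
wordᴹ-split (inˡ x t) o = refl
wordᴹ-split (inʳ t x) o = refl
wordᴹ-split (top s t) o = refl

left-bound : ∀ x o → All (_< o + sizeᴹ x) (left x o)
left-bound (inˡ x t) o = WordSplitˡ.L<N x t o
left-bound (inʳ t x) o = WordSplitʳ.L<N t x o
left-bound (top s t) o = Cross.L′<N s t o

wordᴹ-parts : ∀ x y o → wordᴹ x o ≡ wordᴹ y o → left x o ≡ left y o × right x o ≡ right y o
wordᴹ-parts x y o e = split-injective′ (left x o) (left y o) (cong (λ n → o + n) (same-sizeᴹ x y {o} {o} e))
  (left-bound x o) (left-bound y o) (trans (sym (wordᴹ-split x o)) (trans e (wordᴹ-split y o)))

c132-differ : ∀ {xs ys} → xs ≡ ys → c132 xs ≡ 1 → c132 ys ≡ 0 → ⊥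
c132-differ refl h h′ with () ← trans (sym h) h′

-- The right parts have the same length, so both trees exchange the same two values and the exchange
-- can be undone on either side.
top-injective : ∀ s t s′ t′ o → left (top s t) o ≡ left (top s′ t′) o → right (top s t) o ≡ right (top s′ t′) o →
  top s t ≡ top s′ t′
top-injective s t s′ t′ o eL eR with word-injective t t′ o (Listₚ.map-injective (swap-injective m (m + 1)) eR′)
  where
  m = o + size t
  sizes : size t′ ≡ size t
  sizes = trans (trans (sym (word-length t′ o)) (sym (Listₚ.length-map (Cross.σ s′ t′ o) (word t′ o))))
    (trans (cong length (sym eR)) (trans (Listₚ.length-map (Cross.σ s t o) (word t o)) (word-length t o)))
  eR′ : map (swap m (m + 1)) (word t o) ≡ map (swap m (m + 1)) (word t′ o)
  eR′ = trans eR (cong (λ n → map (swap (o + n) (o + n + 1)) (word t′ o)) sizes)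
... | refl = cong (λ u → top u t) (word-injective s s′ (o + size t)
  (Listₚ.map-injective (swap-injective (o + size t) (o + size t + 1)) eL))

-- The constructors are told apart by the numbers of 132 in the left and right parts: 1 and 0 for
-- `inˡ`, 0 and 1 for `inʳ`, 0 and 0 for `top`.
wordᴹ-injective : ∀ x y o → wordᴹ x o ≡ wordᴹ y o → x ≡ y
wordᴹ-injective x y o e with wordᴹ-parts x y o e
wordᴹ-injective (inˡ x t) (inˡ y u) o e | eL , eR with word-injective t u o eR
... | refl = cong (λ z → inˡ z t) (wordᴹ-injective x y (o + size t) eL)
wordᴹ-injective (inʳ t x) (inʳ u y) o e | eL , eR with wordᴹ-injective x y o eR
... | refl = cong (λ z → inʳ z x) (word-injective t u (o + sizeᴹ x) eL)
wordᴹ-injective (top s t) (top u v) o e | eL , eR = top-injective s t u v o eL eR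
wordᴹ-injective (inˡ x t) (inʳ u y) o e | eL , eR = ⊥-elim (c132-differ eL (wordᴹ-c132 x (o + size t)) (word-c132 u (o + sizeᴹ y)))
wordᴹ-injective (inʳ u y) (inˡ x t) o e | eL , eR = ⊥-elim (c132-differ (sym eL) (wordᴹ-c132 x (o + size t)) (word-c132 u (o + sizeᴹ y)))
wordᴹ-injective (inˡ x t) (top u v) o e | eL , eR = ⊥-elim (c132-differ eL (wordᴹ-c132 x (o + size t)) (Cross.L′-c132 u v o))
wordᴹ-injective (top u v) (inˡ x t) o e | eL , eR = ⊥-elim (c132-differ (sym eL) (wordᴹ-c132 x (o + size t)) (Cross.L′-c132 u v o))
wordᴹ-injective (inʳ t x) (top u v) o e | eL , eR = ⊥-elim (c132-differ eR (wordᴹ-c132 x o) (Cross.R′-c132 u v o))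
wordᴹ-injective (top u v) (inʳ t x) o e | eL , eR = ⊥-elim (c132-differ (sym eR) (wordᴹ-c132 x o) (Cross.R′-c132 u v o))

-- Every word with at most one 132 is read off a tree

unique-disjoint : ∀ L {R : List ℕ} → Unique (L ++ R) → All (λ l → All (l ≢_) R) L
unique-disjoint []      _       = []
unique-disjoint (x ∷ L) (h ∷ u) = Allₚ.++⁻ʳ L h ∷ unique-disjoint L u

record Decomposition (o n : ℕ) (π : List ℕ) : Set where
  field
    L R      : List ℕ
    shape    : π ≡ L ++ o + suc n ∷ R
    rest     : L ++ R ↭ interval o n
    L<N      : All (_< o + suc n) L
    R<N      : All (_< o + suc n) R
    disjoint : All (λ l → All (l ≢_) R) L
    total    : length L + length R ≡ n

decompose : ∀ {o n π} → π ↭ interval o (suc n) → Decomposition o n π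
decompose {o} {n} p with ∈ₚ.∈-∃++ (arrangement-∈ {o} {suc n} p {o + suc n} (ℕₚ.m<m+n o (s≤s z≤n) , ℕₚ.≤-refl))
... | L , R , refl = record
  { L = L ; R = R ; shape = refl ; rest = rest
  ; L<N = Allₚ.++⁻ˡ L bound ; R<N = Allₚ.++⁻ʳ L bound
  ; disjoint = unique-disjoint L (arrangement-unique {o} {n} rest)
  ; total = trans (sym (Listₚ.length-++ L)) (arrangement-length {o} {n} rest)
  }
  where
  rest : L ++ R ↭ interval o n
  rest = ↭ₚ.drop-mid L [] p
  bound : All (_< o + suc n) (L ++ R)
  bound = All.map (λ (_ , v≤) → ℕₚ.≤-<-trans v≤ (ℕₚ.+-monoʳ-< o (ℕₚ.n<1+n n))) (arrangement-bounds {o} {n} rest)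

node-shape : ∀ {n} (L′ R′ : List ℕ) o {a b} → length L′ ≡ a → length R′ ≡ b → length L′ + length R′ ≡ n →
  L′ ++ o + suc (a + b) ∷ R′ ≡ L′ ++ o + suc n ∷ R′
node-shape L′ R′ o refl refl refl = refl

-- Avoiding 132 gives `L ≫ R`, so both parts are arrangements of intervals that avoid 132. The bound
-- `f` makes the recursion on them structural.
word-complete : ∀ f {n o π} → n ≤ f → π ↭ interval o n → altUp π ≡ true → Nonempty π → c132 π ≡ 0 → ∃ λ t → word t o ≡ π
word-complete f       {zero}  _         p _   ne _ = ⊥-elim (ne (↭ₚ.↭-empty-inv p))
word-complete (suc f) {suc n} {o} {π} (s≤s n≤f) p alt ne c with decompose {o} {n} p
... | record { L = L ; R = R ; shape = refl ; rest = rest ; L<N = L<N ; R<N = R<N ; disjoint = disjoint ; total = total }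
  with altUp-split L R alt L<N R<N
...   | inj₁ (refl , refl) = leaf , cong (λ i → [ o + suc i ]) total
...   | inj₂ ((altL , neL) , (altR , neR)) = node (proj₁ left-tree) (proj₁ right-tree) , assembled
  where
  L≫R : L ≫ R
  L≫R = c132-zero⇒≫ L L<N R<N disjoint c
  parts = arrangement-split o n L≫R rest
  zeros : c132 L + c132 R ≡ 0
  zeros = trans (sym (c132-node L L<N R<N L≫R)) c
  left-tree : ∃ λ t → word t (o + length R) ≡ L
  left-tree = word-complete f (ℕₚ.≤-trans (ℕₚ.≤-trans (ℕₚ.m≤m+n _ _) (ℕₚ.≤-reflexive total)) n≤f)
    (proj₁ parts) altL neL (ℕₚ.m+n≡0⇒m≡0 _ zeros)
  right-tree : ∃ λ t → word t o ≡ R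
  right-tree = word-complete f (ℕₚ.≤-trans (ℕₚ.≤-trans (ℕₚ.m≤n+m _ _) (ℕₚ.≤-reflexive total)) n≤f)
    (proj₂ parts) altR neR (ℕₚ.m+n≡0⇒n≡0 (c132 L) zeros)
  assembled : word (node (proj₁ left-tree) (proj₁ right-tree)) o ≡ L ++ o + suc n ∷ R
  assembled with left-tree | right-tree
  ... | s , eL | t , refl rewrite trans (cong (λ i → word s (o + i)) (sym (word-length t o))) eL =
    node-shape L (word t o) o (trans (cong length (sym eL)) (word-length s _)) (word-length t o) total

sum-one : ∀ a b → a + b ≡ 1 → (a ≡ 1 × b ≡ 0) ⊎ (a ≡ 0 × b ≡ 1)
sum-one zero          b e = inj₂ (refl , e)
sum-one (suc zero)    b e = inj₁ (refl , ℕₚ.suc-injective e)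

-- If `L ≫ R`, the occurrence lies in one part, and the recursion applies to that part. If not, l
-- and r are exchanged back and both parts fall to `word-complete`.
wordᴹ-complete : ∀ f {n o π} → n ≤ f → π ↭ interval o n → altUp π ≡ true → c132 π ≡ 1 → ∃ λ x → wordᴹ x o ≡ π
wordᴹ-complete f       {zero}  _         p _   c rewrite ↭ₚ.↭-empty-inv p with () ← c
wordᴹ-complete (suc f) {suc n} {o} {π} (s≤s n≤f) p alt c with decompose {o} {n} p
... | record { L = L ; R = R ; shape = refl ; rest = rest ; L<N = L<N ; R<N = R<N ; disjoint = disjoint ; total = total }
  with altUp-split L R alt L<N R<N
...   | inj₁ (refl , refl) with () ← c
...   | inj₂ ((altL , neL) , (altR , neR)) with ≫-or-crossing L L<N R<N disjoint (ℕₚ.≤-reflexive c)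
...     | inj₁ L≫R with sum-one (c132 L) (c132 R) (trans (sym (c132-node L L<N R<N L≫R)) c) | arrangement-split o n L≫R rest
...       | inj₁ (cL , cR) | pL , pR
  with wordᴹ-complete f (ℕₚ.≤-trans (ℕₚ.≤-trans (ℕₚ.m≤m+n _ _) (ℕₚ.≤-reflexive total)) n≤f) pL altL cL
     | word-complete f (ℕₚ.≤-trans (ℕₚ.≤-trans (ℕₚ.m≤n+m _ _) (ℕₚ.≤-reflexive total)) n≤f) pR altR neR cR
...         | x , eL | t , refl = inˡ x t , assembled
  where
  assembled : wordᴹ (inˡ x t) o ≡ L ++ o + suc n ∷ word t o
  assembled rewrite trans (cong (λ i → wordᴹ x (o + i)) (sym (word-length t o))) eL =
    node-shape L (word t o) o (trans (cong length (sym eL)) (wordᴹ-length x _)) (word-length t o) total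
wordᴹ-complete (suc f) {suc n} {o} {π} (s≤s n≤f) p alt c
    | record { L = L ; R = R ; shape = refl ; rest = rest ; L<N = L<N ; R<N = R<N ; disjoint = disjoint ; total = total }
      | inj₂ ((altL , neL) , (altR , neR)) | inj₁ L≫R | inj₂ (cL , cR) | pL , pR
  with word-complete f (ℕₚ.≤-trans (ℕₚ.≤-trans (ℕₚ.m≤m+n _ _) (ℕₚ.≤-reflexive total)) n≤f) pL altL neL cL
     | wordᴹ-complete f (ℕₚ.≤-trans (ℕₚ.≤-trans (ℕₚ.m≤n+m _ _) (ℕₚ.≤-reflexive total)) n≤f) pR altR cR
...         | t , eL | x , refl = inʳ t x , assembled
  where
  assembled : wordᴹ (inʳ t x) o ≡ L ++ o + suc n ∷ wordᴹ x o
  assembled rewrite trans (cong (λ i → word t (o + i)) (sym (wordᴹ-length x o))) eL =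
    node-shape L (wordᴹ x o) o (trans (cong length (sym eL)) (word-length t _)) (wordᴹ-length x o) total
wordᴹ-complete (suc f) {suc n} {o} {π} (s≤s n≤f) p alt c
    | record { L = .(init ++ [ l ]) ; R = R ; shape = refl ; rest = rest ; L<N = L<N ; R<N = R<N ; disjoint = disjoint ; total = total }
      | inj₂ ((altL , neL) , (altR , neR)) | inj₂ (crossed {init} {l} {r} refl init≫R above-l) =
  top (proj₁ left-tree) (proj₁ right-tree) , assembled
  where
  N : ℕ
  N = o + suc n
  L : List ℕ
  L = init ++ [ l ]
  r∈R×l<r : r ∈ R × l < r
  r∈R×l<r = ∈-above⁻ l R (subst (r ∈_) (sym above-l) (here refl))
  l<r : l < r
  l<r = proj₂ r∈R×l<r
  init-values : All (r <_) init
  init-values = All.map (λ R<v → All.lookup R<v (proj₁ r∈R×l<r)) init≫R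
  L-values : All (λ v → v ≡ l ⊎ r < v) L
  L-values = Allₚ.++⁺ (All.map inj₂ init-values) (inj₁ refl ∷ [])
  R-values : All (λ v → v ≡ r ⊎ v < l) R
  R-values = All.tabulate values
    where
    l≢ : All (l ≢_) R
    l≢ = All.head (Allₚ.++⁻ʳ init disjoint)
    values : ∀ {v} → v ∈ R → v ≡ r ⊎ v < l
    values {v} v∈ with ℕₚ.<-cmp l v
    ... | tri≈ _ l≡v _ = ⊥-elim (All.lookup l≢ v∈ l≡v)
    ... | tri> _ _ v<l = inj₂ v<l
    ... | tri< l<v _ _ with subst (v ∈_) above-l (∈-above⁺ l v∈ l<v)
    ...   | here v≡r = inj₁ v≡r
  σ : ℕ → ℕ
  σ = swap l r
  L* R* : List ℕ
  L* = map σ L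
  R* = map σ R
  L-mono : MonoOn σ L
  L-mono = swap-mono-upper L l<r (inj₁ refl) L-values
  R-mono : MonoOn σ R
  R-mono = swap-mono-lower R l<r (inj₂ refl) R-values
  L*-values : All (r ≤_) L*
  L*-values = Allₚ.map⁺ (All.map image L-values)
    where
    image : ∀ {v} → v ≡ l ⊎ r < v → r ≤ σ v
    image (inj₁ refl) = ℕₚ.≤-reflexive (sym (swap-l l r))
    image (inj₂ r<v)  = subst (r ≤_) (sym (swap-other (ℕₚ.<⇒≢ (ℕₚ.<-trans l<r r<v) ∘ sym) (ℕₚ.<⇒≢ r<v ∘ sym))) (ℕₚ.<⇒≤ r<v)
  R*-values : All (_≤ l) R*
  R*-values = Allₚ.map⁺ (All.map image R-values)
    where
    image : ∀ {v} → v ≡ r ⊎ v < l → σ v ≤ l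
    image (inj₁ refl) = ℕₚ.≤-reflexive (swap-r l r)
    image (inj₂ v<l)  = subst (_≤ l) (sym (swap-other (ℕₚ.<⇒≢ v<l) (ℕₚ.<⇒≢ (ℕₚ.<-trans v<l l<r)))) (ℕₚ.<⇒≤ v<l)
  L*≫R* : L* ≫ R*
  L*≫R* = All.map (λ r≤v → All.map (λ w≤l → ℕₚ.≤-<-trans w≤l (ℕₚ.<-≤-trans l<r r≤v)) R*-values) L*-values
  l∈L : l ∈ L
  l∈L = ∈ₚ.∈-++⁺ʳ init (here refl)
  rest* : L* ++ R* ↭ interval o n
  rest* = subst (_↭ interval o n) (Listₚ.map-++ σ L R)
    (arrangement (Uniqueₚ.map⁺ (swap-injective l r) (arrangement-unique {o} {n} rest))
      (Allₚ.map⁺ (All.map image bounds))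
      (trans (Listₚ.length-map σ (L ++ R)) (arrangement-length {o} {n} rest)))
    where
    bounds : All (InInterval o n) (L ++ R)
    bounds = arrangement-bounds {o} {n} rest
    image : ∀ {v} → InInterval o n v → InInterval o n (σ v)
    image {v} h with swapCase l r v
    ... | isL refl  rewrite swap-l l r = All.lookup bounds (∈ₚ.∈-++⁺ʳ L (proj₁ r∈R×l<r))
    ... | isR refl  rewrite swap-r l r = All.lookup bounds (∈ₚ.∈-++⁺ˡ l∈L)
    ... | other e f rewrite swap-other e f = h
  parts = arrangement-split o n L*≫R* rest*
  -- The occurrence l N r is the one allowed, so neither L nor R contains another.
  zeros : c132 L + suc (c132 R) ≡ 1
  zeros = trans (sym (trans (cong c132 (Listₚ.++-assoc init [ l ] (N ∷ R)))
    (c132-cross init (All.head (Allₚ.++⁻ʳ init L<N) ∷ Allₚ.++⁻ˡ init L<N) R<N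
      (zip-All (λ r<v R<v → ℕₚ.<-trans l<r r<v ∷ R<v) init-values init≫R) above-l (All.lookup R<N (proj₁ r∈R×l<r))))) c
  zeros′ : c132 L + c132 R ≡ 0
  zeros′ = ℕₚ.suc-injective (trans (sym (ℕₚ.+-suc (c132 L) (c132 R))) zeros)
  total* : length L* + length R* ≡ n
  total* = trans (cong₂ _+_ (Listₚ.length-map σ L) (Listₚ.length-map σ R)) total
  left-tree : ∃ λ t → word t (o + length R*) ≡ L*
  left-tree = word-complete f (ℕₚ.≤-trans (ℕₚ.≤-trans (ℕₚ.m≤m+n _ _) (ℕₚ.≤-reflexive total*)) n≤f) (proj₁ parts)
    (trans (altUp-map L L-mono) altL) (nonempty-map σ L neL) (trans (c132-map L L-mono) (ℕₚ.m+n≡0⇒m≡0 _ zeros′))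
  right-tree : ∃ λ t → word t o ≡ R*
  right-tree = word-complete f (ℕₚ.≤-trans (ℕₚ.≤-trans (ℕₚ.m≤n+m _ _) (ℕₚ.≤-reflexive total*)) n≤f) (proj₂ parts)
    (trans (altUp-map R R-mono) altR) (nonempty-map σ R neR) (trans (c132-map R R-mono) (ℕₚ.m+n≡0⇒n≡0 (c132 L) zeros′))
  m : ℕ
  m = o + length R*
  r∈L* : r ∈ L*
  r∈L* = subst (_∈ L*) (swap-l l r) (∈ₚ.∈-map⁺ σ l∈L)
  l∈R* : l ∈ R*
  l∈R* = subst (_∈ R*) (swap-r l r) (∈ₚ.∈-map⁺ σ (proj₁ r∈R×l<r))
  -- Here the consecutive values appear: `R*` fills the values up to m and has maximum l, while `L*`
  -- starts at m + 1 and has minimum r.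
  l≡m : l ≡ m
  l≡m = ℕₚ.≤-antisym (proj₂ (All.lookup (arrangement-bounds {o} {length R*} (proj₂ parts)) l∈R*))
    (All.lookup R*-values (arrangement-∈ {o} {length R*} (proj₂ parts) (ℕₚ.m<m+n o (length-pos l∈R*) , ℕₚ.≤-refl)))
  r≡m+1 : r ≡ m + 1
  r≡m+1 = ℕₚ.≤-antisym
    (All.lookup L*-values (arrangement-∈ {m} {length L*} (proj₁ parts) (ℕₚ.m<m+n m (s≤s z≤n) , ℕₚ.+-monoʳ-≤ m (length-pos r∈L*))))
    (ℕₚ.≤-trans (ℕₚ.≤-reflexive (ℕₚ.+-comm m 1)) (proj₁ (All.lookup (arrangement-bounds {m} {length L*} (proj₁ parts)) r∈L*)))
  assembled : wordᴹ (top (proj₁ left-tree) (proj₁ right-tree)) o ≡ L ++ N ∷ R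
  assembled with left-tree | right-tree
  ... | s , eL | t , eR = begin
    map (swap (o + size t) (o + size t + 1)) (word s (o + size t)) ++ o + suc (size s + size t) ∷ map (swap (o + size t) (o + size t + 1)) (word t o)
      ≡⟨ cong (λ i → map (swap (o + i) (o + i + 1)) (word s (o + i)) ++ o + suc (size s + i) ∷ map (swap (o + i) (o + i + 1)) (word t o)) sizes ⟩
    map (swap m (m + 1)) (word s m) ++ o + suc (size s + length R*) ∷ map (swap m (m + 1)) (word t o)
      ≡⟨ cong₂ (λ xs ys → map (swap m (m + 1)) xs ++ o + suc (size s + length R*) ∷ map (swap m (m + 1)) ys) eL eR ⟩
    map (swap m (m + 1)) L* ++ o + suc (size s + length R*) ∷ map (swap m (m + 1)) R*
      ≡⟨ cong₂ (λ i j → map (swap i j) L* ++ o + suc (size s + length R*) ∷ map (swap i j) R*) l≡m r≡m+1 ⟨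
    map σ L* ++ o + suc (size s + length R*) ∷ map σ R*
      ≡⟨ cong₂ (λ xs ys → xs ++ o + suc (size s + length R*) ∷ ys) (map-swap-involutive l r L) (map-swap-involutive l r R) ⟩
    L ++ o + suc (size s + length R*) ∷ R
      ≡⟨ cong (λ i → L ++ o + suc i ∷ R) (trans (cong (_+ length R*) (trans (sym (word-length s m)) (cong length eL))) total*) ⟩
    L ++ N ∷ R ∎
    where
    open ≡-Reasoning
    sizes : size t ≡ length R*
    sizes = trans (sym (word-length t o)) (cong length eR)

-- Enumeration of the trees by size

-- The pairs of total size n, listed along the recursion of `mulPS-tailˡ`, so that `wsum-conv` turns
-- them into a product of series by the same induction.
conv : {A B : Set} → (ℕ → List A) → (ℕ → List B) → ℕ → List (A × B)
conv F G zero    = cartesianProduct (F 0) (G 0)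
conv F G (suc n) = cartesianProduct (F 0) (G (suc n)) ++ conv (F ∘ suc) G n

conv-cong : ∀ {A B : Set} {F F′ : ℕ → List A} {G G′ : ℕ → List B} n →
  (∀ i → i ≤ n → F i ≡ F′ i) → (∀ i → i ≤ n → G i ≡ G′ i) → conv F G n ≡ conv F′ G′ n
conv-cong zero    f g = cong₂ cartesianProduct (f 0 z≤n) (g 0 z≤n)
conv-cong (suc n) f g = cong₂ _++_ (cong₂ cartesianProduct (f 0 z≤n) (g (suc n) ℕₚ.≤-refl))
  (conv-cong n (λ i i≤n → f (suc i) (s≤s i≤n)) (λ i i≤n → g i (ℕₚ.m≤n⇒m≤1+n i≤n)))

∈-conv⁺ : ∀ {A B : Set} (F : ℕ → List A) (G : ℕ → List B) i j {a b} → a ∈ F i → b ∈ G j → (a , b) ∈ conv F G (i + j)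
∈-conv⁺ F G zero    zero    a∈ b∈ = ∈ₚ.∈-cartesianProduct⁺ a∈ b∈
∈-conv⁺ F G zero    (suc j) a∈ b∈ = ∈ₚ.∈-++⁺ˡ (∈ₚ.∈-cartesianProduct⁺ a∈ b∈)
∈-conv⁺ F G (suc i) j       a∈ b∈ = ∈ₚ.∈-++⁺ʳ (cartesianProduct (F 0) (G (suc (i + j)))) (∈-conv⁺ (F ∘ suc) G i j a∈ b∈)

∈-conv⁻ : ∀ {A B : Set} (F : ℕ → List A) (G : ℕ → List B) n {ab} → ab ∈ conv F G n →
  ∃ λ i → ∃ λ j → i + j ≡ n × proj₁ ab ∈ F i × proj₂ ab ∈ G j
∈-conv⁻ F G zero    ab∈ = 0 , 0 , refl , ∈ₚ.∈-cartesianProduct⁻ (F 0) (G 0) ab∈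
∈-conv⁻ F G (suc n) ab∈ with ∈ₚ.∈-++⁻ (cartesianProduct (F 0) (G (suc n))) ab∈
... | inj₁ h = 0 , suc n , refl , ∈ₚ.∈-cartesianProduct⁻ (F 0) (G (suc n)) h
... | inj₂ h with ∈-conv⁻ (F ∘ suc) G n h
...   | i , j , e , a∈ , b∈ = suc i , j , cong suc e , a∈ , b∈

-- The last hypothesis says that an object has only one size; it keeps the products that are
-- appended disjoint.
conv-unique : ∀ {A B : Set} (F : ℕ → List A) (G : ℕ → List B) n → (∀ i → Unique (F i)) → (∀ i → Unique (G i)) →
  (∀ {i j a} → a ∈ F i → a ∈ F j → i ≡ j) → Unique (conv F G n)
conv-unique F G zero    uF uG d = Uniqueₚ.cartesianProduct⁺ (uF 0) (uG 0)
conv-unique F G (suc n) uF uG d = Uniqueₚ.++⁺ (Uniqueₚ.cartesianProduct⁺ (uF 0) (uG (suc n)))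
  (conv-unique (F ∘ suc) G n (uF ∘ suc) uG (λ a∈ a∈′ → ℕₚ.suc-injective (d a∈ a∈′)))
  λ (h , h′) → clash (proj₁ (∈ₚ.∈-cartesianProduct⁻ (F 0) (G (suc n)) h)) (∈-conv⁻ (F ∘ suc) G n h′)
  where
  clash : ∀ {ab} → proj₁ ab ∈ F 0 → (∃ λ i → ∃ λ j → i + j ≡ n × proj₁ ab ∈ F (suc i) × proj₂ ab ∈ G j) → ⊥
  clash a∈ (_ , _ , _ , a∈′ , _) with () ← d a∈ a∈′

leaves : ℕ → List Tree
leaves zero    = [ leaf ]
leaves (suc _) = []

-- The first argument is fuel; it does not matter once it bounds the size.
treesF : ℕ → ℕ → List Tree
treesF zero    n       = []
treesF (suc f) zero    = []
treesF (suc f) (suc n) = leaves n ++ map (uncurry node) (conv (treesF f) (treesF f) n)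

markedF : ℕ → ℕ → List Marked
markedF zero    n       = []
markedF (suc f) zero    = []
markedF (suc f) (suc n) = map (uncurry inˡ) (conv (markedF f) (treesF f) n) ++
  (map (uncurry inʳ) (conv (treesF f) (markedF f) n) ++ map (uncurry top) (conv (treesF f) (treesF f) n))

trees : ℕ → List Tree
trees n = treesF n n

marked : ℕ → List Marked
marked n = markedF n n

treesF-fuel : ∀ f g n → n ≤ f → n ≤ g → treesF f n ≡ treesF g n
treesF-fuel zero    zero    n       _       _       = refl
treesF-fuel zero    (suc g) zero    _       _       = refl
treesF-fuel (suc f) zero    zero    _       _       = refl
treesF-fuel (suc f) (suc g) zero    _       _       = refl
treesF-fuel (suc f) (suc g) (suc n) (s≤s p) (s≤s q) = cong (λ c → leaves n ++ map (uncurry node) c) (conv-cong n same same)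
  where
  same : ∀ i → i ≤ n → treesF f i ≡ treesF g i
  same i i≤n = treesF-fuel f g i (ℕₚ.≤-trans i≤n p) (ℕₚ.≤-trans i≤n q)

markedF-fuel : ∀ f g n → n ≤ f → n ≤ g → markedF f n ≡ markedF g n
markedF-fuel zero    zero    n       _       _       = refl
markedF-fuel zero    (suc g) zero    _       _       = refl
markedF-fuel (suc f) zero    zero    _       _       = refl
markedF-fuel (suc f) (suc g) zero    _       _       = refl
markedF-fuel (suc f) (suc g) (suc n) (s≤s p) (s≤s q) = cong₂ _++_
  (cong (map (uncurry inˡ)) (conv-cong n sameᴹ same))
  (cong₂ _++_ (cong (map (uncurry inʳ)) (conv-cong n same sameᴹ)) (cong (map (uncurry top)) (conv-cong n same same)))
  where
  same : ∀ i → i ≤ n → treesF f i ≡ treesF g i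
  same i i≤n = treesF-fuel f g i (ℕₚ.≤-trans i≤n p) (ℕₚ.≤-trans i≤n q)
  sameᴹ : ∀ i → i ≤ n → markedF f i ≡ markedF g i
  sameᴹ i i≤n = markedF-fuel f g i (ℕₚ.≤-trans i≤n p) (ℕₚ.≤-trans i≤n q)

trees-suc : ∀ n → trees (suc n) ≡ leaves n ++ map (uncurry node) (conv trees trees n)
trees-suc n = cong (λ c → leaves n ++ map (uncurry node) c) (conv-cong n same same)
  where
  same : ∀ i → i ≤ n → treesF n i ≡ trees i
  same i i≤n = treesF-fuel n i i i≤n ℕₚ.≤-refl

marked-suc : ∀ n → marked (suc n) ≡ map (uncurry inˡ) (conv marked trees n) ++
  (map (uncurry inʳ) (conv trees marked n) ++ map (uncurry top) (conv trees trees n))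
marked-suc n = cong₂ _++_ (cong (map (uncurry inˡ)) (conv-cong n sameᴹ same))
  (cong₂ _++_ (cong (map (uncurry inʳ)) (conv-cong n same sameᴹ)) (cong (map (uncurry top)) (conv-cong n same same)))
  where
  same : ∀ i → i ≤ n → treesF n i ≡ trees i
  same i i≤n = treesF-fuel n i i i≤n ℕₚ.≤-refl
  sameᴹ : ∀ i → i ≤ n → markedF n i ≡ marked i
  sameᴹ i i≤n = markedF-fuel n i i i≤n ℕₚ.≤-refl

∈-map-conv⁺ : ∀ {A B C : Set} (c : A → B → C) (F : ℕ → List A) (G : ℕ → List B) i j {a b} → a ∈ F i → b ∈ G j →
  c a b ∈ map (uncurry c) (conv F G (i + j))
∈-map-conv⁺ c F G i j a∈ b∈ = ∈ₚ.∈-map⁺ (uncurry c) (∈-conv⁺ F G i j a∈ b∈)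

treesF-complete : ∀ f t → size t ≤ f → t ∈ treesF f (size t)
treesF-complete (suc f) leaf       _       = here refl
treesF-complete (suc f) (node s t) (s≤s p) = ∈ₚ.∈-++⁺ʳ (leaves (size s + size t))
  (∈-map-conv⁺ node (treesF f) (treesF f) (size s) (size t)
    (treesF-complete f s (ℕₚ.m+n≤o⇒m≤o _ p)) (treesF-complete f t (ℕₚ.m+n≤o⇒n≤o (size s) p)))

markedF-complete : ∀ f x → sizeᴹ x ≤ f → x ∈ markedF f (sizeᴹ x)
markedF-complete (suc f) (inˡ x t) (s≤s p) = ∈ₚ.∈-++⁺ˡ
  (∈-map-conv⁺ inˡ (markedF f) (treesF f) (sizeᴹ x) (size t)
    (markedF-complete f x (ℕₚ.m+n≤o⇒m≤o _ p)) (treesF-complete f t (ℕₚ.m+n≤o⇒n≤o (sizeᴹ x) p)))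
markedF-complete (suc f) (inʳ t x) (s≤s p) = ∈ₚ.∈-++⁺ʳ (map (uncurry inˡ) (conv (markedF f) (treesF f) (size t + sizeᴹ x))) (∈ₚ.∈-++⁺ˡ
  (∈-map-conv⁺ inʳ (treesF f) (markedF f) (size t) (sizeᴹ x)
    (treesF-complete f t (ℕₚ.m+n≤o⇒m≤o _ p)) (markedF-complete f x (ℕₚ.m+n≤o⇒n≤o (size t) p))))
markedF-complete (suc f) (top s t) (s≤s p) = ∈ₚ.∈-++⁺ʳ (map (uncurry inˡ) (conv (markedF f) (treesF f) (size s + size t)))
  (∈ₚ.∈-++⁺ʳ (map (uncurry inʳ) (conv (treesF f) (markedF f) (size s + size t)))
  (∈-map-conv⁺ top (treesF f) (treesF f) (size s) (size t)
    (treesF-complete f s (ℕₚ.m+n≤o⇒m≤o _ p)) (treesF-complete f t (ℕₚ.m+n≤o⇒n≤o (size s) p))))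

∈-map-conv⁻ : ∀ {A B C : Set} (c : A → B → C) (F : ℕ → List A) (G : ℕ → List B) n {x} → x ∈ map (uncurry c) (conv F G n) →
  ∃ λ a → ∃ λ b → x ≡ c a b × ∃ λ i → ∃ λ j → i + j ≡ n × a ∈ F i × b ∈ G j
∈-map-conv⁻ c F G n x∈ with ∈ₚ.∈-map⁻ (uncurry c) x∈
... | (a , b) , ab∈ , e = a , b , e , ∈-conv⁻ F G n ab∈

treesF-size : ∀ f n {t} → t ∈ treesF f n → size t ≡ n
treesF-size (suc f) (suc n) t∈ with ∈ₚ.∈-++⁻ (leaves n) t∈
treesF-size (suc f) (suc zero) t∈ | inj₁ (here refl) = refl
... | inj₂ h with ∈-map-conv⁻ node (treesF f) (treesF f) n h
...   | s , u , refl , i , j , refl , s∈ , u∈ = cong suc (cong₂ _+_ (treesF-size f i s∈) (treesF-size f j u∈))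

markedF-size : ∀ f n {x} → x ∈ markedF f n → sizeᴹ x ≡ n
markedF-size (suc f) (suc n) x∈ with ∈ₚ.∈-++⁻ (map (uncurry inˡ) (conv (markedF f) (treesF f) n)) x∈
... | inj₁ h with ∈-map-conv⁻ inˡ (markedF f) (treesF f) n h
...   | y , t , refl , i , j , refl , y∈ , t∈ = cong suc (cong₂ _+_ (markedF-size f i y∈) (treesF-size f j t∈))
markedF-size (suc f) (suc n) x∈ | inj₂ h with ∈ₚ.∈-++⁻ (map (uncurry inʳ) (conv (treesF f) (markedF f) n)) h
... | inj₁ h′ with ∈-map-conv⁻ inʳ (treesF f) (markedF f) n h′
...   | t , y , refl , i , j , refl , t∈ , y∈ = cong suc (cong₂ _+_ (treesF-size f i t∈) (markedF-size f j y∈))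
markedF-size (suc f) (suc n) x∈ | inj₂ h | inj₂ h′ with ∈-map-conv⁻ top (treesF f) (treesF f) n h′
... | s , t , refl , i , j , refl , s∈ , t∈ = cong suc (cong₂ _+_ (treesF-size f i s∈) (treesF-size f j t∈))

treesF-unique : ∀ f n → Unique (treesF f n)
treesF-unique zero    n       = []
treesF-unique (suc f) zero    = []
treesF-unique (suc f) (suc n) = Uniqueₚ.++⁺ (leaves-unique n)
  (Uniqueₚ.map⁺ (λ { refl → refl }) (conv-unique (treesF f) (treesF f) n (treesF-unique f) (treesF-unique f)
    (λ {i} {j} a∈ a∈′ → trans (sym (treesF-size f i a∈)) (treesF-size f j a∈′))))
  λ (h , h′) → not-node n h (∈-map-conv⁻ node (treesF f) (treesF f) n h′)
  where
  leaves-unique : ∀ n → Unique (leaves n)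
  leaves-unique zero    = [] ∷ []
  leaves-unique (suc n) = []
  not-node : ∀ n {t} {P : Tree → Tree → Set} → t ∈ leaves n → (∃ λ a → ∃ λ b → t ≡ node a b × P a b) → ⊥
  not-node zero (here refl) (_ , _ , () , _)

markedF-unique : ∀ f n → Unique (markedF f n)
markedF-unique zero    n       = []
markedF-unique (suc f) zero    = []
markedF-unique (suc f) (suc n) = Uniqueₚ.++⁺ (Uniqueₚ.map⁺ (λ { refl → refl }) (conv-unique (markedF f) (treesF f) n (markedF-unique f) (treesF-unique f) sizesᴹ))
  (Uniqueₚ.++⁺ (Uniqueₚ.map⁺ (λ { refl → refl }) (conv-unique (treesF f) (markedF f) n (treesF-unique f) (markedF-unique f) sizes))
    (Uniqueₚ.map⁺ (λ { refl → refl }) (conv-unique (treesF f) (treesF f) n (treesF-unique f) (treesF-unique f) sizes))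
    (λ (h , h′) → ʳ≢top (∈-map-conv⁻ inʳ (treesF f) (markedF f) n h) (∈-map-conv⁻ top (treesF f) (treesF f) n h′)))
  λ (h , h′) → ˡ≢ (∈-map-conv⁻ inˡ (markedF f) (treesF f) n h) (∈ₚ.∈-++⁻ (map (uncurry inʳ) (conv (treesF f) (markedF f) n)) h′)
  where
  sizes : ∀ {i j a} → a ∈ treesF f i → a ∈ treesF f j → i ≡ j
  sizes {i} {j} a∈ a∈′ = trans (sym (treesF-size f i a∈)) (treesF-size f j a∈′)
  sizesᴹ : ∀ {i j a} → a ∈ markedF f i → a ∈ markedF f j → i ≡ j
  sizesᴹ {i} {j} a∈ a∈′ = trans (sym (markedF-size f i a∈)) (markedF-size f j a∈′)
  ʳ≢top : ∀ {x} {P : Tree → Marked → Set} {Q : Tree → Tree → Set} →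
    (∃ λ a → ∃ λ b → x ≡ inʳ a b × P a b) → (∃ λ a → ∃ λ b → x ≡ top a b × Q a b) → ⊥
  ʳ≢top (_ , _ , refl , _) (_ , _ , () , _)
  ˡ≢ : ∀ {x} {P : Marked → Tree → Set} → (∃ λ a → ∃ λ b → x ≡ inˡ a b × P a b) →
    (x ∈ map (uncurry inʳ) (conv (treesF f) (markedF f) n)) ⊎ (x ∈ map (uncurry top) (conv (treesF f) (treesF f) n)) → ⊥
  ˡ≢ (_ , _ , refl , _) (inj₁ h) with ∈-map-conv⁻ inʳ (treesF f) (markedF f) n h
  ... | _ , _ , () , _
  ˡ≢ (_ , _ , refl , _) (inj₂ h) with ∈-map-conv⁻ top (treesF f) (treesF f) n h
  ... | _ , _ , () , _

-- Generating functions of the trees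

wsum : {A : Set} → (A → ℚ) → List A → ℚ
wsum w []       = 0ℚ
wsum w (x ∷ xs) = w x ℚ.+ wsum w xs

wsum-++ : ∀ {A : Set} (w : A → ℚ) xs ys → wsum w (xs ++ ys) ≡ wsum w xs ℚ.+ wsum w ys
wsum-++ w []       ys = sym (ℚₚ.+-identityˡ (wsum w ys))
wsum-++ w (x ∷ xs) ys = trans (cong (w x ℚ.+_) (wsum-++ w xs ys)) (sym (ℚₚ.+-assoc (w x) (wsum w xs) (wsum w ys)))

wsum-map : ∀ {A B : Set} (w : B → ℚ) (f : A → B) xs → wsum w (map f xs) ≡ wsum (w ∘ f) xs
wsum-map w f []       = refl
wsum-map w f (x ∷ xs) = cong (w (f x) ℚ.+_) (wsum-map w f xs)

wsum-cong : ∀ {A : Set} {w v : A → ℚ} → w ≗ v → ∀ xs → wsum w xs ≡ wsum v xs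
wsum-cong e []       = refl
wsum-cong e (x ∷ xs) = cong₂ ℚ._+_ (e x) (wsum-cong e xs)

wsum-zero : ∀ {A : Set} (w : A → ℚ) → (∀ x → w x ≡ 0ℚ) → ∀ xs → wsum w xs ≡ 0ℚ
wsum-zero w e []       = refl
wsum-zero w e (x ∷ xs) = cong₂ ℚ._+_ (e x) (wsum-zero w e xs)

wsum-+ : ∀ {A : Set} (w v : A → ℚ) xs → wsum (λ x → w x ℚ.+ v x) xs ≡ wsum w xs ℚ.+ wsum v xs
wsum-+ w v []       = refl
wsum-+ w v (x ∷ xs) = trans (cong ((w x ℚ.+ v x) ℚ.+_) (wsum-+ w v xs)) (+-interchange (w x) (v x) (wsum w xs) (wsum v xs))

wsum-* : ∀ {A : Set} q (w : A → ℚ) xs → wsum (λ x → q ℚ.* w x) xs ≡ q ℚ.* wsum w xs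
wsum-* q w []       = sym (ℚₚ.*-zeroʳ q)
wsum-* q w (x ∷ xs) = trans (cong (q ℚ.* w x ℚ.+_) (wsum-* q w xs)) (sym (ℚₚ.*-distribˡ-+ q (w x) (wsum w xs)))

wsum-product : ∀ {A B : Set} (w : A → ℚ) (v : B → ℚ) xs ys →
  wsum (λ (a , b) → w a ℚ.* v b) (cartesianProduct xs ys) ≡ wsum w xs ℚ.* wsum v ys
wsum-product w v []       ys = sym (ℚₚ.*-zeroˡ (wsum v ys))
wsum-product w v (x ∷ xs) ys = begin
  wsum wv (map (x ,_) ys ++ cartesianProduct xs ys)
    ≡⟨ wsum-++ wv (map (x ,_) ys) (cartesianProduct xs ys) ⟩
  wsum wv (map (x ,_) ys) ℚ.+ wsum wv (cartesianProduct xs ys)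
    ≡⟨ cong₂ ℚ._+_ (trans (wsum-map wv (x ,_) ys) (wsum-* (w x) v ys)) (wsum-product w v xs ys) ⟩
  w x ℚ.* wsum v ys ℚ.+ wsum w xs ℚ.* wsum v ys
    ≡⟨ ℚₚ.*-distribʳ-+ (wsum v ys) (w x) (wsum w xs) ⟨
  (w x ℚ.+ wsum w xs) ℚ.* wsum v ys ∎
  where
  open ≡-Reasoning
  wv = λ (a , b) → w a ℚ.* v b

genPS : {A : Set} → (ℕ → List A) → (A → ℚ) → PS
genPS F w n = wsum w (F n)

wsum-conv : ∀ {A B : Set} (F : ℕ → List A) (G : ℕ → List B) (w : A → ℚ) (v : B → ℚ) n →
  wsum (λ (a , b) → w a ℚ.* v b) (conv F G n) ≡ mulPS (genPS F w) (genPS G v) n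
wsum-conv F G w v zero    = trans (wsum-product w v (F 0) (G 0)) (sym (mulPS-head (genPS F w) (genPS G v)))
wsum-conv F G w v (suc n) = begin
  wsum wv (cartesianProduct (F 0) (G (suc n)) ++ conv (F ∘ suc) G n)
    ≡⟨ wsum-++ wv (cartesianProduct (F 0) (G (suc n))) (conv (F ∘ suc) G n) ⟩
  wsum wv (cartesianProduct (F 0) (G (suc n))) ℚ.+ wsum wv (conv (F ∘ suc) G n)
    ≡⟨ cong₂ ℚ._+_ (wsum-product w v (F 0) (G (suc n))) (wsum-conv (F ∘ suc) G w v n) ⟩
  genPS F w 0 ℚ.* genPS G v (suc n) ℚ.+ mulPS (genPS F w ∘ suc) (genPS G v) n
    ≡⟨ mulPS-tailˡ (genPS F w) (genPS G v) n ⟨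
  mulPS (genPS F w) (genPS G v) (suc n) ∎
  where
  open ≡-Reasoning
  wv = λ (a , b) → w a ℚ.* v b

module _ {A B C : Set} (c : A → B → C) (F : ℕ → List A) (G : ℕ → List B) (u : C → ℚ) where

  wsum-map-conv : ∀ w v → (∀ a b → u (c a b) ≡ w a ℚ.* v b) → ∀ n →
    wsum u (map (uncurry c) (conv F G n)) ≡ mulPS (genPS F w) (genPS G v) n
  wsum-map-conv w v e n = trans (wsum-map u (uncurry c) (conv F G n))
    (trans (wsum-cong (λ (a , b) → e a b) (conv F G n)) (wsum-conv F G w v n))

  wsum-map-conv₂ : ∀ w v w′ v′ → (∀ a b → u (c a b) ≡ w a ℚ.* v b ℚ.+ w′ a ℚ.* v′ b) → ∀ n →
    wsum u (map (uncurry c) (conv F G n)) ≡ mulPS (genPS F w) (genPS G v) n ℚ.+ mulPS (genPS F w′) (genPS G v′) n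
  wsum-map-conv₂ w v w′ v′ e n = trans (wsum-map u (uncurry c) (conv F G n))
    (trans (wsum-cong (λ (a , b) → e a b) (conv F G n))
      (trans (wsum-+ (λ (a , b) → w a ℚ.* v b) (λ (a , b) → w′ a ℚ.* v′ b) (conv F G n))
        (cong₂ ℚ._+_ (wsum-conv F G w v n) (wsum-conv F G w′ v′ n))))

-- The coefficients of q⁰ and q¹ in qⁿ. This is the origin of the product rules `is0-+` and `is1-+`,
-- the latter in Leibniz form.
is0 is1 : ℕ → ℚ
is0 zero    = 1ℚ
is0 (suc _) = 0ℚ
is1 1 = 1ℚ
is1 _ = 0ℚ

-- An occurrence of 12⋯(k+1) contains k + 1 occurrences of 12⋯k, so a may be ignored when b ≤ 1.
is0-+ : ∀ a b c → (b ≤ 1 → a ≡ 0) → is0 (a + b + c) ≡ is0 b ℚ.* is0 c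
is0-+ a zero          c h rewrite h z≤n = sym (ℚₚ.*-identityˡ (is0 c))
is0-+ a (suc b)       c h rewrite ℕₚ.+-suc a b = sym (ℚₚ.*-zeroˡ (is0 c))

is1-+ : ∀ a b c → (b ≤ 1 → a ≡ 0) → is1 (a + b + c) ≡ is1 b ℚ.* is0 c ℚ.+ is0 b ℚ.* is1 c
is1-+ a zero          c h rewrite h z≤n = sym (trans (cong₂ ℚ._+_ (ℚₚ.*-zeroˡ (is0 c)) (ℚₚ.*-identityˡ (is1 c))) (ℚₚ.+-identityˡ (is1 c)))
is1-+ a (suc zero)    c h rewrite h ℕₚ.≤-refl = sym (trans (cong₂ ℚ._+_ (ℚₚ.*-identityˡ (is0 c)) (ℚₚ.*-zeroˡ (is1 c)))
  (trans (ℚₚ.+-identityʳ (is0 c)) (is0≡ c)))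
  where
  is0≡ : ∀ c → is0 c ≡ is1 (suc c)
  is0≡ zero    = refl
  is0≡ (suc _) = refl
is1-+ a (suc (suc b)) c h rewrite ℕₚ.+-suc a (suc b) | ℕₚ.+-suc a b =
  sym (cong₂ ℚ._+_ (ℚₚ.*-zeroˡ (is0 c)) (ℚₚ.*-zeroˡ (is1 c)))

is0-big : ∀ {n} → 1 ≤ n → is0 n ≡ 0ℚ
is0-big (s≤s _) = refl

is1-big : ∀ {n} → 2 ≤ n → is1 n ≡ 0ℚ
is1-big (s≤s (s≤s _)) = refl

incs-1 : ∀ t → 1 ≤ incs 1 t
incs-1 leaf       = s≤s z≤n
incs-1 (node s t) = ℕₚ.≤-trans (incs-1 s) (ℕₚ.≤-trans (ℕₚ.m≤m+n (incs 1 s) 1) (ℕₚ.m≤m+n _ (incs 1 t)))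

incs-1-node : ∀ s t → 2 ≤ incs 1 (node s t)
incs-1-node s t = ℕₚ.≤-trans (ℕₚ.+-monoˡ-≤ 1 (incs-1 s)) (ℕₚ.m≤m+n (incs 1 s + 1) (incs 1 t))

sum≤1 : ∀ {a b c} → a + b + c ≤ 1 → a ≤ 1 × b ≤ 1 × c ≤ 1
sum≤1 {a} {b} {c} h = ℕₚ.m+n≤o⇒m≤o a ab , ℕₚ.m+n≤o⇒n≤o a ab , ℕₚ.m+n≤o⇒n≤o (a + b) h
  where ab = ℕₚ.m+n≤o⇒m≤o (a + b) h

-- Read off the recursion without going back to words: if the sum is at most 1, so is each summand.
-- At k = 0 a node is excluded because it has more than one letter.
incs-few : ∀ k t → incs (suc k) t ≤ 1 → incs (2 + k) t ≡ 0
incs-few k       leaf       h = refl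
incs-few zero    (node s t) h = ⊥-elim (ℕₚ.<⇒≱ (incs-1-node s t) h)
incs-few (suc k) (node s t) h with sum≤1 {incs (2 + k) s} {incs (1 + k) s} {incs (2 + k) t} h
... | h₁ , h₂ , h₃ = cong₂ _+_ (cong₂ _+_ (incs-few (suc k) s h₁) (incs-few k s h₂)) (incs-few (suc k) t h₃)

incsᴹ-1 : ∀ x → 2 ≤ incsᴹ 1 x
incsᴹ-1 (inˡ x t) = ℕₚ.≤-trans (incsᴹ-1 x) (ℕₚ.≤-trans (ℕₚ.m≤m+n (incsᴹ 1 x) 1) (ℕₚ.m≤m+n _ (incs 1 t)))
incsᴹ-1 (inʳ t x) = ℕₚ.≤-trans (incsᴹ-1 x) (ℕₚ.m≤n+m (incsᴹ 1 x) (incs 1 t + 1))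
incsᴹ-1 (top s t) = ℕₚ.≤-trans (ℕₚ.+-monoˡ-≤ 1 (incs-1 s)) (ℕₚ.m≤m+n (incs 1 s + 1) (incs 1 t + 0))

-- At the marked node a letter of the left part with N is one occurrence of 12, and `crossing 1`
-- supplies a second one. This gives `F2` and `E2`.
incsᴹ-2 : ∀ x → 2 ≤ incsᴹ 2 x
incsᴹ-2 (inˡ x t) = ℕₚ.≤-trans (incsᴹ-2 x) (ℕₚ.≤-trans (ℕₚ.m≤m+n (incsᴹ 2 x) (incsᴹ 1 x)) (ℕₚ.m≤m+n _ (incs 2 t)))
incsᴹ-2 (inʳ t x) = ℕₚ.≤-trans (incsᴹ-2 x) (ℕₚ.m≤n+m (incsᴹ 2 x) (incs 2 t + incs 1 t))
incsᴹ-2 (top s t) = ℕₚ.+-mono-≤ (ℕₚ.≤-trans (incs-1 s) (ℕₚ.m≤n+m (incs 1 s) (incs 2 s))) (ℕₚ.m≤n+m 1 (incs 2 t))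

incsᴹ-few : ∀ k x → incsᴹ (suc k) x ≤ 1 → incsᴹ (2 + k) x ≡ 0
incsᴹ-few zero    x         h = ⊥-elim (ℕₚ.<⇒≱ (incsᴹ-1 x) h)
incsᴹ-few (suc k) (inˡ x t) h with sum≤1 {incsᴹ (2 + k) x} {incsᴹ (1 + k) x} {incs (2 + k) t} h
... | h₁ , h₂ , h₃ = cong₂ _+_ (cong₂ _+_ (incsᴹ-few (suc k) x h₁) (incsᴹ-few k x h₂)) (incs-few (suc k) t h₃)
incsᴹ-few (suc k) (inʳ t x) h with sum≤1 {incs (2 + k) t} {incs (1 + k) t} {incsᴹ (2 + k) x} h
... | h₁ , h₂ , h₃ = cong₂ _+_ (cong₂ _+_ (incs-few (suc k) t h₁) (incs-few k t h₂)) (incsᴹ-few (suc k) x h₃)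
incsᴹ-few (suc k) (top s t) h with sum≤1 {incs (2 + k) s} {incs (1 + k) s} {incs (2 + k) t + crossing (1 + k)} h
... | h₁ , h₂ , h₃ = cong₂ _+_ (cong₂ _+_ (incs-few (suc k) s h₁) (incs-few k s h₂))
  -- The 0 is `crossing (2 + k)`: the pair l r adds nothing to patterns of length 3 or more.
  (cong (_+ 0) (incs-few (suc k) t (ℕₚ.m+n≤o⇒m≤o (incs (2 + k) t) h₃)))

none once : ℕ → Tree → ℚ
none k = is0 ∘ incs k
once k = is1 ∘ incs k

noneᴹ onceᴹ : ℕ → Marked → ℚ
noneᴹ k = is0 ∘ incsᴹ k
onceᴹ k = is1 ∘ incsᴹ k

A B F E : ℕ → Laurent
A k = laurent 0 (genPS trees (none k))
B k = laurent 0 (genPS trees (once k))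
F k = laurent 0 (genPS marked (noneᴹ k))
E k = laurent 0 (genPS marked (onceᴹ k))

mulPS-xL : ∀ s → mulPS (ser xL) s ≗ shiftPS 1 s
mulPS-xL s n = begin
  mulPS (ser xL) s n                  ≡⟨ mulPS-cong {b = s} ser-xL (λ _ → refl) n ⟩
  mulPS (shiftPS 1 (ser oneL)) s n    ≡⟨ mulPS-shiftˡ 1 (ser oneL) s n ⟩
  shiftPS 1 (mulPS (ser oneL) s) n    ≡⟨ shiftPS-cong 1 (λ i → trans (mulPS-constˡ 1ℚ s i) (ℚₚ.*-identityˡ (s i))) n ⟩
  shiftPS 1 s n                       ∎
  where open ≡-Reasoning

-- An equation Y = x W compares coefficients one index apart, which is how the recursions for trees
-- of size n + 1 are phrased.
xL-tail : ∀ {s t : PS} → s 0 ≡ 0ℚ → (∀ n → s (suc n) ≡ t n) → laurent 0 s ≈L xL *L laurent 0 t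
xL-tail {s} {t} e₀ e = cleared λ { zero → trans e₀ (sym (mulPS-xL t 0)) ; (suc n) → trans (e n) (sym (mulPS-xL t (suc n))) }

wsum-leaves : ∀ (w : Tree → ℚ) {q} → w leaf ≡ q → ∀ n → wsum w (leaves n) ≡ ser (constL q) n
wsum-leaves w refl zero    = ℚₚ.+-identityʳ (w leaf)
wsum-leaves w refl (suc n) = refl

genPS-trees : ∀ w {q} → w leaf ≡ q → ∀ n →
  genPS trees w (suc n) ≡ ser (constL q) n ℚ.+ wsum w (map (uncurry node) (conv trees trees n))
genPS-trees w e n = trans (cong (wsum w) (trees-suc n))
  (trans (wsum-++ w (leaves n) (map (uncurry node) (conv trees trees n)))
    (cong (ℚ._+ wsum w (map (uncurry node) (conv trees trees n))) (wsum-leaves w e n)))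

genPS-marked : ∀ w n → genPS marked w (suc n) ≡ wsum w (map (uncurry inˡ) (conv marked trees n)) ℚ.+
  (wsum w (map (uncurry inʳ) (conv trees marked n)) ℚ.+ wsum w (map (uncurry top) (conv trees trees n)))
genPS-marked w n = trans (cong (wsum w) (marked-suc n))
  (trans (wsum-++ w (map (uncurry inˡ) (conv marked trees n)) _)
    (cong (wsum w (map (uncurry inˡ) (conv marked trees n)) ℚ.+_) (wsum-++ w (map (uncurry inʳ) (conv trees marked n)) _)))

A1 : A 1 ≈L zeroL
A1 = ≈L-strict refl λ n → trans (wsum-zero (none 1) (λ t → is0-big (incs-1 t)) (trees n)) (sym (ser-zeroL n))

F2 : F 2 ≈L zeroL
F2 = ≈L-strict refl λ n → trans (wsum-zero (noneᴹ 2) (λ x → is0-big (ℕₚ.<⇒≤ (incsᴹ-2 x))) (marked n)) (sym (ser-zeroL n))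

E2 : E 2 ≈L zeroL
E2 = ≈L-strict refl λ n → trans (wsum-zero (onceᴹ 2) (λ x → is1-big (incsᴹ-2 x)) (marked n)) (sym (ser-zeroL n))

-- Only the leaf has exactly one letter.
B1 : B 1 ≈L xL
B1 = ≈L-trans (xL-tail {t = ser oneL} refl coefficients) (≈L-trans (*L-comm xL oneL) (*L-identityˡ xL))
  where
  coefficients : ∀ n → genPS trees (once 1) (suc n) ≡ ser oneL n
  coefficients n = trans (genPS-trees (once 1) refl n)
    (trans (cong (ser oneL n ℚ.+_) (trans (wsum-map (once 1) (uncurry node) (conv trees trees n))
      (wsum-zero _ (λ (s , t) → is1-big (incs-1-node s t)) (conv trees trees n)))) (ℚₚ.+-identityʳ (ser oneL n)))

A-eq : ∀ k → A (2 + k) ≈L xL *L (oneL +L A (1 + k) *L A (2 + k))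
A-eq k = xL-tail refl λ n → trans (genPS-trees (none (2 + k)) refl n)
  (cong (ser oneL n ℚ.+_) (wsum-map-conv node trees trees (none (2 + k)) (none (1 + k)) (none (2 + k))
    (λ s t → is0-+ (incs (2 + k) s) (incs (1 + k) s) (incs (2 + k) t) (incs-few k s)) n))

-- The leaf contains no pattern of length 2 + k; it contributes 0 here, where it contributed the
-- constant 1 to `A-eq`.
B-eq : ∀ k → B (2 + k) ≈L xL *L (B (1 + k) *L A (2 + k) +L A (1 + k) *L B (2 + k))
B-eq k = xL-tail {t = ser (B (1 + k) *L A (2 + k) +L A (1 + k) *L B (2 + k))} refl λ n → trans (genPS-trees (once (2 + k)) refl n)
  (trans (cong₂ ℚ._+_ (ser-zeroL n) (wsum-map-conv₂ node trees trees (once (2 + k)) (once (1 + k)) (none (2 + k)) (none (1 + k)) (once (2 + k))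
    (λ s t → is1-+ (incs (2 + k) s) (incs (1 + k) s) (incs (2 + k) t) (incs-few k s)) n)) (ℚₚ.+-identityˡ (mulPS (genPS trees (once (1 + k))) (genPS trees (none (2 + k))) n ℚ.+ mulPS (genPS trees (none (1 + k))) (genPS trees (once (2 + k))) n)))

-- The summands belong to `inˡ`, `inʳ` and `top` in this order. At these lengths `crossing` is 0, so
-- `top s t` counts like `node s t`.
F-eq : ∀ k → F (3 + k) ≈L xL *L (F (2 + k) *L A (3 + k) +L (A (2 + k) *L F (3 + k) +L A (2 + k) *L A (3 + k)))
F-eq k = xL-tail refl λ n → trans (genPS-marked u n) (cong₂ ℚ._+_
  (wsum-map-conv inˡ marked trees u (noneᴹ (2 + k)) (none (3 + k)) (λ x t → is0-+ (incsᴹ (3 + k) x) (incsᴹ (2 + k) x) (incs (3 + k) t) (incsᴹ-few (suc k) x)) n)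
  (cong₂ ℚ._+_
    (wsum-map-conv inʳ trees marked u (none (2 + k)) (noneᴹ (3 + k)) (λ t x → is0-+ (incs (3 + k) t) (incs (2 + k) t) (incsᴹ (3 + k) x) (incs-few (suc k) t)) n)
    (wsum-map-conv top trees trees u (none (2 + k)) (none (3 + k)) (λ s t → trans
      (cong (λ i → is0 (incs (3 + k) s + incs (2 + k) s + i)) (ℕₚ.+-identityʳ (incs (3 + k) t)))
      (is0-+ (incs (3 + k) s) (incs (2 + k) s) (incs (3 + k) t) (incs-few (suc k) s))) n)))
  where
  u : Marked → ℚ
  u = noneᴹ (3 + k)

E-eq : ∀ k → E (3 + k) ≈L xL *L ((E (2 + k) *L A (3 + k) +L F (2 + k) *L B (3 + k)) +L
  ((B (2 + k) *L F (3 + k) +L A (2 + k) *L E (3 + k)) +L (B (2 + k) *L A (3 + k) +L A (2 + k) *L B (3 + k))))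
E-eq k = xL-tail refl λ n → trans (genPS-marked u n) (cong₂ ℚ._+_
  (wsum-map-conv₂ inˡ marked trees u (onceᴹ (2 + k)) (none (3 + k)) (noneᴹ (2 + k)) (once (3 + k)) (λ x t → is1-+ (incsᴹ (3 + k) x) (incsᴹ (2 + k) x) (incs (3 + k) t) (incsᴹ-few (suc k) x)) n)
  (cong₂ ℚ._+_
    (wsum-map-conv₂ inʳ trees marked u (once (2 + k)) (noneᴹ (3 + k)) (none (2 + k)) (onceᴹ (3 + k)) (λ t x → is1-+ (incs (3 + k) t) (incs (2 + k) t) (incsᴹ (3 + k) x) (incs-few (suc k) t)) n)
    (wsum-map-conv₂ top trees trees u (once (2 + k)) (none (3 + k)) (none (2 + k)) (once (3 + k)) (λ s t → trans
      (cong (λ i → is1 (incs (3 + k) s + incs (2 + k) s + i)) (ℕₚ.+-identityʳ (incs (3 + k) t)))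
      (is1-+ (incs (3 + k) s) (incs (2 + k) s) (incs (3 + k) t) (incs-few (suc k) s))) n)))
  where
  u : Marked → ℚ
  u = onceᴹ (3 + k)

E-rhs : ∀ k → E (2 + k) ≈L rhs (2 + k)
E-rhs = FunctionalEquations.Solution.E-closed laurentSemiring -L_ +L-inverseʳ xL (constL (+ 2 / 1)) recipL U
  (λ j → sumL j (λ i → U i *L U (suc i)))
  (λ k → sumL k (λ j → ((U (suc j) *L (U (suc j) +L (xL *L U j))) +L (constL (+ 2 / 1) *L xL *L sumL j (λ i → U i *L U (suc i))))
    *L recipL (U (suc j) *L U (suc (suc j)))))
  A B F E twoL ≈L-refl xL-U1 (λ _ → ≈L-refl) U*U-invertible ≈L-refl (λ _ → ≈L-refl) ≈L-refl (λ _ → ≈L-refl)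
  A1 B1 F2 E2 A-eq B-eq F-eq E-eq

-- The permutations counted by ud

countᵇ-filterᵇ : ∀ {A : Set} (p q : A → Bool) xs → countᵇ (λ x → p x ∧ q x) xs ≡ countᵇ q (filterᵇ p xs)
countᵇ-filterᵇ p q []       = refl
countᵇ-filterᵇ p q (x ∷ xs) with p x
... | true  = cong (λ n → (if q x then 1 else 0) + n) (countᵇ-filterᵇ p q xs)
... | false = countᵇ-filterᵇ p q xs

countᵇ-↭ : ∀ {A : Set} (p : A → Bool) {xs ys} → xs ↭ ys → countᵇ p xs ≡ countᵇ p ys
countᵇ-↭ p ↭.refl            = refl
countᵇ-↭ p (↭.prep x h)      = cong (λ n → (if p x then 1 else 0) + n) (countᵇ-↭ p h)
countᵇ-↭ p (↭.swap {xs = xs} {ys = ys} x y h) = begin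
  px + (py + countᵇ p xs)   ≡⟨ ℕₚ.+-assoc px py (countᵇ p xs) ⟨
  px + py + countᵇ p xs     ≡⟨ cong₂ _+_ (ℕₚ.+-comm px py) (countᵇ-↭ p h) ⟩
  py + px + countᵇ p ys     ≡⟨ ℕₚ.+-assoc py px (countᵇ p ys) ⟩
  py + (px + countᵇ p ys)   ∎
  where
  open ≡-Reasoning
  px = if p x then 1 else 0
  py = if p y then 1 else 0
countᵇ-↭ p (↭.trans h h′)    = trans (countᵇ-↭ p h) (countᵇ-↭ p h′)

∧-true : ∀ {a b} → a ∧ b ≡ true → a ≡ true × b ≡ true
∧-true {true} {true} _ = refl , refl

notIn-true : ∀ a bs → notIn a bs ≡ true → All (a ≢_) bs
notIn-true a []       _ = []
notIn-true a (b ∷ bs) h with a ≡ᵇ b in e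
... | false = (λ a≡b → subst T e (ℕₚ.≡⇒≡ᵇ a b a≡b)) ∷ notIn-true a bs h

notIn-true⁻¹ : ∀ {a bs} → All (a ≢_) bs → notIn a bs ≡ true
notIn-true⁻¹ []                = refl
notIn-true⁻¹ {a} {b ∷ bs} (a≢b ∷ h) with a ≡ᵇ b in e
... | false = notIn-true⁻¹ h
... | true  = ⊥-elim (a≢b (ℕₚ.≡ᵇ⇒≡ a b (subst T (sym e) _)))

distinct-true : ∀ xs → distinct xs ≡ true → Unique xs
distinct-true []       _ = []
distinct-true (x ∷ xs) h = notIn-true x xs (proj₁ (∧-true h)) ∷ distinct-true xs (proj₂ (∧-true {notIn x xs} h))

distinct-true⁻¹ : ∀ {xs} → Unique xs → distinct xs ≡ true
distinct-true⁻¹ []      = refl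
distinct-true⁻¹ (h ∷ u) = cong₂ _∧_ (notIn-true⁻¹ h) (distinct-true⁻¹ u)

∈-range⁻ : ∀ n {v} → v ∈ range n → InInterval 0 n v
∈-range⁻ n v∈ with ∈ₚ.∈-map⁻ suc v∈
... | i , i∈ , refl = s≤s z≤n , ∈ₚ.∈-upTo⁻ i∈

∈-range⁺ : ∀ n {v} → InInterval 0 n v → v ∈ range n
∈-range⁺ n {suc i} (_ , i<n) = ∈ₚ.∈-map⁺ suc (∈ₚ.∈-upTo⁺ i<n)

extend : List ℕ → List (List ℕ) → List (List ℕ)
extend as ws = concatMap (λ a → map (a ∷_) ws) as

∈-extend⁻ : ∀ as ws {π} → π ∈ extend as ws → ∃ λ a → ∃ λ w → π ≡ a ∷ w × a ∈ as × w ∈ ws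
∈-extend⁻ (a ∷ as) ws π∈ with ∈ₚ.∈-++⁻ (map (a ∷_) ws) π∈
... | inj₁ h with ∈ₚ.∈-map⁻ (a ∷_) h
...   | w , w∈ , e = a , w , e , here refl , w∈
∈-extend⁻ (a ∷ as) ws π∈ | inj₂ h with ∈-extend⁻ as ws h
... | b , w , e , b∈ , w∈ = b , w , e , there b∈ , w∈

∈-extend⁺ : ∀ {as ws a w} → a ∈ as → w ∈ ws → a ∷ w ∈ extend as ws
∈-extend⁺ {a ∷ as} {ws} (here refl) w∈ = ∈ₚ.∈-++⁺ˡ (∈ₚ.∈-map⁺ (a ∷_) w∈)
∈-extend⁺ {a ∷ as} {ws} (there b∈)  w∈ = ∈ₚ.∈-++⁺ʳ (map (a ∷_) ws) (∈-extend⁺ b∈ w∈)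

extend-unique : ∀ {as ws} → Unique as → Unique ws → Unique (extend as ws)
extend-unique                []      uw = []
extend-unique {a ∷ as} {ws} (h ∷ u) uw = Uniqueₚ.++⁺ (Uniqueₚ.map⁺ Listₚ.∷-injectiveʳ uw) (extend-unique u uw)
  λ (π∈ , π∈′) → clash (∈ₚ.∈-map⁻ (a ∷_) π∈) (∈-extend⁻ as ws π∈′)
  where
  clash : ∀ {π} → (∃ λ w → w ∈ ws × π ≡ a ∷ w) → (∃ λ b → ∃ λ w → π ≡ b ∷ w × b ∈ as × w ∈ ws) → ⊥
  clash (_ , _ , refl) (_ , _ , refl , a∈ , _) = All.lookup h a∈ refl

words-unique : ∀ l n → Unique (words l n)
words-unique zero    n = [] ∷ []
words-unique (suc l) n = extend-unique (Uniqueₚ.map⁺ ℕₚ.suc-injective (Uniqueₚ.upTo⁺ n)) (words-unique l n)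

∈-words⁻ : ∀ l n {π} → π ∈ words l n → length π ≡ l × All (InInterval 0 n) π
∈-words⁻ zero    n (here refl) = refl , []
∈-words⁻ (suc l) n π∈ with ∈-extend⁻ (range n) (words l n) π∈
... | a , w , refl , a∈ , w∈ with ∈-words⁻ l n w∈
...   | e , b = cong suc e , ∈-range⁻ n a∈ ∷ b

∈-words⁺ : ∀ n {π} → All (InInterval 0 n) π → π ∈ words (length π) n
∈-words⁺ n []      = here refl
∈-words⁺ n (h ∷ b) = ∈-extend⁺ (∈-range⁺ n h) (∈-words⁺ n b)

-- The conditions of `ud` that do not mention k; one bijection with marked trees then serves every
-- k.
valid : List ℕ → Bool
valid π = distinct π ∧ upDown π ∧ (occ p132 π ≡ᵇ 1)

sizeᴹ-3 : ∀ x → 3 ≤ sizeᴹ x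
sizeᴹ-3 (inˡ x t) = ℕₚ.≤-trans (sizeᴹ-3 x) (ℕₚ.m≤n⇒m≤1+n (ℕₚ.m≤m+n (sizeᴹ x) (size t)))
sizeᴹ-3 (inʳ t x) = ℕₚ.≤-trans (sizeᴹ-3 x) (ℕₚ.m≤n⇒m≤1+n (ℕₚ.m≤n+m (sizeᴹ x) (size t)))
sizeᴹ-3 (top s t) = s≤s (ℕₚ.+-mono-≤ (size-pos s) (size-pos t))

T-true : ∀ {b} → T b → b ≡ true
T-true {true} _ = refl

valid-wordᴹ : ∀ x → valid (wordᴹ x 0) ≡ true
valid-wordᴹ x = cong₂ _∧_ (distinct-true⁻¹ (arrangement-unique {0} {sizeᴹ x} (wordᴹ-arrangement x 0)))
  (cong₂ _∧_ (cong₂ _∧_ (T-true (ℕₚ.≤⇒≤ᵇ (subst (3 ≤_) (sym (wordᴹ-length x 0)) (sizeᴹ-3 x)))) (wordᴹ-altUp x 0))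
             (cong (_≡ᵇ 1) (trans (occ-132 (wordᴹ x 0)) (wordᴹ-c132 x 0))))

valid-words : ℕ → List (List ℕ)
valid-words n = filterᵇ valid (words n n)

marked-words : ℕ → List (List ℕ)
marked-words n = map (λ x → wordᴹ x 0) (marked n)

valid⇒marked : ∀ n {π} → π ∈ valid-words n → π ∈ marked-words n
valid⇒marked n {π} π∈ with ∈ₚ.∈-filter⁻ (λ w → T? (valid w)) {xs = words n n} π∈
... | π∈words , v with ∈-words⁻ n n π∈words | ∧-true {distinct π} (T-true v)
...   | len , bounds | d , v′ with ∧-true {upDown π} v′
...     | ud , c with wordᴹ-complete n ℕₚ.≤-refl (arrangement (distinct-true π d) bounds len)
                        (proj₂ (∧-true {3 ≤ᵇ length π} ud))
                        (trans (sym (occ-132 π)) (ℕₚ.≡ᵇ⇒≡ (occ p132 π) 1 (subst T (sym c) _)))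
...       | x , refl = ∈ₚ.∈-map⁺ (λ x → wordᴹ x 0)
  (subst (λ m → x ∈ marked m) (trans (sym (wordᴹ-length x 0)) len) (markedF-complete (sizeᴹ x) x ℕₚ.≤-refl))

marked⇒valid : ∀ n {π} → π ∈ marked-words n → π ∈ valid-words n
marked⇒valid n π∈ with ∈ₚ.∈-map⁻ (λ x → wordᴹ x 0) π∈
... | x , x∈ , refl with markedF-size n n x∈
...   | refl = ∈ₚ.∈-filter⁺ (λ w → T? (valid w))
  (subst (λ l → wordᴹ x 0 ∈ words l (sizeᴹ x)) (wordᴹ-length x 0)
    (∈-words⁺ (sizeᴹ x) (arrangement-bounds {0} {sizeᴹ x} (wordᴹ-arrangement x 0))))
  (subst T (sym (valid-wordᴹ x)) _)

-- Two lists without repetitions and with the same members agree up to order, which is enough for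
-- counting.
valid↭marked : ∀ n → valid-words n ↭ marked-words n
valid↭marked n = ∼bag⇒↭ (unique∧set⇒bag
  (Uniqueₚ.filter⁺ (λ w → T? (valid w)) (words-unique n n))
  (Uniqueₚ.map⁺ (λ {x} {y} → wordᴹ-injective x y 0) (markedF-unique n n))
  (mk⇔ (valid⇒marked n) (marked⇒valid n)))

ud-marked : ∀ k n → ud k n ≡ countᵇ (λ x → incsᴹ k x ≡ᵇ 1) (marked n)
ud-marked k n = begin
  ud k n
    ≡⟨ countᵇ-cong (λ π → regroup (distinct π) (upDown π) (occ p132 π ≡ᵇ 1) (occ (inc k) π ≡ᵇ 1)) (words n n) ⟩
  countᵇ (λ π → valid π ∧ (occ (inc k) π ≡ᵇ 1)) (words n n)
    ≡⟨ countᵇ-filterᵇ valid (λ π → occ (inc k) π ≡ᵇ 1) (words n n) ⟩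
  countᵇ (λ π → occ (inc k) π ≡ᵇ 1) (valid-words n)
    ≡⟨ countᵇ-↭ (λ π → occ (inc k) π ≡ᵇ 1) (valid↭marked n) ⟩
  countᵇ (λ π → occ (inc k) π ≡ᵇ 1) (marked-words n)
    ≡⟨ countᵇ-map (λ π → occ (inc k) π ≡ᵇ 1) (λ x → wordᴹ x 0) (marked n) ⟩
  countᵇ (λ x → occ (inc k) (wordᴹ x 0) ≡ᵇ 1) (marked n)
    ≡⟨ countᵇ-cong (λ x → cong (_≡ᵇ 1) (trans (occ-inc k (wordᴹ x 0)) (wordᴹ-ci k x 0))) (marked n) ⟩
  countᵇ (λ x → incsᴹ k x ≡ᵇ 1) (marked n) ∎
  where
  open ≡-Reasoning
  regroup : ∀ a b c d → (a ∧ b ∧ c ∧ d) ≡ ((a ∧ b ∧ c) ∧ d)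
  regroup true  true  c d = refl
  regroup true  false c d = refl
  regroup false b     c d = refl

-- `_/_` reduces to lowest terms, so the identity is checked between unnormalised fractions.
suc/1 : ∀ n → + suc n / 1 ≡ 1ℚ ℚ.+ (+ n / 1)
suc/1 n = ℚₚ.toℚᵘ-injective (begin
  ℚ.toℚᵘ (+ suc n / 1)                ≈⟨ ℚₚ.toℚᵘ-fromℚᵘ (ℚᵘ.mkℚᵘ (+ suc n) 0) ⟩
  ℚᵘ.mkℚᵘ (+ suc n) 0                 ≈⟨ ℚᵘ.*≡* (cong (λ i → (+ 1 ℤ.+ i) ℤ.* + 1) (sym (ℤₚ.*-identityʳ (+ n)))) ⟩
  ℚᵘ.1ℚᵘ ℚᵘ.+ ℚᵘ.mkℚᵘ (+ n) 0         ≈⟨ ℚᵘₚ.+-congʳ ℚᵘ.1ℚᵘ (ℚᵘₚ.≃-sym (ℚₚ.toℚᵘ-fromℚᵘ (ℚᵘ.mkℚᵘ (+ n) 0))) ⟩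
  ℚ.toℚᵘ 1ℚ ℚᵘ.+ ℚ.toℚᵘ (+ n / 1)     ≈⟨ ℚᵘₚ.≃-sym (ℚₚ.toℚᵘ-homo-+ 1ℚ (+ n / 1)) ⟩
  ℚ.toℚᵘ (1ℚ ℚ.+ (+ n / 1))           ∎)
  where open SetoidReasoning ℚᵘₚ.≃-setoid

count-wsum : ∀ {A : Set} (f : A → ℕ) xs → + countᵇ (λ x → f x ≡ᵇ 1) xs / 1 ≡ wsum (is1 ∘ f) xs
count-wsum f []       = refl
count-wsum f (x ∷ xs) with f x
... | zero        = trans (count-wsum f xs) (sym (ℚₚ.+-identityˡ (wsum (is1 ∘ f) xs)))
... | suc zero    = trans (suc/1 (countᵇ (λ x → f x ≡ᵇ 1) xs)) (cong (1ℚ ℚ.+_) (count-wsum f xs))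
... | suc (suc _) = trans (count-wsum f xs) (sym (ℚₚ.+-identityˡ (wsum (is1 ∘ f) xs)))

gf-ud : ∀ k → gf (ud k) ≈L E k
gf-ud k = ≈L-strict refl λ n → trans (cong (λ c → + c / 1) (ud-marked k n)) (count-wsum (incsᴹ k) (marked n))

theorem5p1 : (k : ℕ) → 2 ≤ k → (e : ℤ) → coeffL (gf (ud k)) e ≡ coeffL (rhs k) e
theorem5p1 (suc (suc k)) 2≤k e = coeffL-cong (≈L-trans (gf-ud (2 + k)) (E-rhs k)) e
theorem5p1 (suc zero) (s≤s ()) e
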